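{- Let $G\cong C_p^2\times C_q^2$ for distinct odd primes $p,q$, and let $\mathcal{A}$ be a primitive rational S-ring over $G$ of rank at least $3$. Then $\mathcal{A}$ has a basic set of the form $H_1\setminus\{e\}\cup\cdots\cup H_m\setminus\{e\}$, where each $H_i\le G$ has order $pq$ and $H_i\cap H_j=\{e\}$ for $i\ne j$.
   Context: An S-ring over $G$ is a subring $\mathcal{A}\subseteq\mathbb{Z}G$ spanned by $\underline{X}=\sum_{x\in X}x$ for $X$ in a partition of $G$ (basic sets) containing $\{e\}$ and closed under $X\mapsto X^{ -1}$; its rank is the number of basic sets. $\mathcal{A}$ is primitive if no subgroup $H\ne\{e\},G$ satisfies $\underline H\in\mathcal{A}$. $\mathcal{A}$ is rational if every basic set $X$ satisfies $\{x^m:x\in X\}=X$ for all integers $m$ coprime to $\exp(G)$. -}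

module Defs where

open import Data.Nat using (ℕ; zero; suc; _+_; _*_; _∸_; NonZero)
open import Data.Nat.DivMod using (_mod_)
open import Data.Nat.Primality using (Prime; prime⇒nonZero)
open import Data.Nat.Coprimality using (Coprime)
open import Data.Fin using (Fin; toℕ)
open import Data.Fin.Properties using () renaming (_≟_ to _≟F_)
open import Data.Bool using (Bool; true; false)
open import Data.List using (List; []; _∷_; concatMap; map; filter; length; allFin)
open import Data.Product using (Σ; ∃; _×_; _,_)
open import Data.Product.Properties using (≡-dec)
open import Data.Sum using (_⊎_)
open import Data.Empty using (⊥)
open import Relation.Nullary using (¬_; Dec)
open import Relation.Nullary.Decidable using (_×-dec_)
open import Relation.Binary.PropositionalEquality using (_≡_; _≢_)

-- The group  G = C_p² × C_q²  realised additively as  ℤ/p × ℤ/p × ℤ/q × ℤ/q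
-- (the group is written additively: e = 0, xy = x + y, x⁻¹ = - x, x^m = m · x).
module Over (p q : ℕ) (pp : Prime p) (qq : Prime q) where

  private instance
    nzp : NonZero p
    nzp = prime⇒nonZero pp
    nzq : NonZero q
    nzq = prime⇒nonZero qq

  addₙ : ∀ n .{{_ : NonZero n}} → Fin n → Fin n → Fin n
  addₙ n a b = (toℕ a + toℕ b) mod n

  negₙ : ∀ n .{{_ : NonZero n}} → Fin n → Fin n
  negₙ n a = (n ∸ toℕ a) mod n

  zeroₙ : ∀ n .{{_ : NonZero n}} → Fin n
  zeroₙ n = 0 mod n

  scaleₙ : ∀ n .{{_ : NonZero n}} → ℕ → Fin n → Fin n
  scaleₙ n m a = (m * toℕ a) mod n

  G : Set
  G = Fin p × Fin p × Fin q × Fin q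

  e : G
  e = zeroₙ p , zeroₙ p , zeroₙ q , zeroₙ q

  _·_ : G → G → G
  (a , b , c , d) · (a' , b' , c' , d') =
    addₙ p a a' , addₙ p b b' , addₙ q c c' , addₙ q d d'

  inv : G → G
  inv (a , b , c , d) = negₙ p a , negₙ p b , negₙ q c , negₙ q d

  pow : G → ℕ → G
  pow (a , b , c , d) m = scaleₙ p m a , scaleₙ p m b , scaleₙ q m c , scaleₙ q m d

  _≟G_ : (x y : G) → Dec (x ≡ y)
  _≟G_ = ≡-dec _≟F_ (≡-dec _≟F_ (≡-dec _≟F_ _≟F_))

  elems : List G
  elems = concatMap (λ a → concatMap (λ b → concatMap (λ c → map (λ d → a , b , c , d)
            (allFin q)) (allFin q)) (allFin p)) (allFin p)

  count : (P : G → Set) → ((x : G) → Dec (P x)) → ℕ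
  count P P? = length (filter P? elems)

  record IsSubgroup (H : G → Bool) : Set where
    field
      has-e   : H e ≡ true
      has-mul : (x y : G) → H x ≡ true → H y ≡ true → H (x · y) ≡ true
      has-inv : (x : G) → H x ≡ true → H (inv x) ≡ true

  -- A partition of G into r blocks is given by a surjective labelling
  -- c : G → Fin r; the basic set with label i is  { x | c x ≡ i }.
  module _ {r : ℕ} (c : G → Fin r) where

    IsPartition : Set
    IsPartition = (i : Fin r) → ∃ λ x → c x ≡ i

    -- coefficient of z in  X̲_i · X̲_j :  #{ (x , y) ∈ X_i × X_j | x y = z }
    --   = #{ x ∈ X_i | x⁻¹ z ∈ X_j }
    structConst : Fin r → Fin r → G → ℕ
    structConst i j z =
      count (λ x → (c x ≡ i) × (c (inv x · z) ≡ j))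
            (λ x → (c x ≟F i) ×-dec (c (inv x · z) ≟F j))

    -- S-ring: partition with {e} a basic set, closed under X ↦ X⁻¹, and whose
    -- ℤ-span is closed under multiplication (X̲_i X̲_j is a ℤ-combination of
    -- the X̲_k, i.e. its coefficient function is constant on each basic set).
    record IsSRing : Set where
      field
        partition   : IsPartition
        identity    : (x : G) → c x ≡ c e → x ≡ e
        inverse     : (x y : G) → c x ≡ c y → c (inv x) ≡ c (inv y)
        mult-closed : (i j : Fin r) (z w : G) → c z ≡ c w →
                      structConst i j z ≡ structConst i j w

    -- H̲ ∈ 𝒜  iff  H is a union of basic sets
    InSRing : (G → Bool) → Set
    InSRing H = (x y : G) → c x ≡ c y → H x ≡ H y

    IsPrimitive : Set
    IsPrimitive = (H : G → Bool) → IsSubgroup H → InSRing H →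
                  ¬ ((∃ λ x → H x ≡ true × x ≢ e) × (∃ λ y → H y ≡ false))

    -- rational: for every m coprime to exp(G) = p q and every basic set X,
    -- X^(m) = { x^m | x ∈ X } equals X.
    IsRational : Set
    IsRational = (m : ℕ) → Coprime m (p * q) → (i : Fin r) →
                 ((x : G) → c x ≡ i → c (pow x m) ≡ i) ×
                 ((y : G) → c y ≡ i → ∃ λ x → c x ≡ i × pow x m ≡ y)

  order : (H : G → Bool) → ℕ
  order H = count (λ x → H x ≡ true) (λ x → Data.Bool._≟_ (H x) true)
    where import Data.Bool

module Submission where

-- Rationality makes every basic set a union of sets of generators of cyclic subgroups, so the
-- basic sets colour the lines of C_p² and of C_q² (vertices) and the pairs of such lines (edges)
-- of the complete bipartite graph K_{p+1,q+1}.  By Schur's theorem on p-th powers (Frobenius in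
-- characteristic p) and primitivity, every vertex has one special edge of its own colour while
-- all its other edges share one colour, its major colour.  A colour f that is nowhere major then
-- sits on a matching: the basic set of f is the union of the H∖{e}, where H = A × B for the
-- matched lines A, B.
--
-- If there is no such f, then (p ≠ q and both sides have at least 4 vertices) all majors agree
-- except at one line of C_p² and one of C_q² at most, so the rank is 3 or some basic set lies in a proper
-- subgroup; the latter contradicts primitivity.  In rank 3 the homomorphisms of 𝒜 to ℤ attached
-- to the index p subgroups A × C_q² and the index q subgroups C_p² × B take at most two values
-- on a basic set, being roots of one quadratic equation; the exceptional configurations give
-- three.

-- The pattern at a vertex is a count. For y ≠ 0 in C_q², the elements of a basic set X in the coset
-- C_p² y are exactly the p-th roots in X of y^p, so by Schur's theorem their number modulo p
-- depends only on the basic set of y^p. Primitivity forces that basic set out of C_q², where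
-- nothing is a p-th power; hence the number is divisible by p. By rationality it is also [y ∈ X] +
-- (p - 1) N, where N counts the edges coloured X at the line of y. So N ≡ [y ∈ X] mod p, and p + 1
-- edges leave only the stated pattern.
--
-- The homomorphisms to ℤ are character values, but no root of unity occurs: a function on ℤ/n of
-- sum zero, pulled back to G, is an eigenfunction of convolution with a basic set, and the
-- eigenvalue is the integer wanted. Oddness of p and q enters through p, q ≥ 3 and through |p - q|
-- ≥ 2, which keeps the weight of an exceptional row apart from that of an exceptional column.

open import Data.Bool using (Bool; true; false)
open import Data.Empty using (⊥; ⊥-elim)
open import Data.Fin using (Fin; zero; suc; toℕ)
open import Data.Fin.Properties using () renaming (_≟_ to _≟F_)
open import Data.Integer as ℤ using (ℤ; +_; 0ℤ; 1ℤ)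
import Data.Integer.Properties as ℤ
open import Data.Integer.Tactic.RingSolver using (solve-∀)
open import Data.List using (List; []; _∷_; allFin)
open import Data.Nat as ℕ using (ℕ; zero; suc; NonZero; s≤s; z≤n)
import Data.Nat.Properties as ℕ
import Data.Nat.Tactic.RingSolver as ℕSolver
open import Data.Nat.Primality using (Prime)
open import Data.Product using (∃; ∃₂; _×_; _,_; proj₁; proj₂)
open import Data.Sum using (_⊎_; inj₁; inj₂)
open import Function using (_∘_)
open import Function.Bundles using (_⇔_)
open import Relation.Binary.PropositionalEquality
open import Relation.Nullary using (¬_; Dec; yes; no; does)
open import Defs

-- Finite sums of integers and indicator functions.

module FiniteSums where

  open import Data.Bool using (if_then_else_)
  open import Data.Integer using (_+_; _*_; _≤_; +≤+)
  open import Data.Integer.Properties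
  open import Data.List using (_++_; map; concatMap; filter; length; tabulate)
  open import Relation.Binary using (DecidableEquality)
  open import Relation.Nullary.Decidable using (_×-dec_; dec-true; dec-false)
  open import Relation.Unary using (Decidable)

  open ≡-Reasoning

  +ℤ-congˡ : ∀ i {j k} → j ≡ k → i + j ≡ i + k
  +ℤ-congˡ i = cong (λ x → i + x)

  private variable
    A B : Set
    P Q : Set

  ∑ : List A → (A → ℤ) → ℤ
  ∑ []       f = 0ℤ
  ∑ (x ∷ xs) f = f x + ∑ xs f

  𝟙 : Dec P → ℤ
  𝟙 d = if does d then 1ℤ else 0ℤ

  𝟙-yes : (d : Dec P) → P → 𝟙 d ≡ 1ℤ
  𝟙-yes d p rewrite dec-true d p = refl

  𝟙-no : (d : Dec P) → ¬ P → 𝟙 d ≡ 0ℤ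
  𝟙-no d ¬p rewrite dec-false d ¬p = refl

  𝟙-⇔ : (d : Dec P) (d′ : Dec Q) → (P → Q) → (Q → P) → 𝟙 d ≡ 𝟙 d′
  𝟙-⇔ (yes p) d′ f g = sym (𝟙-yes d′ (f p))
  𝟙-⇔ (no ¬p) d′ f g = sym (𝟙-no d′ (¬p ∘ g))

  𝟙-× : (d : Dec P) (d′ : Dec Q) → 𝟙 (d ×-dec d′) ≡ 𝟙 d * 𝟙 d′
  𝟙-× (yes _) (yes _) = refl
  𝟙-× (yes _) (no _)  = refl
  𝟙-× (no _)  (yes _) = refl
  𝟙-× (no _)  (no _)  = refl

  𝟙-≥0 : (d : Dec P) → 0ℤ ≤ 𝟙 d
  𝟙-≥0 (yes _) = +≤+ z≤n
  𝟙-≥0 (no _)  = ≤-refl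

  𝟙-mono : (d : Dec P) (d′ : Dec Q) → (P → Q) → 𝟙 d ≤ 𝟙 d′
  𝟙-mono (yes p) d′ f = ≤-reflexive (sym (𝟙-yes d′ (f p)))
  𝟙-mono (no _)  d′ f = 𝟙-≥0 d′

  ∑-cong : (xs : List A) {f g : A → ℤ} → (∀ x → f x ≡ g x) → ∑ xs f ≡ ∑ xs g
  ∑-cong []       f≗g = refl
  ∑-cong (x ∷ xs) f≗g = cong₂ _+_ (f≗g x) (∑-cong xs f≗g)

  ∑-mono : (xs : List A) {f g : A → ℤ} → (∀ x → f x ≤ g x) → ∑ xs f ≤ ∑ xs g
  ∑-mono []       f≤g = ≤-refl
  ∑-mono (x ∷ xs) f≤g = +-mono-≤ (f≤g x) (∑-mono xs f≤g)

  ∑-0 : (xs : List A) → ∑ xs (λ _ → 0ℤ) ≡ 0ℤ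
  ∑-0 []       = refl
  ∑-0 (x ∷ xs) = trans (+-identityˡ _) (∑-0 xs)

  ∑-+ : (xs : List A) (f g : A → ℤ) → ∑ xs (λ x → f x + g x) ≡ ∑ xs f + ∑ xs g
  ∑-+ []       f g = refl
  ∑-+ (x ∷ xs) f g rewrite ∑-+ xs f g = interchange (f x) (g x) (∑ xs f) (∑ xs g)
    where
    interchange : ∀ a b c d → a + b + (c + d) ≡ a + c + (b + d)
    interchange = solve-∀

  ∑-*ˡ : (xs : List A) (k : ℤ) (f : A → ℤ) → ∑ xs (λ x → k * f x) ≡ k * ∑ xs f
  ∑-*ˡ []       k f = sym (*-zeroʳ k)
  ∑-*ˡ (x ∷ xs) k f rewrite ∑-*ˡ xs k f = sym (*-distribˡ-+ k (f x) (∑ xs f))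

  ∑-*ʳ : (xs : List A) (k : ℤ) (f : A → ℤ) → ∑ xs (λ x → f x * k) ≡ ∑ xs f * k
  ∑-*ʳ xs k f = trans (∑-cong xs (λ x → *-comm (f x) k)) (trans (∑-*ˡ xs k f) (*-comm k _))

  ∑-swap : (xs : List A) (ys : List B) (f : A → B → ℤ) →
           ∑ xs (λ x → ∑ ys (f x)) ≡ ∑ ys (λ y → ∑ xs (λ x → f x y))
  ∑-swap []       ys f = sym (∑-0 ys)
  ∑-swap (x ∷ xs) ys f rewrite ∑-swap xs ys f = sym (∑-+ ys (f x) _)

  ∑-++ : (xs ys : List A) (f : A → ℤ) → ∑ (xs ++ ys) f ≡ ∑ xs f + ∑ ys f
  ∑-++ []       ys f = sym (+-identityˡ _)
  ∑-++ (x ∷ xs) ys f rewrite ∑-++ xs ys f = sym (+-assoc (f x) _ _)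

  ∑-map : (h : A → B) (xs : List A) (f : B → ℤ) → ∑ (map h xs) f ≡ ∑ xs (f ∘ h)
  ∑-map h []       f = refl
  ∑-map h (x ∷ xs) f = +ℤ-congˡ (f (h x)) (∑-map h xs f)

  ∑-concatMap : (h : A → List B) (xs : List A) (f : B → ℤ) →
                ∑ (concatMap h xs) f ≡ ∑ xs (λ x → ∑ (h x) f)
  ∑-concatMap h []       f = refl
  ∑-concatMap h (x ∷ xs) f = trans (∑-++ (h x) (concatMap h xs) f)
                                   (+ℤ-congˡ (∑ (h x) f) (∑-concatMap h xs f))

  module _ {R : A → Set} (R? : Decidable R) where

    ∑-filter : (xs : List A) (f : A → ℤ) → ∑ (filter R? xs) f ≡ ∑ xs (λ x → 𝟙 (R? x) * f x)
    ∑-filter []       f = refl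
    ∑-filter (x ∷ xs) f with R? x
    ... | yes _ = cong₂ _+_ (sym (*-identityˡ (f x))) (∑-filter xs f)
    ... | no _  = trans (∑-filter xs f) (sym (+-identityˡ _))

    length-filter : (xs : List A) → + length (filter R? xs) ≡ ∑ xs (𝟙 ∘ R?)
    length-filter []       = refl
    length-filter (x ∷ xs) with R? x
    ... | yes _ = +ℤ-congˡ 1ℤ (length-filter xs)
    ... | no _  = trans (length-filter xs) (sym (+-identityˡ _))

    ∑𝟙-witness : (xs : List A) → ∑ xs (𝟙 ∘ R?) ≢ 0ℤ → ∃ R
    ∑𝟙-witness []       s≢0 = ⊥-elim (s≢0 refl)
    ∑𝟙-witness (x ∷ xs) s≢0 with R? x
    ... | yes r = x , r
    ... | no _  = ∑𝟙-witness xs (s≢0 ∘ trans (+-identityˡ _))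

  -- Each element occurs exactly once, encoded as the sifting property of delta functions. Sums
  -- consume it in this form, which spares membership and uniqueness proofs.
  record Enumerates {A : Set} (_≟_ : DecidableEquality A) (xs : List A) : Set where
    constructor enumerates
    field pick : ∀ g (f : A → ℤ) → ∑ xs (λ x → 𝟙 (x ≟ g) * f x) ≡ f g
  open Enumerates public

  module _ {_≟_ : DecidableEquality A} {xs : List A} (enum : Enumerates _≟_ xs) where

    ∑-point : ∀ g → ∑ xs (λ x → 𝟙 (x ≟ g)) ≡ 1ℤ
    ∑-point g = trans (∑-cong xs (λ x → sym (*-identityʳ _))) (pick enum g (λ _ → 1ℤ))

    ∑-zero-except : ∀ g (f : A → ℤ) → (∀ x → x ≢ g → f x ≡ 0ℤ) → ∑ xs f ≡ f g
    ∑-zero-except g f off = trans (∑-cong xs lem) (pick enum g f)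
      where
      lem : ∀ x → f x ≡ 𝟙 (x ≟ g) * f x
      lem x with x ≟ g
      ... | yes _   = sym (*-identityˡ (f x))
      ... | no x≢g  = off x x≢g

    ∑𝟙-positive : {R : A → Set} (R? : Decidable R) → ∀ {g} → R g → 1ℤ ≤ ∑ xs (𝟙 ∘ R?)
    ∑𝟙-positive {R} R? {g} r = subst (_≤ ∑ xs (𝟙 ∘ R?)) (∑-point g)
      (∑-mono xs (λ x → 𝟙-mono (x ≟ g) (R? x) (λ x≡g → subst R (sym x≡g) r)))

  -- Double counting of the pairs `(a , b)` with `f a ≡ b`, each weighted by `g b`: there is one
  -- pair for every `a` and one for every `b`.
  ∑-reindex : {_≟A_ : DecidableEquality A} {_≟B_ : DecidableEquality B} {xs : List A} {ys : List B} →
              Enumerates _≟A_ xs → Enumerates _≟B_ ys →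
              (f : A → B) (f⁻¹ : B → A) → (∀ a → f⁻¹ (f a) ≡ a) → (∀ b → f (f⁻¹ b) ≡ b) →
              (g : B → ℤ) → ∑ xs (g ∘ f) ≡ ∑ ys g
  ∑-reindex {_≟A_ = _≟A_} {_≟B_} {xs} {ys} enumA enumB f f⁻¹ left right g = sym (begin
    ∑ ys g
      ≡⟨ ∑-cong ys (λ b → pick enumA (f⁻¹ b) (λ _ → g b)) ⟨
    ∑ ys (λ b → ∑ xs (λ a → 𝟙 (a ≟A f⁻¹ b) * g b))
      ≡⟨ ∑-swap ys xs _ ⟩
    ∑ xs (λ a → ∑ ys (λ b → 𝟙 (a ≟A f⁻¹ b) * g b))
      ≡⟨ ∑-cong xs (λ a → ∑-cong ys (λ b → cong (_* g b)
           (𝟙-⇔ (a ≟A f⁻¹ b) (b ≟B f a)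
             (λ e → trans (sym (right b)) (cong f (sym e)))
             (λ e → trans (sym (left a)) (cong f⁻¹ (sym e)))))) ⟩
    ∑ xs (λ a → ∑ ys (λ b → 𝟙 (b ≟B f a) * g b))
      ≡⟨ ∑-cong xs (λ a → pick enumB (f a) g) ⟩
    ∑ xs (g ∘ f) ∎)

  ∑-tabulate : ∀ {n} (h : Fin n → A) (f : A → ℤ) → ∑ (tabulate h) f ≡ ∑ (allFin n) (f ∘ h)
  ∑-tabulate {n = zero}  h f = refl
  ∑-tabulate {n = suc n} h f = +ℤ-congˡ (f (h zero))
    (trans (∑-tabulate (h ∘ suc) f) (sym (∑-tabulate suc (f ∘ h))))

  ∑-allFin-suc : ∀ {n} (f : Fin (suc n) → ℤ) → ∑ (allFin (suc n)) f ≡ f zero + ∑ (allFin n) (f ∘ suc)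
  ∑-allFin-suc f = +ℤ-congˡ (f zero) (∑-tabulate suc f)

  enumerates-allFin : ∀ n → Enumerates _≟F_ (allFin n)
  enumerates-allFin n = enumerates (go n)
    where
    go : ∀ n g (f : Fin n → ℤ) → ∑ (allFin n) (λ x → 𝟙 (x ≟F g) * f x) ≡ f g
    go (suc n) zero f = trans (∑-allFin-suc {n} (λ x → 𝟙 (x ≟F zero) * f x))
      (trans (cong₂ _+_ (*-identityˡ (f zero)) (∑-0 (allFin n))) (+-identityʳ _))
    go (suc n) (suc g) f = trans (∑-allFin-suc {n} (λ x → 𝟙 (x ≟F suc g) * f x))
      (trans (+-identityˡ _)
        (trans (∑-cong (allFin n) (λ x → cong (_* f (suc x))
                 (𝟙-⇔ (suc x ≟F suc g) (x ≟F g) (λ { refl → refl }) (λ { refl → refl }))))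
               (go n g (f ∘ suc))))

  ∑-const : ∀ n k → ∑ (allFin n) (λ _ → k) ≡ + n * k
  ∑-const zero    k = refl
  ∑-const (suc n) k = trans (∑-allFin-suc {n} (λ _ → k)) (trans (+ℤ-congˡ k (∑-const n k)) (sym (suc-* (+ n) k)))

-- The Frobenius map on monoid semirings modulo a prime.

module Frobenius where

  open import Algebra.Bundles using (CommutativeSemiring)
  open import Algebra.Structures using (IsCommutativeMonoid)
  open import Algebra.Structures.Biased using (isCommutativeSemiringˡ)
  open import Algebra.Core using (Op₂)
  open import Data.Fin using (inject₁; fromℕ)
  open import Data.Fin.Properties using (toℕ<n; toℕ-inject₁; toℕ-fromℕ)
  open import Data.List using (_++_; map; concatMap)
  open import Data.Nat.Combinatorics using (_C_; nCn≡1; nC1≡n; nCk+nC[k+1]≡[n+1]C[k+1])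
  open import Data.Nat.Divisibility using (_∣_; divides; ∣⇒≤)
  open import Data.Nat.Primality using (euclidsLemma)
  open import Relation.Binary using (IsEquivalence)
  open FiniteSums

  [1+k]*[1+n]C[1+k] : ∀ n k → suc k ℕ.* (suc n C suc k) ≡ suc n ℕ.* (n C k)
  [1+k]*[1+n]C[1+k] zero    zero    = refl
  [1+k]*[1+n]C[1+k] zero    (suc k) = ℕ.*-zeroʳ (suc (suc k))
  [1+k]*[1+n]C[1+k] (suc n) zero    = begin
    1 ℕ.* (suc (suc n) C 1)  ≡⟨ ℕ.*-identityˡ _ ⟩
    suc (suc n) C 1          ≡⟨ nC1≡n (suc (suc n)) ⟩
    suc (suc n)              ≡⟨ ℕ.*-identityʳ _ ⟨
    suc (suc n) ℕ.* 1 ∎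
    where open ≡-Reasoning
  [1+k]*[1+n]C[1+k] (suc n) (suc k) = begin
    suc (suc k) ℕ.* (suc (suc n) C suc (suc k))
      ≡⟨ cong (suc (suc k) ℕ.*_) (nCk+nC[k+1]≡[n+1]C[k+1] (suc n) (suc k)) ⟨
    suc (suc k) ℕ.* ((suc n C suc k) ℕ.+ (suc n C suc (suc k)))
      ≡⟨ expand k (suc n C suc k) (suc n C suc (suc k)) ⟩
    (suc n C suc k) ℕ.+ (suc k ℕ.* (suc n C suc k) ℕ.+ suc (suc k) ℕ.* (suc n C suc (suc k)))
      ≡⟨ cong ((suc n C suc k) ℕ.+_) (cong₂ ℕ._+_ ([1+k]*[1+n]C[1+k] n k) ([1+k]*[1+n]C[1+k] n (suc k))) ⟩
    (suc n C suc k) ℕ.+ (suc n ℕ.* (n C k) ℕ.+ suc n ℕ.* (n C suc k))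
      ≡⟨ cong ((suc n C suc k) ℕ.+_) (ℕ.*-distribˡ-+ (suc n) (n C k) (n C suc k)) ⟨
    (suc n C suc k) ℕ.+ suc n ℕ.* ((n C k) ℕ.+ (n C suc k))
      ≡⟨ cong (λ c → (suc n C suc k) ℕ.+ suc n ℕ.* c) (nCk+nC[k+1]≡[n+1]C[k+1] n k) ⟩
    suc (suc n) ℕ.* (suc n C suc k) ∎
    where
    open ≡-Reasoning
    expand : ∀ k x y → suc (suc k) ℕ.* (x ℕ.+ y) ≡ x ℕ.+ (suc k ℕ.* x ℕ.+ suc (suc k) ℕ.* y)
    expand = ℕSolver.solve-∀

  -- By the absorption identity p divides k times the binomial coefficient, and 0 < k < p leaves the
  -- prime only the second factor.
  prime∣C : ∀ {p k} → Prime p → 0 ℕ.< k → k ℕ.< p → p ∣ p C k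
  prime∣C {suc n} {suc k} pp _ k<p
    with euclidsLemma (suc k) (suc n C suc k) pp
           (divides (n C k) (trans ([1+k]*[1+n]C[1+k] n k) (ℕ.*-comm (suc n) (n C k))))
  ... | inj₁ p∣k = ⊥-elim (ℕ.<⇒≱ k<p (∣⇒≤ p∣k))
  ... | inj₂ p∣C = p∣C

  module FreshmansDream {a ℓ} (S : CommutativeSemiring a ℓ) where

    private module S = CommutativeSemiring S
    open S hiding (refl; sym; trans; reflexive; setoid; isEquivalence; zero)
    open import Algebra.Properties.CommutativeSemiring.Binomial S
    open import Algebra.Properties.Semiring.Exp semiring using (_^_)
    open import Algebra.Properties.Semiring.Mult semiring renaming (_×_ to _•_)
    open import Algebra.Properties.Semiring.Sum semiring
      using (sum; sum-init-last; sum-cong-≋; sum-replicate-zero)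
    open import Relation.Binary.Reasoning.Setoid S.setoid

    -- The inner terms of the binomial theorem have coefficients divisible by p and vanish by
    -- `char`. A semiring suffices, as it must: lists of group elements have no subtraction.
    frobenius-+ : ∀ {p} → Prime p → (∀ z → p • z ≈ 0#) → ∀ x y → (x + y) ^ p ≈ x ^ p + y ^ p
    frobenius-+ {suc n} pp char x y = begin
      (x + y) ^ suc n
        ≈⟨ theorem (suc n) x y ⟩
      binomialTerm x y (suc n) zero + sum (binomialTerm x y (suc n) ∘ suc)
        ≈⟨ +-cong first (sum-init-last (binomialTerm x y (suc n) ∘ suc)) ⟩
      y ^ suc n + (sum (binomialTerm x y (suc n) ∘ suc ∘ inject₁) + binomialTerm x y (suc n) (fromℕ (suc n)))
        ≈⟨ +-congˡ (+-cong (S.trans (sum-cong-≋ middle) (sum-replicate-zero n)) last-term) ⟩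
      y ^ suc n + (0# + x ^ suc n)
        ≈⟨ +-congˡ (+-identityˡ _) ⟩
      y ^ suc n + x ^ suc n
        ≈⟨ +-comm _ _ ⟩
      x ^ suc n + y ^ suc n ∎
      where
      first : binomialTerm x y (suc n) zero ≈ y ^ suc n
      first = S.trans (+-identityʳ _) (*-identityˡ _)

      last-term : binomialTerm x y (suc n) (fromℕ (suc n)) ≈ x ^ suc n
      last-term rewrite toℕ-fromℕ n | nCn≡1 (suc n) | ℕ.n∸n≡0 n = S.trans (+-identityʳ _) (*-identityʳ _)

      multiple : ∀ {m} z → suc n ∣ m → m • z ≈ 0#
      multiple z (divides q refl) = S.trans (S.sym (×-assocˡ z q (suc n))) (S.trans (×-congʳ q (char z)) (×-zero q))
        where
        ×-zero : ∀ q → q • 0# ≈ 0#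
        ×-zero zero    = S.refl
        ×-zero (suc q) = S.trans (+-identityˡ _) (×-zero q)

      middle : ∀ (i : Fin n) → binomialTerm x y (suc n) (suc (inject₁ i)) ≈ 0#
      middle i = multiple _ (prime∣C pp (ℕ.s≤s ℕ.z≤n)
        (ℕ.s≤s (subst (ℕ._< n) (sym (toℕ-inject₁ i)) (toℕ<n i))))

  module Congruence (n : ℕ) where

    infix 4 _≋_
    record _≋_ (x y : ℤ) : Set where
      constructor _,_
      field
        quotient : ℤ
        equality : x ≡ y ℤ.+ quotient ℤ.* + n

    ≋-reflexive : ∀ {x y} → x ≡ y → x ≋ y
    ≋-reflexive refl = 0ℤ , sym (ℤ.+-identityʳ _)

    ≋-sym : ∀ {x y} → x ≋ y → y ≋ x
    ≋-sym {y = y} (k , refl) = ℤ.- k , lem y k (+ n)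
      where
      lem : ∀ y k n → y ≡ y ℤ.+ k ℤ.* n ℤ.+ ℤ.- k ℤ.* n
      lem = solve-∀

    ≋-trans : ∀ {x y z} → x ≋ y → y ≋ z → x ≋ z
    ≋-trans {z = z} (k , refl) (l , refl) = l ℤ.+ k , lem z k l (+ n)
      where
      lem : ∀ z k l n → z ℤ.+ l ℤ.* n ℤ.+ k ℤ.* n ≡ z ℤ.+ (l ℤ.+ k) ℤ.* n
      lem = solve-∀

    ≋-+ : ∀ {x y u v} → x ≋ y → u ≋ v → x ℤ.+ u ≋ y ℤ.+ v
    ≋-+ {y = y} {v = v} (k , refl) (l , refl) = k ℤ.+ l , lem y v k l (+ n)
      where
      lem : ∀ y v k l n → y ℤ.+ k ℤ.* n ℤ.+ (v ℤ.+ l ℤ.* n) ≡ y ℤ.+ v ℤ.+ (k ℤ.+ l) ℤ.* n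
      lem = solve-∀

    ≋-∑ : ∀ {A : Set} (xs : List A) {f g : A → ℤ} → (∀ x → f x ≋ g x) → ∑ xs f ≋ ∑ xs g
    ≋-∑ []       h = ≋-reflexive refl
    ≋-∑ (x ∷ xs) h = ≋-+ (h x) (≋-∑ xs h)

  -- Lists over M form the semiring ℕ[M] read modulo n; two lists are identified when every
  -- function on M has congruent sums over them, so that no coefficients need to be extracted.
  module MonoidSemiring {M : Set} {_·_ : Op₂ M} {e : M} (isCM : IsCommutativeMonoid _≡_ _·_ e) (n : ℕ) where

    open Congruence n
    open IsCommutativeMonoid isCM using (assoc; identityˡ; identityʳ; comm)

    infix 4 _≈ₗ_
    record _≈ₗ_ (xs ys : List M) : Set where
      constructor mk≈
      field at : ∀ φ → ∑ xs φ ≋ ∑ ys φ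
    open _≈ₗ_ public

    _⊛_ : List M → List M → List M
    xs ⊛ ys = concatMap (λ x → map (x ·_) ys) xs

    ∑-⊛ : ∀ xs ys φ → ∑ (xs ⊛ ys) φ ≡ ∑ xs (λ x → ∑ ys (λ y → φ (x · y)))
    ∑-⊛ xs ys φ = trans (∑-concatMap _ xs φ) (∑-cong xs (λ x → ∑-map (x ·_) ys φ))

    ≈ₗ-exact : ∀ {xs ys} → (∀ φ → ∑ xs φ ≡ ∑ ys φ) → xs ≈ₗ ys
    ≈ₗ-exact h = mk≈ (λ φ → ≋-reflexive (h φ))

    isEquivalence′ : IsEquivalence _≈ₗ_
    isEquivalence′ = record
      { refl  = ≈ₗ-exact (λ φ → refl)
      ; sym   = λ h → mk≈ (λ φ → ≋-sym (at h φ))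
      ; trans = λ h h′ → mk≈ (λ φ → ≋-trans (at h φ) (at h′ φ)) }

    ++-cong : ∀ {xs ys us vs} → xs ≈ₗ ys → us ≈ₗ vs → xs ++ us ≈ₗ ys ++ vs
    ++-cong {xs} {ys} {us} {vs} h h′ = mk≈ (λ φ →
      subst₂ _≋_ (sym (∑-++ xs us φ)) (sym (∑-++ ys vs φ)) (≋-+ (at h φ) (at h′ φ)))

    ⊛-cong : ∀ {xs ys us vs} → xs ≈ₗ ys → us ≈ₗ vs → xs ⊛ us ≈ₗ ys ⊛ vs
    ⊛-cong {xs} {ys} {us} {vs} h h′ = mk≈ (λ φ →
      subst₂ _≋_ (sym (∑-⊛ xs us φ)) (sym (∑-⊛ ys vs φ))
        (≋-trans (≋-∑ xs (λ x → at h′ (φ ∘ (x ·_)))) (at h _)))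

    listSemiring : CommutativeSemiring _ _
    listSemiring = record
      { Carrier = List M ; _≈_ = _≈ₗ_ ; _+_ = _++_ ; _*_ = _⊛_ ; 0# = [] ; 1# = e ∷ []
      ; isCommutativeSemiring = isCommutativeSemiringˡ record
        { +-isCommutativeMonoid = record
          { isMonoid = record
            { isSemigroup = record
              { isMagma = record { isEquivalence = isEquivalence′ ; ∙-cong = ++-cong }
              ; assoc = λ xs ys zs → ≈ₗ-exact (λ φ → trans (trans (∑-++ (xs ++ ys) zs φ) (cong (ℤ._+ ∑ zs φ) (∑-++ xs ys φ)))
                  (trans (ℤ.+-assoc (∑ xs φ) (∑ ys φ) (∑ zs φ))
                    (sym (trans (∑-++ xs (ys ++ zs) φ) (cong (ℤ._+_ (∑ xs φ)) (∑-++ ys zs φ)))))) }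
            ; identity = (λ xs → ≈ₗ-exact (λ φ → refl))
                       , (λ xs → ≈ₗ-exact (λ φ → trans (∑-++ xs [] φ) (ℤ.+-identityʳ _))) }
          ; comm = λ xs ys → ≈ₗ-exact (λ φ → trans (∑-++ xs ys φ) (trans (ℤ.+-comm (∑ xs φ) _) (sym (∑-++ ys xs φ)))) }
        ; *-isCommutativeMonoid = record
          { isMonoid = record
            { isSemigroup = record
              { isMagma = record { isEquivalence = isEquivalence′ ; ∙-cong = ⊛-cong }
              ; assoc = λ xs ys zs → ≈ₗ-exact (λ φ → begin
                  ∑ ((xs ⊛ ys) ⊛ zs) φ
                    ≡⟨ trans (∑-⊛ (xs ⊛ ys) zs φ) (∑-⊛ xs ys _) ⟩
                  ∑ xs (λ x → ∑ ys (λ y → ∑ zs (λ z → φ ((x · y) · z))))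
                    ≡⟨ ∑-cong xs (λ x → ∑-cong ys (λ y → ∑-cong zs (λ z → cong φ (assoc x y z)))) ⟩
                  ∑ xs (λ x → ∑ ys (λ y → ∑ zs (λ z → φ (x · (y · z)))))
                    ≡⟨ ∑-cong xs (λ x → ∑-⊛ ys zs (φ ∘ (x ·_))) ⟨
                  ∑ xs (λ x → ∑ (ys ⊛ zs) (φ ∘ (x ·_)))
                    ≡⟨ ∑-⊛ xs (ys ⊛ zs) φ ⟨
                  ∑ (xs ⊛ (ys ⊛ zs)) φ ∎) }
            ; identity = (λ xs → ≈ₗ-exact (λ φ → trans (∑-⊛ (e ∷ []) xs φ)
                           (trans (ℤ.+-identityʳ _) (∑-cong xs (λ x → cong φ (identityˡ x))))))
                       , (λ xs → ≈ₗ-exact (λ φ → trans (∑-⊛ xs (e ∷ []) φ)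
                           (∑-cong xs (λ x → trans (ℤ.+-identityʳ _) (cong φ (identityʳ x)))))) }
          ; comm = λ xs ys → ≈ₗ-exact (λ φ → begin
              ∑ (xs ⊛ ys) φ                        ≡⟨ ∑-⊛ xs ys φ ⟩
              ∑ xs (λ x → ∑ ys (λ y → φ (x · y)))  ≡⟨ ∑-swap xs ys _ ⟩
              ∑ ys (λ y → ∑ xs (λ x → φ (x · y)))
                ≡⟨ ∑-cong ys (λ y → ∑-cong xs (λ x → cong φ (comm x y))) ⟩
              ∑ ys (λ y → ∑ xs (λ x → φ (y · x)))  ≡⟨ ∑-⊛ ys xs φ ⟨
              ∑ (ys ⊛ xs) φ ∎) }
        ; distribʳ = λ xs ys zs → ≈ₗ-exact (λ φ → begin
            ∑ ((ys ++ zs) ⊛ xs) φ            ≡⟨ trans (∑-⊛ (ys ++ zs) xs φ) (∑-++ ys zs _) ⟩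
            _                                ≡⟨ cong₂ ℤ._+_ (∑-⊛ ys xs φ) (∑-⊛ zs xs φ) ⟨
            ∑ (ys ⊛ xs) φ ℤ.+ ∑ (zs ⊛ xs) φ  ≡⟨ ∑-++ (ys ⊛ xs) (zs ⊛ xs) φ ⟨
            ∑ ((ys ⊛ xs) ++ (zs ⊛ xs)) φ ∎)
        ; zeroˡ = λ xs → ≈ₗ-exact (λ φ → refl) } }
      where open ≡-Reasoning

    module L = CommutativeSemiring listSemiring
    open import Algebra.Properties.Semiring.Exp L.semiring using (_^_) public
    open import Algebra.Properties.Semiring.Mult L.semiring using () renaming (_×_ to _•_)

    mpow : M → ℕ → M
    mpow x zero    = e
    mpow x (suc k) = x · mpow x k

    singleton-^ : ∀ x k → ((x ∷ []) ^ k) ≈ₗ mpow x k ∷ []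
    singleton-^ x zero    = L.refl
    singleton-^ x (suc k) = L.trans (L.*-congˡ {x ∷ []} (singleton-^ x k)) L.refl

    ∑-• : ∀ k zs φ → ∑ (k • zs) φ ≡ + k ℤ.* ∑ zs φ
    ∑-• zero    zs φ = refl
    ∑-• (suc k) zs φ = trans (∑-++ zs (k • zs) φ) (trans (cong (ℤ._+_ (∑ zs φ)) (∑-• k zs φ)) (sym (ℤ.suc-* (+ k) _)))

    -- In this semiring `x ∷ xs` is the sum of a singleton and `xs`, so additivity of the n-th power
    -- peels off one element at a time.
    frobenius : Prime n → ∀ xs → xs ^ n ≈ₗ map (λ x → mpow x n) xs
    frobenius pn []       = zero-^ pn
      where
      zero-^ : ∀ {n} → Prime n → [] ^ n ≈ₗ []
      zero-^ {suc n} _ = L.refl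
    frobenius pn (x ∷ xs) = L.trans
      (FreshmansDream.frobenius-+ listSemiring pn char (x ∷ []) xs)
      (L.+-cong {x = (x ∷ []) ^ n} (singleton-^ x n) (frobenius pn xs))
      where
      char : ∀ zs → n • zs ≈ₗ []
      char zs = mk≈ (λ φ → ∑ zs φ , trans (∑-• n zs φ) (trans (ℤ.*-comm (+ n) _) (sym (ℤ.+-identityˡ _))))

-- Arithmetic modulo a prime n and the lines of the plane F_n².

module PrimePlane where

  open import Data.Fin.Properties using (toℕ<n; toℕ-fromℕ<; toℕ-injective)
  open import Data.Integer using (_+_; _*_; _-_)
  open import Data.Nat using (_%_; _∸_)
  open import Data.Nat.DivMod using (_mod_; [m+kn]%n≡m%n; m%n<n; m<n⇒m%n≡m; %-distribˡ-+; %-distribˡ-*)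
  open import Data.Nat.Coprimality using (prime⇒coprime; coprime-Bézout)
  open import Data.Nat.GCD using (module Bézout)
  open import Data.Nat.Primality using (prime⇒nonZero; prime⇒nonTrivial)
  open import Relation.Nullary.Decidable using (decidable-stable)
  open FiniteSums

  open ≡-Reasoning

  module Residues (n : ℕ) .{{_ : NonZero n}} where

    infixl 6 _⊕_
    infixl 7 _⊗_

    ι : ℕ → Fin n
    ι m = m mod n

    -- Addition and negation repeat the right-hand sides of `addₙ` and `negₙ`, so that the
    -- coordinates of products and inverses in G are these operations by computation.
    _⊕_ _⊗_ : Fin n → Fin n → Fin n
    a ⊕ b = ι (toℕ a ℕ.+ toℕ b)
    a ⊗ b = ι (toℕ a ℕ.* toℕ b)

    ⊖_ : Fin n → Fin n
    ⊖ a = ι (n ∸ toℕ a)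

    0# 1# : Fin n
    0# = ι 0
    1# = ι 1

    toℕ-ι : ∀ m → toℕ (ι m) ≡ m % n
    toℕ-ι m = toℕ-fromℕ< (m%n<n m n)

    ι-cong : ∀ {m k} → m % n ≡ k % n → ι m ≡ ι k
    ι-cong {m} {k} eq = toℕ-injective (trans (toℕ-ι m) (trans eq (sym (toℕ-ι k))))

    ι-injective : ∀ {m k} → ι m ≡ ι k → m % n ≡ k % n
    ι-injective {m} {k} eq = trans (sym (toℕ-ι m)) (trans (cong toℕ eq) (toℕ-ι k))

    ι-toℕ : ∀ a → ι (toℕ a) ≡ a
    ι-toℕ a = toℕ-injective (trans (toℕ-ι (toℕ a)) (m<n⇒m%n≡m (toℕ<n a)))

    ι-+ : ∀ m k → ι (m ℕ.+ k) ≡ ι m ⊕ ι k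
    ι-+ m k = ι-cong (trans (%-distribˡ-+ m k n) (cong₂ (λ x y → (x ℕ.+ y) % n) (sym (toℕ-ι m)) (sym (toℕ-ι k))))

    ι-* : ∀ m k → ι (m ℕ.* k) ≡ ι m ⊗ ι k
    ι-* m k = ι-cong (trans (%-distribˡ-* m k n) (cong₂ (λ x y → (x ℕ.* y) % n) (sym (toℕ-ι m)) (sym (toℕ-ι k))))

    ι-+kn : ∀ m k → ι (m ℕ.+ k ℕ.* n) ≡ ι m
    ι-+kn m k = ι-cong ([m+kn]%n≡m%n m k n)

    ⊕-comm : ∀ a b → a ⊕ b ≡ b ⊕ a
    ⊕-comm a b = cong ι (ℕ.+-comm (toℕ a) (toℕ b))

    ⊕-assoc : ∀ a b c → a ⊕ b ⊕ c ≡ a ⊕ (b ⊕ c)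
    ⊕-assoc a b c = begin
      a ⊕ b ⊕ c                          ≡⟨ cong (a ⊕ b ⊕_) (ι-toℕ c) ⟨
      a ⊕ b ⊕ ι (toℕ c)                  ≡⟨ ι-+ (toℕ a ℕ.+ toℕ b) (toℕ c) ⟨
      ι (toℕ a ℕ.+ toℕ b ℕ.+ toℕ c)      ≡⟨ cong ι (ℕ.+-assoc (toℕ a) (toℕ b) (toℕ c)) ⟩
      ι (toℕ a ℕ.+ (toℕ b ℕ.+ toℕ c))    ≡⟨ ι-+ (toℕ a) (toℕ b ℕ.+ toℕ c) ⟩
      ι (toℕ a) ⊕ (b ⊕ c)                ≡⟨ cong (_⊕ (b ⊕ c)) (ι-toℕ a) ⟩
      a ⊕ (b ⊕ c) ∎

    ⊕-identityˡ : ∀ a → 0# ⊕ a ≡ a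
    ⊕-identityˡ a = begin
      0# ⊕ a            ≡⟨ cong (0# ⊕_) (ι-toℕ a) ⟨
      ι 0 ⊕ ι (toℕ a)   ≡⟨ ι-+ 0 (toℕ a) ⟨
      ι (toℕ a)         ≡⟨ ι-toℕ a ⟩
      a ∎

    ⊕-identityʳ : ∀ a → a ⊕ 0# ≡ a
    ⊕-identityʳ a = trans (⊕-comm a 0#) (⊕-identityˡ a)

    ⊕-inverseʳ : ∀ a → a ⊕ ⊖ a ≡ 0#
    ⊕-inverseʳ a = begin
      a ⊕ ⊖ a                     ≡⟨ cong (_⊕ ⊖ a) (ι-toℕ a) ⟨
      ι (toℕ a) ⊕ ⊖ a             ≡⟨ ι-+ (toℕ a) (n ∸ toℕ a) ⟨
      ι (toℕ a ℕ.+ (n ∸ toℕ a))   ≡⟨ cong ι (ℕ.m+[n∸m]≡n (ℕ.<⇒≤ (toℕ<n a))) ⟩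
      ι n                         ≡⟨ cong ι (ℕ.*-identityˡ n) ⟨
      ι (0 ℕ.+ 1 ℕ.* n)           ≡⟨ ι-+kn 0 1 ⟩
      0# ∎

    ⊕-inverseˡ : ∀ a → ⊖ a ⊕ a ≡ 0#
    ⊕-inverseˡ a = trans (⊕-comm (⊖ a) a) (⊕-inverseʳ a)

    ⊕-cancel-⊖ : ∀ a b → ⊖ a ⊕ (a ⊕ b) ≡ b
    ⊕-cancel-⊖ a b = trans (sym (⊕-assoc (⊖ a) a b)) (trans (cong (_⊕ b) (⊕-inverseˡ a)) (⊕-identityˡ b))

    ⊕-⊖-cancel : ∀ a b → a ⊕ (⊖ a ⊕ b) ≡ b
    ⊕-⊖-cancel a b = trans (sym (⊕-assoc a (⊖ a) b)) (trans (cong (_⊕ b) (⊕-inverseʳ a)) (⊕-identityˡ b))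

    ⊖-unique : ∀ a b → a ⊕ b ≡ 0# → b ≡ ⊖ a
    ⊖-unique a b eq = trans (sym (⊕-cancel-⊖ a b)) (trans (cong (⊖ a ⊕_) eq) (⊕-identityʳ (⊖ a)))

    ⊗-comm : ∀ a b → a ⊗ b ≡ b ⊗ a
    ⊗-comm a b = cong ι (ℕ.*-comm (toℕ a) (toℕ b))

    ⊗-assoc : ∀ a b c → a ⊗ b ⊗ c ≡ a ⊗ (b ⊗ c)
    ⊗-assoc a b c = begin
      a ⊗ b ⊗ c                          ≡⟨ cong (a ⊗ b ⊗_) (ι-toℕ c) ⟨
      a ⊗ b ⊗ ι (toℕ c)                  ≡⟨ ι-* (toℕ a ℕ.* toℕ b) (toℕ c) ⟨
      ι (toℕ a ℕ.* toℕ b ℕ.* toℕ c)      ≡⟨ cong ι (ℕ.*-assoc (toℕ a) (toℕ b) (toℕ c)) ⟩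
      ι (toℕ a ℕ.* (toℕ b ℕ.* toℕ c))    ≡⟨ ι-* (toℕ a) (toℕ b ℕ.* toℕ c) ⟩
      ι (toℕ a) ⊗ (b ⊗ c)                ≡⟨ cong (_⊗ (b ⊗ c)) (ι-toℕ a) ⟩
      a ⊗ (b ⊗ c) ∎

    ⊗-identityˡ : ∀ a → 1# ⊗ a ≡ a
    ⊗-identityˡ a = begin
      1# ⊗ a             ≡⟨ cong (1# ⊗_) (ι-toℕ a) ⟨
      ι 1 ⊗ ι (toℕ a)    ≡⟨ ι-* 1 (toℕ a) ⟨
      ι (1 ℕ.* toℕ a)    ≡⟨ cong ι (ℕ.*-identityˡ (toℕ a)) ⟩
      ι (toℕ a)          ≡⟨ ι-toℕ a ⟩
      a ∎

    ⊗-identityʳ : ∀ a → a ⊗ 1# ≡ a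
    ⊗-identityʳ a = trans (⊗-comm a 1#) (⊗-identityˡ a)

    ⊗-zeroˡ : ∀ a → 0# ⊗ a ≡ 0#
    ⊗-zeroˡ a = trans (cong (0# ⊗_) (sym (ι-toℕ a))) (sym (ι-* 0 (toℕ a)))

    ⊗-zeroʳ : ∀ a → a ⊗ 0# ≡ 0#
    ⊗-zeroʳ a = trans (⊗-comm a 0#) (⊗-zeroˡ a)

    ⊗-distribˡ : ∀ a b c → a ⊗ (b ⊕ c) ≡ a ⊗ b ⊕ a ⊗ c
    ⊗-distribˡ a b c = begin
      a ⊗ (b ⊕ c)                                    ≡⟨ cong (_⊗ (b ⊕ c)) (ι-toℕ a) ⟨
      ι (toℕ a) ⊗ ι (toℕ b ℕ.+ toℕ c)                ≡⟨ ι-* (toℕ a) (toℕ b ℕ.+ toℕ c) ⟨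
      ι (toℕ a ℕ.* (toℕ b ℕ.+ toℕ c))                ≡⟨ cong ι (ℕ.*-distribˡ-+ (toℕ a) (toℕ b) (toℕ c)) ⟩
      ι (toℕ a ℕ.* toℕ b ℕ.+ toℕ a ℕ.* toℕ c)        ≡⟨ ι-+ (toℕ a ℕ.* toℕ b) (toℕ a ℕ.* toℕ c) ⟩
      a ⊗ b ⊕ a ⊗ c ∎

    scale-⊗ : ∀ m a → ι (m ℕ.* toℕ a) ≡ ι m ⊗ a
    scale-⊗ m a = trans (ι-* m (toℕ a)) (cong (ι m ⊗_) (ι-toℕ a))

  module PrimeField (n : ℕ) (pn : Prime n) where

    instance
      nonZero : NonZero n
      nonZero = prime⇒nonZero pn

    open Residues n public

    1<n : 1 ℕ.< n
    1<n = ℕ.nonTrivial⇒n>1 n {{prime⇒nonTrivial pn}}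

    1≢0 : 1# ≢ 0#
    1≢0 eq with trans (sym (m<n⇒m%n≡m 1<n)) (trans (ι-injective eq) (m<n⇒m%n≡m (ℕ.<-trans ℕ.z<s 1<n)))
    ... | ()

    inverse : ∀ a → a ≢ 0# → ∃ λ b → a ⊗ b ≡ 1#
    inverse a a≢0 = go (toℕ a) refl
      where
      go : ∀ m → m ≡ toℕ a → ∃ λ b → a ⊗ b ≡ 1#
      go zero    eq = ⊥-elim (a≢0 (trans (sym (ι-toℕ a)) (cong ι (sym eq))))
      go (suc k) eq with coprime-Bézout (prime⇒coprime pn (subst (ℕ._< n) (sym eq) (toℕ<n a)))
      ... | Bézout.-+ x y bez = ι y , (begin
        a ⊗ ι y              ≡⟨ ⊗-comm a (ι y) ⟩
        ι y ⊗ a              ≡⟨ scale-⊗ y a ⟨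
        ι (y ℕ.* toℕ a)      ≡⟨ cong (λ z → ι (y ℕ.* z)) eq ⟨
        ι (y ℕ.* suc k)      ≡⟨ cong ι bez ⟨
        ι (1 ℕ.+ x ℕ.* n)    ≡⟨ ι-+kn 1 x ⟩
        1# ∎)
      -- Here y a ≡ -1, so the inverse of a is y (y a).
      ... | Bézout.+- x y bez = ι (y ℕ.* m′) , (begin
        a ⊗ ι (y ℕ.* m′)              ≡⟨ ⊗-comm a _ ⟩
        ι (y ℕ.* m′) ⊗ a              ≡⟨ scale-⊗ (y ℕ.* m′) a ⟨
        ι (y ℕ.* m′ ℕ.* toℕ a)        ≡⟨ cong (λ z → ι (y ℕ.* m′ ℕ.* z)) eq ⟨
        ι (y ℕ.* m′ ℕ.* suc k)        ≡⟨ ι-+kn _ x ⟨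
        ι (y ℕ.* m′ ℕ.* suc k ℕ.+ x ℕ.* n)
          ≡⟨ cong (λ z → ι (y ℕ.* m′ ℕ.* suc k ℕ.+ z)) bez ⟨
        ι (y ℕ.* m′ ℕ.* suc k ℕ.+ (1 ℕ.+ y ℕ.* suc k))
          ≡⟨ cong ι (regroup y (suc k)) ⟩
        ι (1 ℕ.+ (y ℕ.* suc k) ℕ.* (1 ℕ.+ y ℕ.* suc k))
          ≡⟨ cong (λ z → ι (1 ℕ.+ (y ℕ.* suc k) ℕ.* z)) bez ⟩
        ι (1 ℕ.+ (y ℕ.* suc k) ℕ.* (x ℕ.* n))
          ≡⟨ cong (λ z → ι (1 ℕ.+ z)) (ℕ.*-assoc (y ℕ.* suc k) x n) ⟨
        ι (1 ℕ.+ (y ℕ.* suc k ℕ.* x) ℕ.* n)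
          ≡⟨ ι-+kn 1 (y ℕ.* suc k ℕ.* x) ⟩
        1# ∎)
        where
        m′ = y ℕ.* suc k
        regroup : ∀ y m → y ℕ.* (y ℕ.* m) ℕ.* m ℕ.+ (1 ℕ.+ y ℕ.* m) ≡ 1 ℕ.+ (y ℕ.* m) ℕ.* (1 ℕ.+ y ℕ.* m)
        regroup = ℕSolver.solve-∀

    ⊗-inverse-cancel : ∀ a b → a ⊗ b ≡ 1# → ∀ c → b ⊗ (a ⊗ c) ≡ c
    ⊗-inverse-cancel a b ab≡1 c = begin
      b ⊗ (a ⊗ c)  ≡⟨ ⊗-assoc b a c ⟨
      b ⊗ a ⊗ c    ≡⟨ cong (_⊗ c) (trans (⊗-comm b a) ab≡1) ⟩
      1# ⊗ c       ≡⟨ ⊗-identityˡ c ⟩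
      c ∎

    ⊗-≢0 : ∀ {a b} → a ≢ 0# → b ≢ 0# → a ⊗ b ≢ 0#
    ⊗-≢0 {a} {b} a≢0 b≢0 ab≡0 with inverse a a≢0
    ... | c , ac≡1 = b≢0 (trans (sym (⊗-inverse-cancel a c ac≡1 b)) (trans (cong (c ⊗_) ab≡0) (⊗-zeroʳ c)))

    -- Confines a sum to the nonzero scalars while it still runs over all of `F`, where dilation is
    -- available.
    ν : Fin n → ℤ
    ν s = 1ℤ - 𝟙 (s ≟F 0#)

    ν-split : ∀ s k → k ≡ 𝟙 (s ≟F 0#) * k + ν s * k
    ν-split s k = lem (𝟙 (s ≟F 0#)) k
      where
      lem : ∀ d k → k ≡ d * k + (1ℤ - d) * k
      lem = solve-∀

    ν-cong : ∀ s {x y} → (s ≢ 0# → x ≡ y) → ν s * x ≡ ν s * y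
    ν-cong s h with s ≟F 0#
    ... | yes _   = refl
    ... | no s≢0  = cong (1ℤ *_) (h s≢0)

    F : List (Fin n)
    F = allFin n

    enumF : Enumerates _≟F_ F
    enumF = enumerates-allFin n

    ∑-translate : ∀ a (g : Fin n → ℤ) → ∑ F (λ j → g (a ⊕ j)) ≡ ∑ F g
    ∑-translate a = ∑-reindex enumF enumF (a ⊕_) (⊖ a ⊕_) (⊕-cancel-⊖ a) (⊕-⊖-cancel a)

    ∑-dilate : ∀ a → a ≢ 0# → (g : Fin n → ℤ) → ∑ F (λ j → g (a ⊗ j)) ≡ ∑ F g
    ∑-dilate a a≢0 with inverse a a≢0
    ... | b , ab≡1 = ∑-reindex enumF enumF (a ⊗_) (b ⊗_) (⊗-inverse-cancel a b ab≡1)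
                       (⊗-inverse-cancel b a (trans (⊗-comm b a) ab≡1))

    ∑-ν : ∀ k → ∑ F (λ s → ν s * k) ≡ (+ n - 1ℤ) * k
    ∑-ν k = begin
      ∑ F (λ s → ν s * k)
        ≡⟨ solve₁ (∑ F (λ s → ν s * k)) k ⟩
      k + ∑ F (λ s → ν s * k) - k
        ≡⟨ cong (λ x → x + ∑ F (λ s → ν s * k) - k) (pick enumF 0# (λ _ → k)) ⟨
      ∑ F (λ s → 𝟙 (s ≟F 0#) * k) + ∑ F (λ s → ν s * k) - k
        ≡⟨ cong (_- k) (∑-+ F _ _) ⟨
      ∑ F (λ s → 𝟙 (s ≟F 0#) * k + ν s * k) - k
        ≡⟨ cong (_- k) (∑-cong F (λ s → ν-split s k)) ⟨
      ∑ F (λ s → k) - k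
        ≡⟨ cong (_- k) (∑-const n k) ⟩
      + n * k - k
        ≡⟨ solve₂ (+ n) k ⟩
      (+ n - 1ℤ) * k ∎
      where
      solve₁ : ∀ x k → x ≡ k + x - k
      solve₁ = solve-∀
      solve₂ : ∀ n k → n * k - k ≡ (n - 1ℤ) * k
      solve₂ = solve-∀

  module Plane (n : ℕ) (pn : Prime n) where

    open PrimeField n pn public

    V : Set
    V = Fin n × Fin n

    Direction : Set
    Direction = Fin (suc n)

    directions : List Direction
    directions = allFin (suc n)

    𝟎 : V
    𝟎 = 0# , 0#

    infixr 7 _∙_
    _∙_ : Fin n → V → V
    s ∙ (a , b) = s ⊗ a , s ⊗ b

    _⊞_ : V → V → V
    (a , b) ⊞ (c , d) = a ⊕ c , b ⊕ d

    -- The lines of F_n² through 0, spanned by (0 , 1) and the (1 , t).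
    rep : Direction → V
    rep zero    = 0# , 1#
    rep (suc t) = 1# , t

    -- The linear form whose kernel is the line of `rep l`; its levels are the cosets of that line.
    ψ : Direction → V → Fin n
    ψ zero    (a , b) = a
    ψ (suc t) (a , b) = b ⊕ ⊖ t ⊗ a

    ∑V : (V → ℤ) → ℤ
    ∑V f = ∑ F (λ a → ∑ F (λ b → f (a , b)))

    ψ-⊞ : ∀ l u v → ψ l (u ⊞ v) ≡ ψ l u ⊕ ψ l v
    ψ-⊞ zero    u v = refl
    ψ-⊞ (suc t) (a , b) (c , d) = begin
      b ⊕ d ⊕ ⊖ t ⊗ (a ⊕ c)            ≡⟨ cong (b ⊕ d ⊕_) (⊗-distribˡ (⊖ t) a c) ⟩
      b ⊕ d ⊕ (⊖ t ⊗ a ⊕ ⊖ t ⊗ c)      ≡⟨ ⊕-assoc b d _ ⟩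
      b ⊕ (d ⊕ (⊖ t ⊗ a ⊕ ⊖ t ⊗ c))    ≡⟨ cong (b ⊕_) (⊕-assoc d _ _) ⟨
      b ⊕ (d ⊕ ⊖ t ⊗ a ⊕ ⊖ t ⊗ c)      ≡⟨ cong (λ x → b ⊕ (x ⊕ ⊖ t ⊗ c)) (⊕-comm d _) ⟩
      b ⊕ (⊖ t ⊗ a ⊕ d ⊕ ⊖ t ⊗ c)      ≡⟨ cong (b ⊕_) (⊕-assoc _ d _) ⟩
      b ⊕ (⊖ t ⊗ a ⊕ (d ⊕ ⊖ t ⊗ c))    ≡⟨ ⊕-assoc b _ _ ⟨
      b ⊕ ⊖ t ⊗ a ⊕ (d ⊕ ⊖ t ⊗ c) ∎

    ψ-∙ : ∀ l s u → ψ l (s ∙ u) ≡ s ⊗ ψ l u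
    ψ-∙ zero    s u = refl
    ψ-∙ (suc t) s (a , b) = begin
      s ⊗ b ⊕ ⊖ t ⊗ (s ⊗ a)   ≡⟨ cong (s ⊗ b ⊕_) (⊗-assoc (⊖ t) s a) ⟨
      s ⊗ b ⊕ ⊖ t ⊗ s ⊗ a     ≡⟨ cong (λ x → s ⊗ b ⊕ x ⊗ a) (⊗-comm (⊖ t) s) ⟩
      s ⊗ b ⊕ s ⊗ ⊖ t ⊗ a     ≡⟨ cong (s ⊗ b ⊕_) (⊗-assoc s (⊖ t) a) ⟩
      s ⊗ b ⊕ s ⊗ (⊖ t ⊗ a)   ≡⟨ ⊗-distribˡ s b _ ⟨
      s ⊗ (b ⊕ ⊖ t ⊗ a) ∎

    ψ-𝟎 : ∀ l → ψ l 𝟎 ≡ 0#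
    ψ-𝟎 zero    = refl
    ψ-𝟎 (suc t) = trans (⊕-identityˡ _) (⊗-zeroʳ (⊖ t))

    ψ-rep-same : ∀ l → ψ l (rep l) ≡ 0#
    ψ-rep-same zero    = refl
    ψ-rep-same (suc t) = trans (cong (t ⊕_) (⊗-identityʳ (⊖ t))) (⊕-inverseʳ t)

    ψ-rep-other : ∀ {l l′} → l ≢ l′ → ψ l (rep l′) ≢ 0#
    ψ-rep-other {zero}  {zero}   l≢l′ = ⊥-elim (l≢l′ refl)
    ψ-rep-other {zero}  {suc t}  l≢l′ = 1≢0
    ψ-rep-other {suc t} {zero}   l≢l′ = λ eq → 1≢0 (trans (sym (trans (cong (1# ⊕_) (⊗-zeroʳ (⊖ t))) (⊕-identityʳ 1#))) eq)
    ψ-rep-other {suc t} {suc t′} l≢l′ = λ eq → l≢l′ (cong suc (begin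
      t                     ≡⟨ ⊕-⊖-cancel t′ t ⟨
      t′ ⊕ (⊖ t′ ⊕ t)       ≡⟨ cong (t′ ⊕_) (⊕-comm (⊖ t′) t) ⟩
      t′ ⊕ (t ⊕ ⊖ t′)       ≡⟨ cong (λ x → t′ ⊕ (t ⊕ x)) (⊖-unique t′ (⊖ t) (trans (cong (t′ ⊕_) (sym (⊗-identityʳ (⊖ t)))) eq)) ⟨
      t′ ⊕ (t ⊕ ⊖ t)        ≡⟨ cong (t′ ⊕_) (⊕-inverseʳ t) ⟩
      t′ ⊕ 0#               ≡⟨ ⊕-identityʳ t′ ⟩
      t′ ∎))

    direction : ∀ u → u ≡ 𝟎 ⊎ ∃₂ λ s l → s ≢ 0# × u ≡ s ∙ rep l
    direction (a , b) with a ≟F 0#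
    ... | no a≢0 with inverse a a≢0
    ...   | a⁻¹ , aa⁻¹≡1 = inj₂ (a , suc (a⁻¹ ⊗ b) , a≢0 ,
              cong₂ _,_ (sym (⊗-identityʳ a)) (sym (⊗-inverse-cancel a⁻¹ a (trans (⊗-comm a⁻¹ a) aa⁻¹≡1) b)))
    direction (a , b) | yes a≡0 with b ≟F 0#
    ...   | yes b≡0 = inj₁ (cong₂ _,_ a≡0 b≡0)
    ...   | no b≢0  = inj₂ (b , zero , b≢0 , cong₂ _,_ (trans a≡0 (sym (⊗-zeroʳ b))) (sym (⊗-identityʳ b)))

    -- Every nonzero vector is a nonzero multiple of exactly one `rep l`. For first coordinate a ≠ 0
    -- the slope t is reached by the dilation b = a t; the vectors with a = 0 form the line of
    -- `rep zero`.
    ∑V-by-directions : ∀ f → ∑V f ≡ f 𝟎 + ∑ directions (λ l → ∑ F (λ s → ν s * f (s ∙ rep l)))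
    ∑V-by-directions f = begin
      ∑V f
        ≡⟨ ∑-cong F (λ a → ν-split a _) ⟩
      ∑ F (λ a → 𝟙 (a ≟F 0#) * ∑ F (λ b → f (a , b)) + ν a * ∑ F (λ b → f (a , b)))
        ≡⟨ ∑-+ F _ _ ⟩
      ∑ F (λ a → 𝟙 (a ≟F 0#) * ∑ F (λ b → f (a , b))) + ∑ F (λ a → ν a * ∑ F (λ b → f (a , b)))
        ≡⟨ cong₂ _+_ (pick enumF 0# _) (∑-cong F slopes) ⟩
      ∑ F (λ b → f (0# , b)) + ∑ F (λ a → ∑ F (λ t → ν a * f (a ∙ rep (suc t))))
        ≡⟨ cong₂ _+_ vertical (∑-swap F F _) ⟩
      f 𝟎 + ∑ F (λ s → ν s * f (s ∙ rep zero)) + ∑ F (λ t → ∑ F (λ a → ν a * f (a ∙ rep (suc t))))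
        ≡⟨ ℤ.+-assoc (f 𝟎) _ _ ⟩
      f 𝟎 + (∑ F (λ s → ν s * f (s ∙ rep zero)) + ∑ F (λ t → ∑ F (λ a → ν a * f (a ∙ rep (suc t)))))
        ≡⟨ +ℤ-congˡ (f 𝟎) (∑-allFin-suc (λ l → ∑ F (λ s → ν s * f (s ∙ rep l)))) ⟨
      f 𝟎 + ∑ directions (λ l → ∑ F (λ s → ν s * f (s ∙ rep l))) ∎
      where
      slopes : ∀ a → ν a * ∑ F (λ b → f (a , b)) ≡ ∑ F (λ t → ν a * f (a ∙ rep (suc t)))
      slopes a = trans (ν-cong a (λ a≢0 → sym (trans
          (∑-cong F (λ t → cong (λ x → f (x , a ⊗ t)) (⊗-identityʳ a)))
          (∑-dilate a a≢0 (λ b → f (a , b))))))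
        (sym (∑-*ˡ F (ν a) _))

      vertical : ∑ F (λ b → f (0# , b)) ≡ f 𝟎 + ∑ F (λ s → ν s * f (s ∙ rep zero))
      vertical = begin
        ∑ F (λ b → f (0# , b))
          ≡⟨ ∑-cong F (λ b → ν-split b _) ⟩
        ∑ F (λ b → 𝟙 (b ≟F 0#) * f (0# , b) + ν b * f (0# , b))
          ≡⟨ ∑-+ F _ _ ⟩
        ∑ F (λ b → 𝟙 (b ≟F 0#) * f (0# , b)) + ∑ F (λ b → ν b * f (0# , b))
          ≡⟨ cong₂ _+_ (pick enumF 0# _) (∑-cong F (λ b → cong (λ v → ν b * f v)
               (cong₂ _,_ (sym (⊗-zeroʳ b)) (sym (⊗-identityʳ b))))) ⟩
        f 𝟎 + ∑ F (λ s → ν s * f (s ∙ rep zero)) ∎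

    Homogeneous : (V → ℤ) → Set
    Homogeneous J = ∀ s u → s ≢ 0# → J (s ∙ u) ≡ J u

    module _ {J : V → ℤ} (hom : Homogeneous J) where

      ∑V-homogeneous : ∑V J ≡ J 𝟎 + (+ n - 1ℤ) * ∑ directions (J ∘ rep)
      ∑V-homogeneous = trans (∑V-by-directions J) (+ℤ-congˡ (J 𝟎) (trans
        (∑-cong directions (λ l → trans (∑-cong F (λ s → ν-cong s (hom s (rep l)))) (∑-ν (J (rep l)))))
        (∑-*ˡ directions (+ n - 1ℤ) (J ∘ rep))))

      -- For a nontrivial character ζ of ℤ/n this is the sum of `J u` times ζ(`ψ l u`) over the
      -- plane: the nonzero points of the line `l` contribute n - 1 times its value, and those of
      -- any other line -1 times, because the n-th roots of unity other than 1 sum to -1.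
      fourier : Direction → ℤ
      fourier l = J 𝟎 + + n * J (rep l) - ∑ directions (J ∘ rep)

      background : Direction → ℤ
      background l = ∑ directions (J ∘ rep) - J (rep l)

      hits : ∀ v j → v ≢ 0# → ∑ F (λ s → ν s * 𝟙 (s ⊗ v ≟F j)) ≡ 1ℤ - 𝟙 (j ≟F 0#)
      hits v j v≢0 with inverse v v≢0
      ... | w , vw≡1 = begin
        ∑ F (λ s → ν s * 𝟙 (s ⊗ v ≟F j))
          ≡⟨ ∑-cong F (λ s → trans (ℤ.*-comm (ν s) _) (cong (_* ν s) (𝟙-⇔ (s ⊗ v ≟F j) (s ≟F w ⊗ j) (to s) (from s)))) ⟩
        ∑ F (λ s → 𝟙 (s ≟F w ⊗ j) * ν s)
          ≡⟨ pick enumF (w ⊗ j) ν ⟩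
        ν (w ⊗ j)
          ≡⟨ cong (λ x → 1ℤ - x) (𝟙-⇔ (w ⊗ j ≟F 0#) (j ≟F 0#) to₀ from₀) ⟩
        1ℤ - 𝟙 (j ≟F 0#) ∎
        where
        to : ∀ s → s ⊗ v ≡ j → s ≡ w ⊗ j
        to s refl = sym (trans (cong (w ⊗_) (⊗-comm s v)) (⊗-inverse-cancel v w vw≡1 s))
        from : ∀ s → s ≡ w ⊗ j → s ⊗ v ≡ j
        from s refl = trans (⊗-comm (w ⊗ j) v) (⊗-inverse-cancel w v (trans (⊗-comm w v) vw≡1) j)
        to₀ : w ⊗ j ≡ 0# → j ≡ 0#
        to₀ eq = trans (sym (⊗-inverse-cancel w v (trans (⊗-comm w v) vw≡1) j)) (trans (cong (v ⊗_) eq) (⊗-zeroʳ v))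
        from₀ : j ≡ 0# → w ⊗ j ≡ 0#
        from₀ refl = ⊗-zeroʳ w

      misses : ∀ j → ∑ F (λ s → ν s * 𝟙 (s ⊗ 0# ≟F j)) ≡ (+ n - 1ℤ) * 𝟙 (j ≟F 0#)
      misses j = trans (∑-cong F (λ s → cong (ν s *_) (𝟙-⇔ (s ⊗ 0# ≟F j) (j ≟F 0#)
          (λ eq → trans (sym eq) (⊗-zeroʳ s)) (λ eq → trans (⊗-zeroʳ s) (sym eq)))))
        (∑-ν (𝟙 (j ≟F 0#)))

      -- A line other than `l` meets every nonzero level in one nonzero point, while the line `l`
      -- lies inside level 0. So all nonzero levels have the same sum, and level 0 exceeds it by the
      -- Fourier value.
      ∑V-level : ∀ l j → ∑V (λ u → 𝟙 (ψ l u ≟F j) * J u) ≡ background l + fourier l * 𝟙 (j ≟F 0#)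
      ∑V-level l j = begin
        ∑V (λ u → 𝟙 (ψ l u ≟F j) * J u)
          ≡⟨ ∑V-by-directions _ ⟩
        𝟙 (ψ l 𝟎 ≟F j) * J 𝟎 + ∑ directions (λ l′ → ∑ F (λ s → ν s * (𝟙 (ψ l (s ∙ rep l′) ≟F j) * J (s ∙ rep l′))))
          ≡⟨ cong₂ _+_ (cong (_* J 𝟎) at-𝟎) (∑-cong directions along) ⟩
        -- The factor is (n - 1) δ for the line `l` and 1 - δ for the others; a correction n δ - 1
        -- at `l` gives both a common form.
        δ * J 𝟎 + ∑ directions (λ l′ → 𝟙 (l′ ≟F l) * ((+ n * δ - 1ℤ) * J (rep l′)) + (1ℤ - δ) * J (rep l′))
          ≡⟨ +ℤ-congˡ (δ * J 𝟎) (trans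
               (∑-+ directions (λ l′ → 𝟙 (l′ ≟F l) * ((+ n * δ - 1ℤ) * J (rep l′))) (λ l′ → (1ℤ - δ) * J (rep l′)))
               (cong₂ _+_ (pick (enumerates-allFin (suc n)) l (λ l′ → (+ n * δ - 1ℤ) * J (rep l′)))
                 (∑-*ˡ directions (1ℤ - δ) (J ∘ rep)))) ⟩
        δ * J 𝟎 + ((+ n * δ - 1ℤ) * J (rep l) + (1ℤ - δ) * ∑ directions (J ∘ rep))
          ≡⟨ collect δ (J 𝟎) (+ n) (J (rep l)) (∑ directions (J ∘ rep)) ⟩
        background l + fourier l * δ ∎
        where
        δ = 𝟙 (j ≟F 0#)

        collect : ∀ δ J₀ n Jₗ S → δ * J₀ + ((n * δ - 1ℤ) * Jₗ + (1ℤ - δ) * S) ≡ S - Jₗ + (J₀ + n * Jₗ - S) * δ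
        collect = solve-∀

        at-𝟎 : 𝟙 (ψ l 𝟎 ≟F j) ≡ δ
        at-𝟎 = 𝟙-⇔ (ψ l 𝟎 ≟F j) (j ≟F 0#) (λ eq → trans (sym eq) (ψ-𝟎 l)) (λ eq → trans (ψ-𝟎 l) (sym eq))

        pull : ∀ l′ → ∑ F (λ s → ν s * (𝟙 (ψ l (s ∙ rep l′) ≟F j) * J (s ∙ rep l′)))
             ≡ ∑ F (λ s → ν s * 𝟙 (s ⊗ ψ l (rep l′) ≟F j)) * J (rep l′)
        pull l′ = trans
          (∑-cong F (λ s → trans
            (ν-cong s (λ s≢0 → cong₂ _*_ (cong (λ x → 𝟙 (x ≟F j)) (ψ-∙ l s (rep l′))) (hom s (rep l′) s≢0)))
            (sym (ℤ.*-assoc (ν s) _ _))))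
          (∑-*ʳ F (J (rep l′)) _)

        along : ∀ l′ → ∑ F (λ s → ν s * (𝟙 (ψ l (s ∙ rep l′) ≟F j) * J (s ∙ rep l′)))
              ≡ 𝟙 (l′ ≟F l) * ((+ n * δ - 1ℤ) * J (rep l′)) + (1ℤ - δ) * J (rep l′)
        along l′ with l′ ≟F l
        ... | yes refl = trans (pull l′) (trans
                (cong (_* J (rep l′)) (trans
                  (cong (λ x → ∑ F (λ s → ν s * 𝟙 (s ⊗ x ≟F j))) (ψ-rep-same l′)) (misses j)))
                (on (+ n) δ (J (rep l′))))
          where
          on : ∀ n δ x → (n - 1ℤ) * δ * x ≡ 1ℤ * ((n * δ - 1ℤ) * x) + (1ℤ - δ) * x
          on = solve-∀
        ... | no l′≢l = trans (pull l′) (trans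
                (cong (_* J (rep l′)) (hits (ψ l (rep l′)) j (ψ-rep-other (l′≢l ∘ sym))))
                (off (+ n) δ (J (rep l′))))
          where
          off : ∀ n δ x → (1ℤ - δ) * x ≡ 0ℤ * ((n * δ - 1ℤ) * x) + (1ℤ - δ) * x
          off = solve-∀

    ∙-𝟎 : ∀ s → s ∙ 𝟎 ≡ 𝟎
    ∙-𝟎 s = cong₂ _,_ (⊗-zeroʳ s) (⊗-zeroʳ s)

    0-∙ : ∀ u → 0# ∙ u ≡ 𝟎
    0-∙ (a , b) = cong₂ _,_ (⊗-zeroˡ a) (⊗-zeroˡ b)

    1-∙ : ∀ u → 1# ∙ u ≡ u
    1-∙ (a , b) = cong₂ _,_ (⊗-identityˡ a) (⊗-identityˡ b)

    ∙-injective : ∀ {s} → s ≢ 0# → ∀ {u v} → s ∙ u ≡ s ∙ v → u ≡ v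
    ∙-injective {s} s≢0 {a , b} {c , d} eq with inverse s s≢0
    ... | t , st≡1 = cong₂ _,_
      (trans (sym (⊗-inverse-cancel s t st≡1 a)) (trans (cong ((t ⊗_) ∘ proj₁) eq) (⊗-inverse-cancel s t st≡1 c)))
      (trans (sym (⊗-inverse-cancel s t st≡1 b)) (trans (cong ((t ⊗_) ∘ proj₂) eq) (⊗-inverse-cancel s t st≡1 d)))

    rep≢𝟎 : ∀ l → rep l ≢ 𝟎
    rep≢𝟎 zero    eq = 1≢0 (cong proj₂ eq)
    rep≢𝟎 (suc t) eq = 1≢0 (cong proj₁ eq)

    ψ-kernel : ∀ l l′ {s} → s ≢ 0# → ψ l (s ∙ rep l′) ≡ 0# → l ≡ l′
    ψ-kernel l l′ {s} s≢0 eq = decidable-stable (l ≟F l′) (λ l≢l′ →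
      ⊗-≢0 s≢0 (ψ-rep-other l≢l′) (trans (sym (ψ-∙ l s (rep l′))) eq))

    ψ-line : ∀ l s → ψ l (s ∙ rep l) ≡ 0#
    ψ-line l s = trans (ψ-∙ l s (rep l)) (trans (cong (s ⊗_) (ψ-rep-same l)) (⊗-zeroʳ s))

    ψ-independent : ∀ l l′ → l ≢ l′ → ∀ u → ψ l u ≡ 0# → ψ l′ u ≡ 0# → u ≡ 𝟎
    ψ-independent l l′ l≢l′ u eq eq′ with direction u
    ... | inj₁ u≡𝟎 = u≡𝟎
    ... | inj₂ (s , l″ , s≢0 , refl) = ⊥-elim (l≢l′ (trans (ψ-kernel l l″ s≢0 eq) (sym (ψ-kernel l′ l″ s≢0 eq′))))

    ∑V-cong : ∀ {f g : V → ℤ} → (∀ u → f u ≡ g u) → ∑V f ≡ ∑V g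
    ∑V-cong h = ∑-cong F (λ a → ∑-cong F (λ b → h (a , b)))

    ∑V-*ˡ : ∀ k (f : V → ℤ) → ∑V (λ u → k * f u) ≡ k * ∑V f
    ∑V-*ˡ k f = trans (∑-cong F (λ a → ∑-*ˡ F k _)) (∑-*ˡ F k _)

    -- A constant function has Fourier value 0. The zero term is kept because it gives the equation
    -- the shape demanded by `Flat`.
    ∑V-level-const : ∀ l j (k : ℤ) → ∑V (λ u → 𝟙 (ψ l u ≟F j) * k) ≡ + n * k + 0ℤ * 𝟙 (j ≟F 0#)
    ∑V-level-const l j k = trans (∑V-level {J = λ _ → k} (λ _ _ _ → refl) l j)
      (trans (cong (λ S → S - k + (k + + n * k - S) * 𝟙 (j ≟F 0#)) (∑-const (suc n) k))
        (ring (+ n) k (𝟙 (j ≟F 0#))))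
      where
      ring : ∀ n k d → (1ℤ + n) * k - k + (k + n * k - (1ℤ + n) * k) * d ≡ n * k + 0ℤ * d
      ring = solve-∀

    ∑V-zero-except : ∀ v (f : V → ℤ) → (∀ u → u ≢ v → f u ≡ 0ℤ) → ∑V f ≡ f v
    ∑V-zero-except (a , b) f off = trans
      (∑-zero-except enumF a (λ a′ → ∑ F (λ b′ → f (a′ , b′)))
        (λ a′ a≢ → trans (∑-cong F (λ b′ → off (a′ , b′) (a≢ ∘ cong proj₁))) (∑-0 F)))
      (∑-zero-except enumF b (λ b′ → f (a , b′)) (λ b′ b≢ → off (a , b′) (b≢ ∘ cong proj₂)))

    ∑V-0 : ∑V (λ _ → 0ℤ) ≡ 0ℤ
    ∑V-0 = trans (∑-cong F (λ _ → ∑-0 F)) (∑-0 F)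

  ∑V-swap : ∀ {p q} (pp : Prime p) (qq : Prime q) (f : Plane.V p pp → Plane.V q qq → ℤ) →
            Plane.∑V p pp (λ u → Plane.∑V q qq (f u)) ≡ Plane.∑V q qq (λ y → Plane.∑V p pp (λ u → f u y))
  ∑V-swap {p} {q} pp qq f = begin
    ∑ P (λ a → ∑ P (λ b → ∑ Q (λ c → ∑ Q (λ d → f (a , b) (c , d)))))
      ≡⟨ ∑-cong P (λ a → ∑-swap P Q (λ b c → ∑ Q (λ d → f (a , b) (c , d)))) ⟩
    ∑ P (λ a → ∑ Q (λ c → ∑ P (λ b → ∑ Q (λ d → f (a , b) (c , d)))))
      ≡⟨ ∑-swap P Q (λ a c → ∑ P (λ b → ∑ Q (λ d → f (a , b) (c , d)))) ⟩
    ∑ Q (λ c → ∑ P (λ a → ∑ P (λ b → ∑ Q (λ d → f (a , b) (c , d)))))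
      ≡⟨ ∑-cong Q (λ c → ∑-cong P (λ a → ∑-swap P Q (λ b d → f (a , b) (c , d)))) ⟩
    ∑ Q (λ c → ∑ P (λ a → ∑ Q (λ d → ∑ P (λ b → f (a , b) (c , d)))))
      ≡⟨ ∑-cong Q (λ c → ∑-swap P Q (λ a d → ∑ P (λ b → f (a , b) (c , d)))) ⟩
    ∑ Q (λ c → ∑ Q (λ d → ∑ P (λ a → ∑ P (λ b → f (a , b) (c , d))))) ∎
    where
    P = allFin p
    Q = allFin q

-- Families of n + 1 values with prescribed multiplicities modulo n.

module Multiplicities where

  import Data.Fin.Properties as Fin
  open import Data.Fin using (punchIn; fromℕ<)
  open import Data.Integer using (_+_; _*_; _-_; _≤_; _<_; +<+)
  open import Relation.Nullary.Decidable using (_×-dec_; ¬?; decidable-stable)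
  open FiniteSums
  open Frobenius

  <-of-sum : ∀ {t u n} → t + u ≡ n → 1ℤ ≤ u → t < n
  <-of-sum {t} {u} refl 1≤u = ℤ.<-≤-trans
    (subst (_< t + 1ℤ) (ℤ.+-identityʳ t) (ℤ.+-monoʳ-< t (+<+ (s≤s z≤n)))) (ℤ.+-monoʳ-≤ t 1≤u)

  no-multiple-between : ∀ {n k} → 0ℤ < k * + n → k * + n < + n → ⊥
  no-multiple-between {n} {k} 0<kn kn<n =
    ℤ.<-irrefl refl (ℤ.<-≤-trans k<1 (ℤ.i<j⇒suc[i]≤j 0<k))
    where
    0<k : 0ℤ < k
    0<k = ℤ.*-cancelʳ-<-nonNeg (+ n) 0<kn
    k<1 : k < 1ℤ
    k<1 = ℤ.*-cancelʳ-<-nonNeg (+ n) (subst (k * + n <_) (sym (ℤ.*-identityˡ (+ n))) kn<n)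

  module _ {n r : ℕ} (1<n : 1 ℕ.< n) (f : Fin (suc n) → Fin r) (v : Fin r) where

    open Congruence n

    multiplicity : Fin r → ℤ
    multiplicity i = ∑ (allFin (suc n)) (λ l → 𝟙 (f l ≟F i))

    private
      0<n : 0 ℕ.< n
      0<n = ℕ.<-trans ℕ.z<s 1<n

      enum : Enumerates _≟F_ (allFin (suc n))
      enum = enumerates-allFin (suc n)

    -- The multiplicity of v is ≡ 1 and every other one is ≡ 0 modulo n, so after removing one
    -- occurrence of v all n remaining values coincide.
    all-but-one-equal : (∀ i → 𝟙 (v ≟F i) + (+ n - 1ℤ) * multiplicity i ≋ 0ℤ) →
                        ∃₂ λ l₀ d → f l₀ ≡ v × (∀ l → l ≢ l₀ → f l ≡ d)
    all-but-one-equal h with ∑𝟙-witness (λ l → f l ≟F v) (allFin (suc n)) s≢0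
      where
      -- If `v` did not occur, the hypothesis at `v` would make 1 a multiple of n.
      s≢0 : multiplicity v ≢ 0ℤ
      s≢0 s≡0 with h v
      ... | k , eq = no-multiple-between {n} {k} (subst (0ℤ <_) 1≡kn (+<+ (s≤s z≤n))) (subst (_< + n) 1≡kn (+<+ 1<n))
        where
        1≡kn : 1ℤ ≡ k * + n
        1≡kn = begin
          1ℤ ≡⟨ 𝟙-yes (v ≟F v) refl ⟨
          𝟙 (v ≟F v) ≡⟨ ℤ.+-identityʳ _ ⟨
          𝟙 (v ≟F v) + 0ℤ ≡⟨ +ℤ-congˡ (𝟙 (v ≟F v)) (ℤ.*-zeroʳ (+ n - 1ℤ)) ⟨
          𝟙 (v ≟F v) + (+ n - 1ℤ) * 0ℤ ≡⟨ cong (λ x → 𝟙 (v ≟F v) + (+ n - 1ℤ) * x) s≡0 ⟨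
          𝟙 (v ≟F v) + (+ n - 1ℤ) * multiplicity v ≡⟨ eq ⟩
          0ℤ + k * + n ≡⟨ ℤ.+-identityˡ _ ⟩
          k * + n ∎
          where open ≡-Reasoning
    ... | l₀ , fl₀≡v = l₀ , d , fl₀≡v , rest
      where
      -- Any index other than `l₀` may propose the common value `d`. Among the n remaining indices
      -- `t` count those that agree and `u` those that do not. As `t` is a multiple of n, and
      -- positive because of `l₁`, it cannot drop below n, so `u` is 0.
      l₁ : Fin (suc n)
      l₁ = punchIn l₀ (fromℕ< 0<n)
      d = f l₁

      Same Other : Fin (suc n) → Set
      Same  l = l ≢ l₀ × f l ≡ d
      Other l = l ≢ l₀ × f l ≢ d

      same? : ∀ l → Dec (Same l)
      same? l = ¬? (l ≟F l₀) ×-dec (f l ≟F d)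
      other? : ∀ l → Dec (Other l)
      other? l = ¬? (l ≟F l₀) ×-dec ¬? (f l ≟F d)

      t u : ℤ
      t = ∑ (allFin (suc n)) (𝟙 ∘ same?)
      u = ∑ (allFin (suc n)) (𝟙 ∘ other?)

      t+u : t + u ≡ + n
      t+u = trans (drop (t + u) _ (begin
        t + u + 1ℤ
          ≡⟨ cong₂ _+_ (∑-+ (allFin (suc n)) (𝟙 ∘ same?) (𝟙 ∘ other?)) (∑-point enum l₀) ⟨
        ∑ (allFin (suc n)) (λ l → 𝟙 (same? l) + 𝟙 (other? l)) + ∑ (allFin (suc n)) (λ l → 𝟙 (l ≟F l₀))
          ≡⟨ ∑-+ (allFin (suc n)) (λ l → 𝟙 (same? l) + 𝟙 (other? l)) (λ l → 𝟙 (l ≟F l₀)) ⟨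
        ∑ (allFin (suc n)) (λ l → 𝟙 (same? l) + 𝟙 (other? l) + 𝟙 (l ≟F l₀))
          ≡⟨ ∑-cong (allFin (suc n)) pointwise ⟩
        ∑ (allFin (suc n)) (λ _ → 1ℤ)
          ≡⟨ ∑-const (suc n) 1ℤ ⟩
        + suc n * 1ℤ ∎)) (minus-one (+ n))
        where
        open ≡-Reasoning
        pointwise : ∀ l → 𝟙 (same? l) + 𝟙 (other? l) + 𝟙 (l ≟F l₀) ≡ 1ℤ
        pointwise l with l ≟F l₀ | f l ≟F d
        ... | yes _ | yes _ = refl
        ... | yes _ | no _  = refl
        ... | no _  | yes _ = refl
        ... | no _  | no _  = refl
        drop : ∀ x y → x + 1ℤ ≡ y → x ≡ y - 1ℤ
        drop x _ refl = lem x
          where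
          lem : ∀ x → x ≡ x + 1ℤ - 1ℤ
          lem = solve-∀
        minus-one : ∀ n → (1ℤ + n) * 1ℤ - 1ℤ ≡ n
        minus-one = solve-∀

      t+v : t + 𝟙 (v ≟F d) ≡ multiplicity d
      t+v = trans (+ℤ-congˡ t (sym (pick enum l₀ (λ _ → 𝟙 (v ≟F d)))))
        (trans (sym (∑-+ (allFin (suc n)) (𝟙 ∘ same?) (λ l → 𝟙 (l ≟F l₀) * 𝟙 (v ≟F d)))) (∑-cong (allFin (suc n)) pointwise))
        where
        pointwise : ∀ l → 𝟙 (same? l) + 𝟙 (l ≟F l₀) * 𝟙 (v ≟F d) ≡ 𝟙 (f l ≟F d)
        pointwise l with l ≟F l₀
        ... | yes refl = trans (ℤ.+-identityˡ _) (trans (ℤ.*-identityˡ _) (cong (λ x → 𝟙 (x ≟F d)) (sym fl₀≡v)))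
        ... | no _ with f l ≟F d
        ...   | yes _ = refl
        ...   | no _  = refl

      t-multiple : ∃ λ k → t ≡ k * + n
      t-multiple with h d
      ... | k , eq = multiplicity d - k , lem t (𝟙 (v ≟F d)) (+ n) k (multiplicity d) t+v eq
        where
        -- Being s - v, the number t equals n s minus the quantity v + (n - 1) s, which the
        -- hypothesis makes a multiple of n.
        lem : ∀ t v n k s → t + v ≡ s → v + (n - 1ℤ) * s ≡ 0ℤ + k * n → t ≡ (s - k) * n
        lem t v n k s refl eq = trans (ring₁ t v n) (trans (cong (λ x → (t + v) * n - x) eq) (ring₂ (t + v) n k))
          where
          ring₁ : ∀ t v n → t ≡ (t + v) * n - (v + (n - 1ℤ) * (t + v))
          ring₁ = solve-∀
          ring₂ : ∀ s n k → s * n - (0ℤ + k * n) ≡ (s - k) * n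
          ring₂ = solve-∀

      rest : ∀ l → l ≢ l₀ → f l ≡ d
      rest l l≢l₀ = decidable-stable (f l ≟F d) (λ fl≢d → contra (∑𝟙-positive enum other? {l} (l≢l₀ , fl≢d)))
        where
        contra : 1ℤ ≤ u → ⊥
        contra 1≤u with t-multiple
        ... | k , t≡kn = no-multiple-between {n} {k}
          (subst (0ℤ <_) t≡kn (ℤ.<-≤-trans (+<+ (s≤s z≤n)) (∑𝟙-positive enum same? {l₁} (Fin.punchInᵢ≢i l₀ _ , refl))))
          (subst (_< + n) t≡kn (<-of-sum t+u 1≤u))

-- Colourings of complete bipartite graphs.

module Colourings where

  open import Data.Fin.Properties using (any?; ¬∀⟶∃¬; pigeonhole)
  import Data.Fin.Properties as Fin
  open import Data.Integer using (_+_; _*_; _-_)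
  open import Data.Sum using (swap)
  open import Relation.Binary.Definitions using (tri<; tri≈; tri>)
  open import Relation.Nullary.Decidable using (_×-dec_; _⊎-dec_; ¬?; decidable-stable)
  open FiniteSums

  -- A colouring of the vertices and edges of a complete bipartite graph in which every vertex
  -- has a special edge of its own colour, while all its other edges share a major colour.
  record Colouring (r a b : ℕ) : Set where
    field
      E         : Fin a → Fin b → Fin r
      vA        : Fin a → Fin r
      vB        : Fin b → Fin r
      sA        : Fin a → Fin b
      sB        : Fin b → Fin a
      dA        : Fin a → Fin r
      dB        : Fin b → Fin r
      A-special : ∀ l → E l (sA l) ≡ vA l
      A-major   : ∀ l m → m ≢ sA l → E l m ≡ dA l
      B-special : ∀ m → E (sB m) m ≡ vB m
      B-major   : ∀ l m → l ≢ sB m → E l m ≡ dB m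

    A-minor : ∀ {l m} → E l m ≢ dA l → m ≡ sA l
    A-minor {l} {m} E≢d = decidable-stable (m ≟F sA l) (E≢d ∘ A-major l m)

    B-minor : ∀ {l m} → E l m ≢ dB m → l ≡ sB m
    B-minor {l} {m} E≢d = decidable-stable (l ≟F sB m) (E≢d ∘ B-major l m)

    A-colour : ∀ {l m} → E l m ≢ dA l → E l m ≡ vA l
    A-colour {l} E≢d with A-minor E≢d
    ... | refl = A-special l

    B-colour : ∀ {l m} → E l m ≢ dB m → E l m ≡ vB m
    B-colour {m = m} E≢d with B-minor E≢d
    ... | refl = B-special m

  transpose : ∀ {r a b} → Colouring r a b → Colouring r b a
  transpose C = record
    { E = λ m l → E l m ; vA = vB ; vB = vA ; sA = sB ; sB = sA ; dA = dB ; dB = dA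
    ; A-special = B-special ; A-major = λ m l → B-major l m
    ; B-special = A-special ; B-major = λ m l → A-major l m }
    where open Colouring C

  -- Four values do not fit injectively into three names. With repeated arguments it also serves to
  -- avoid a single value.
  avoid₃ : ∀ {n} → 4 ℕ.≤ n → (x y z : Fin n) → ∃ λ l → l ≢ x × l ≢ y × l ≢ z
  avoid₃ {n} 4≤n x y z
    with ¬∀⟶∃¬ n (λ l → l ≡ x ⊎ l ≡ y ⊎ l ≡ z) (λ l → (l ≟F x) ⊎-dec (l ≟F y) ⊎-dec (l ≟F z)) covers
    where
    code : ∀ {l} → l ≡ x ⊎ l ≡ y ⊎ l ≡ z → Fin 3
    code (inj₁ _)        = zero
    code (inj₂ (inj₁ _)) = suc zero
    code (inj₂ (inj₂ _)) = suc (suc zero)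

    code-injective : ∀ {l l′} (c : l ≡ x ⊎ l ≡ y ⊎ l ≡ z) (c′ : l′ ≡ x ⊎ l′ ≡ y ⊎ l′ ≡ z) →
                     code c ≡ code c′ → l ≡ l′
    code-injective (inj₁ refl)        (inj₁ refl)        _ = refl
    code-injective (inj₁ _)           (inj₂ (inj₁ _))    ()
    code-injective (inj₁ _)           (inj₂ (inj₂ _))    ()
    code-injective (inj₂ (inj₁ _))    (inj₁ _)           ()
    code-injective (inj₂ (inj₂ _))    (inj₁ _)           ()
    code-injective (inj₂ (inj₁ _))    (inj₂ (inj₂ _))    ()
    code-injective (inj₂ (inj₂ _))    (inj₂ (inj₁ _))    ()
    code-injective (inj₂ (inj₁ refl)) (inj₂ (inj₁ refl)) _ = refl
    code-injective (inj₂ (inj₂ refl)) (inj₂ (inj₂ refl)) _ = refl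

    covers : ¬ (∀ l → l ≡ x ⊎ l ≡ y ⊎ l ≡ z)
    covers cov with pigeonhole 4≤n (λ l → code (cov l))
    ... | i , j , i<j , eq = Fin.<-irrefl (code-injective (cov i) (cov j) eq) i<j
  ... | l , l∉ = l , l∉ ∘ inj₁ , l∉ ∘ inj₂ ∘ inj₁ , l∉ ∘ inj₂ ∘ inj₂

  missed : ∀ {m n} → m ℕ.< n → (f : Fin m → Fin n) → ∃ λ j → ∀ i → f i ≢ j
  missed {m} {n} m<n f with ¬∀⟶∃¬ n (λ j → ∃ λ i → f i ≡ j) (λ j → any? (λ i → f i ≟F j)) onto
    where
    onto : ¬ (∀ j → ∃ λ i → f i ≡ j)
    onto sec with pigeonhole m<n (proj₁ ∘ sec)
    ... | i , j , i<j , eq = Fin.<-irrefl (trans (sym (proj₂ (sec i))) (trans (cong f eq) (proj₂ (sec j)))) i<j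
  ... | j , j∉ = j , λ i eq → j∉ (i , eq)

  -- `l⋆` and `m⋆` are only permitted exceptions: their own majors may well equal `major`, and when
  -- a side has no exception the index is an arbitrary choice.
  record Concentrated {r a b} (C : Colouring r a b) : Set where
    open Colouring C
    field
      major  : Fin r
      l⋆     : Fin a
      m⋆     : Fin b
      A-rest : ∀ l → l ≢ l⋆ → dA l ≡ major
      B-rest : ∀ m → m ≢ m⋆ → dB m ≡ major

  -- A column m₀ containing no special edge of a row shows all row majors but one; two columns
  -- with a different major would both have to be special for a common row.
  concentrated-< : ∀ {r a b} → 4 ℕ.≤ a → a ℕ.< b → (C : Colouring r a b) → Concentrated C
  concentrated-< {r} {a} {b} 4≤a a<b C with missed a<b (Colouring.sA C)
  ... | m₀ , m₀-free = go (any? (λ m → ¬? (dB m ≟F d₀)))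
    where
    open Colouring C
    d₀ = dB m₀
    l₀ = sB m₀

    A-rest′ : ∀ l → l ≢ l₀ → dA l ≡ d₀
    A-rest′ l l≢ = trans (sym (A-major l m₀ (m₀-free l ∘ sym))) (B-major l m₀ l≢)

    -- The column gives the edge (l, m) the colour `dB m`, which is not the major `d₀` of the row;
    -- hence row `l` spends its only special edge on `m`.
    sA-bad : ∀ {l m} → dB m ≢ d₀ → l ≢ l₀ → l ≢ sB m → sA l ≡ m
    sA-bad {l} {m} d≢ l≢l₀ l≢s = sym (A-minor (λ eq →
      d≢ (trans (sym (B-major l m l≢s)) (trans eq (A-rest′ l l≢l₀)))))

    go : Dec (∃ λ m → dB m ≢ d₀) → Concentrated C
    go (no none) = record { major = d₀ ; l⋆ = l₀ ; m⋆ = m₀ ; A-rest = A-rest′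
      ; B-rest = λ m _ → decidable-stable (dB m ≟F d₀) (λ d≢ → none (m , d≢)) }
    go (yes (m₁ , d₁≢)) = record { major = d₀ ; l⋆ = l₀ ; m⋆ = m₁ ; A-rest = A-rest′
      ; B-rest = λ m m≢ → decidable-stable (dB m ≟F d₀) (two-bad m m≢) }
      where
      two-bad : ∀ m → m ≢ m₁ → ¬ (dB m ≢ d₀)
      two-bad m m≢m₁ d≢ with avoid₃ 4≤a l₀ (sB m) (sB m₁)
      ... | l , l≢l₀ , l≢s , l≢s₁ = m≢m₁ (trans (sym (sA-bad d≢ l≢l₀ l≢s)) (sA-bad d₁≢ l≢l₀ l≢s₁))

  -- The argument starts from a vertex to which no special edge of the other side leads. Unequal
  -- sizes provide one on the larger side.
  concentrated : ∀ {r a b} → 4 ℕ.≤ a → 4 ℕ.≤ b → a ≢ b → (C : Colouring r a b) → Concentrated C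
  concentrated {a = a} {b} 4≤a 4≤b a≢b C with ℕ.<-cmp a b
  ... | tri< a<b _ _ = concentrated-< 4≤a a<b C
  ... | tri≈ _ a≡b _ = ⊥-elim (a≢b a≡b)
  ... | tri> _ _ b<a = record { major = major ; l⋆ = m⋆ ; m⋆ = l⋆ ; A-rest = B-rest ; B-rest = A-rest }
    where open Concentrated (concentrated-< 4≤b b<a (transpose C))

  module Weights {r p q : ℕ} (C : Colouring r (suc p) (suc q)) (X : Fin r) where

    open Colouring C

    rows : List (Fin (suc p))
    rows = allFin (suc p)
    columns : List (Fin (suc q))
    columns = allFin (suc q)

    #dA #dB : ℤ
    #dA = ∑ rows (λ l → 𝟙 (dA l ≟F X))
    #dB = ∑ columns (λ m → 𝟙 (dB m ≟F X))

    -- Up to an affine map, the value on the basic set X of the homomorphism of 𝒜 to ℤ attached to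
    -- the subgroup A × C_q², respectively C_p² × B.
    weight : Fin (suc p) ⊎ Fin (suc q) → ℤ
    weight (inj₁ l) = 𝟙 (vA l ≟F X) + (+ q - 1ℤ) * 𝟙 (dA l ≟F X) - #dB
    weight (inj₂ m) = 𝟙 (vB m ≟F X) + (+ p - 1ℤ) * 𝟙 (dB m ≟F X) - #dA

    TwoValued : Set
    TwoValued = ∀ x y z → weight x ≢ weight y → weight y ≢ weight z → weight x ≢ weight z → ⊥

  module _ {r p q : ℕ} (C : Colouring r (suc p) (suc q)) where

    open Colouring C
    open Weights

    two-valued-transpose : ∀ {X} → TwoValued C X → TwoValued (transpose C) X
    two-valued-transpose {X} two x y z = subst₃ (two (swap x) (swap y) (swap z))
      where
      same : ∀ x → weight C X (swap x) ≡ weight (transpose C) X x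
      same (inj₁ _) = refl
      same (inj₂ _) = refl
      subst₃ : (weight C X (swap x) ≢ weight C X (swap y) → weight C X (swap y) ≢ weight C X (swap z) →
                weight C X (swap x) ≢ weight C X (swap z) → ⊥) →
               weight (transpose C) X x ≢ weight (transpose C) X y → weight (transpose C) X y ≢ weight (transpose C) X z →
               weight (transpose C) X x ≢ weight (transpose C) X z → ⊥
      subst₃ rewrite same x | same y | same z = λ f → f

    #dA-single : ∀ {X d₀ l⋆} → d₀ ≢ X → dA l⋆ ≡ X → (∀ l → l ≢ l⋆ → dA l ≡ d₀) → #dA C X ≡ 1ℤ
    #dA-single {X} {d₀} {l⋆} d₀≢X d⋆≡X rest = trans
      (∑-cong (rows C X) (λ l → 𝟙-⇔ (dA l ≟F X) (l ≟F l⋆)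
        (λ d≡X → decidable-stable (l ≟F l⋆) (λ l≢ → d₀≢X (trans (sym (rest l l≢)) d≡X)))
        (λ { refl → d⋆≡X })))
      (∑-point (enumerates-allFin (suc p)) l⋆)

    #dB-none : ∀ {X d₀} → d₀ ≢ X → (∀ m → dB m ≡ d₀) → #dB C X ≡ 0ℤ
    #dB-none {X} d₀≢X all = trans
      (∑-cong (columns C X) (λ m → 𝟙-no (dB m ≟F X) (λ d≡X → d₀≢X (trans (sym (all m)) d≡X))))
      (∑-0 (columns C X))

  𝟙-dichotomy : ∀ {P : Set} (d : Dec P) → 𝟙 d ≡ 0ℤ ⊎ 𝟙 d ≡ 1ℤ
  𝟙-dichotomy (yes _) = inj₂ refl
  𝟙-dichotomy (no _)  = inj₁ refl

  module _ {r p q : ℕ} (3≤q : 3 ℕ.≤ q) (C : Colouring r (suc p) (suc q)) where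

    open Colouring C
    open Weights C

    -- The weights of l⋆, l and a suitable column are ≥ 2, 1 and 0.
    exceptional-row : ∀ {d₀ X l⋆ l m} → d₀ ≢ X → dA l⋆ ≡ X → (∀ l → l ≢ l⋆ → dA l ≡ d₀) →
                      (∀ m → dB m ≡ d₀) → TwoValued X → l ≢ l⋆ → E l m ≡ X → ⊥
    exceptional-row {d₀} {X} {l⋆} {l} {m} d₀≢X d⋆≡X A-rest B-all two l≢l⋆ E≡X
      -- The column `m′` is not special for `l⋆`, so it meets `l⋆` in the colour `X`. As its major
      -- is `d₀`, that edge is special for the column, which makes `vB m′` equal to `X` and the
      -- weight 1 - 1.
      with avoid₃ (s≤s 3≤q) (sA l⋆) (sA l⋆) (sA l⋆)
    ... | m′ , m′≢ , _ = two (inj₁ l⋆) (inj₁ l) (inj₂ m′)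
      (λ eq → big-weight 1 ℕ.≤-refl (trans (sym weight-l⋆) (trans eq weight-l)))
      (λ eq → 1≢0 (trans (sym weight-l) (trans eq weight-m′)))
      (λ eq → big-weight 0 z≤n (trans (sym weight-l⋆) (trans eq weight-m′)))
      where
      1≢0 : 1ℤ ≢ 0ℤ
      1≢0 ()

      E-row : E l⋆ m′ ≡ X
      E-row = trans (A-major l⋆ m′ m′≢) d⋆≡X

      weight-l⋆ : weight X (inj₁ l⋆) ≡ 𝟙 (vA l⋆ ≟F X) + (+ q - 1ℤ)
      weight-l⋆ rewrite #dB-none C d₀≢X B-all | 𝟙-yes (dA l⋆ ≟F X) d⋆≡X = lem (𝟙 (vA l⋆ ≟F X)) (+ q)
        where
        lem : ∀ v q → v + (q - 1ℤ) * 1ℤ - 0ℤ ≡ v + (q - 1ℤ)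
        lem = solve-∀

      -- The edge (l, m) of colour `X` deviates from the major `d₀` of row `l`, so it is its special
      -- edge and `vA l` is `X`.
      weight-l : weight X (inj₁ l) ≡ 1ℤ
      weight-l rewrite #dB-none C d₀≢X B-all
        | 𝟙-no (dA l ≟F X) (λ eq → d₀≢X (trans (sym (A-rest l l≢l⋆)) eq))
        | 𝟙-yes (vA l ≟F X) (trans (sym (A-colour (λ eq → d₀≢X (trans (sym (A-rest l l≢l⋆)) (trans (sym eq) E≡X))))) E≡X)
        = lem (+ q)
        where
        lem : ∀ q → 1ℤ + (q - 1ℤ) * 0ℤ - 0ℤ ≡ 1ℤ
        lem = solve-∀

      weight-m′ : weight X (inj₂ m′) ≡ 0ℤ
      weight-m′ rewrite #dA-single C d₀≢X d⋆≡X A-rest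
        | 𝟙-no (dB m′ ≟F X) (λ eq → d₀≢X (trans (sym (B-all m′)) eq))
        | 𝟙-yes (vB m′ ≟F X) (trans (sym (B-colour (λ eq → d₀≢X (trans (sym (B-all m′)) (trans (sym eq) E-row))))) E-row)
        = lem (+ p)
        where
        lem : ∀ p → 1ℤ + (p - 1ℤ) * 0ℤ - 1ℤ ≡ 0ℤ
        lem = solve-∀

      big-weight : ∀ k → k ℕ.≤ 1 → 𝟙 (vA l⋆ ≟F X) + (+ q - 1ℤ) ≢ + k
      big-weight k k≤1 eq with 𝟙-dichotomy (vA l⋆ ≟F X)
      ... | inj₁ v≡0 = ℕ.<⇒≱ 3≤q
            (subst (ℕ._≤ 2) (ℤ.+-injective (sym (lem₀ (+ q) (+ k) (trans (cong (λ v → v + (+ q - 1ℤ)) (sym v≡0)) eq))))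
              (s≤s k≤1))
        where
        lem₀ : ∀ q k → 0ℤ + (q - 1ℤ) ≡ k → q ≡ 1ℤ + k
        lem₀ q _ refl = ring q
          where
          ring : ∀ q → q ≡ 1ℤ + (0ℤ + (q - 1ℤ))
          ring = solve-∀
      ... | inj₂ v≡1 = ℕ.<⇒≱ (ℕ.<-trans (s≤s (s≤s z≤n)) 3≤q)
            (subst (ℕ._≤ 1) (ℤ.+-injective (sym (lem₁ (+ q) (+ k) (trans (cong (λ v → v + (+ q - 1ℤ)) (sym v≡1)) eq))))
              k≤1)
        where
        lem₁ : ∀ q k → 1ℤ + (q - 1ℤ) ≡ k → q ≡ k
        lem₁ q _ refl = ring q
          where
          ring : ∀ q → q ≡ 1ℤ + (q - 1ℤ)
          ring = solve-∀

    -- The weights of l⋆ and m⋆ are ≥ 1 and differ because ∣p - q∣ ≥ 2; that of any other row is ≤ 0.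
    exceptional-cross : 3 ℕ.≤ p → p ≢ q → p ≢ suc q → q ≢ suc p →
                        ∀ {d₀ X l⋆ m⋆} → d₀ ≢ X → dA l⋆ ≡ X → (∀ l → l ≢ l⋆ → dA l ≡ d₀) →
                        dB m⋆ ≡ X → (∀ m → m ≢ m⋆ → dB m ≡ d₀) → TwoValued X → ⊥
    exceptional-cross 3≤p p≢q p≢1+q q≢1+p {d₀} {X} {l⋆} {m⋆} d₀≢X dA⋆≡X A-rest dB⋆≡X B-rest two
      with avoid₃ (s≤s 3≤p) l⋆ l⋆ l⋆
    ... | l , l≢ , _ = two (inj₁ l⋆) (inj₁ l) (inj₂ m⋆)
      (λ eq → big 3≤q (𝟙-dichotomy (vA l⋆ ≟F X)) (𝟙-dichotomy (vA l ≟F X)) (trans (sym weight-l⋆) (trans eq weight-l)))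
      (λ eq → big 3≤p (𝟙-dichotomy (vB m⋆ ≟F X)) (𝟙-dichotomy (vA l ≟F X)) (trans (sym weight-m⋆) (trans (sym eq) weight-l)))
      (λ eq → apart (𝟙-dichotomy (vA l⋆ ≟F X)) (𝟙-dichotomy (vB m⋆ ≟F X)) (trans (sym weight-l⋆) (trans eq weight-m⋆)))
      where
      #dA≡1 : #dA X ≡ 1ℤ
      #dA≡1 = #dA-single C d₀≢X dA⋆≡X A-rest
      #dB≡1 : #dB X ≡ 1ℤ
      #dB≡1 = #dA-single (transpose C) d₀≢X dB⋆≡X B-rest

      on : ∀ v q → v + (q - 1ℤ) * 1ℤ - 1ℤ ≡ v + q - + 2
      on = solve-∀
      off : ∀ v q → v + (q - 1ℤ) * 0ℤ - 1ℤ ≡ v - 1ℤ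
      off = solve-∀

      weight-l⋆ : weight X (inj₁ l⋆) ≡ 𝟙 (vA l⋆ ≟F X) + + q - + 2
      weight-l⋆ rewrite #dB≡1 | 𝟙-yes (dA l⋆ ≟F X) dA⋆≡X = on (𝟙 (vA l⋆ ≟F X)) (+ q)
      weight-m⋆ : weight X (inj₂ m⋆) ≡ 𝟙 (vB m⋆ ≟F X) + + p - + 2
      weight-m⋆ rewrite #dA≡1 | 𝟙-yes (dB m⋆ ≟F X) dB⋆≡X = on (𝟙 (vB m⋆ ≟F X)) (+ p)
      weight-l : weight X (inj₁ l) ≡ 𝟙 (vA l ≟F X) - 1ℤ
      weight-l rewrite #dB≡1 | 𝟙-no (dA l ≟F X) (λ eq → d₀≢X (trans (sym (A-rest l l≢)) eq)) = off (𝟙 (vA l ≟F X)) (+ q)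

      add-2 : ∀ {x y} → x - + 2 ≡ y → x ≡ y + + 2
      add-2 {x} refl = ring x
        where
        ring : ∀ x → x ≡ x - + 2 + + 2
        ring = solve-∀

      add-2′ : ∀ {x y} → x - + 2 ≡ y - + 2 → x ≡ y
      add-2′ {x} {y} eq = trans (add-2 eq) (ring y)
        where
        ring : ∀ y → y - + 2 + + 2 ≡ y
        ring = solve-∀

      big : ∀ {n x y} → 3 ℕ.≤ n → x ≡ 0ℤ ⊎ x ≡ 1ℤ → y ≡ 0ℤ ⊎ y ≡ 1ℤ → x + + n - + 2 ≢ y - 1ℤ
      big {n} 3≤n (inj₁ refl) (inj₁ refl) eq = ℕ.<⇒≢ (ℕ.<-trans (s≤s (s≤s z≤n)) 3≤n) (sym (ℤ.+-injective (add-2 {+ n} eq)))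
      big {n} 3≤n (inj₁ refl) (inj₂ refl) eq = ℕ.<⇒≢ 3≤n (sym (ℤ.+-injective (add-2 {+ n} eq)))
      big {n} 3≤n (inj₂ refl) (inj₁ refl) eq = ℕ.<⇒≢ (ℕ.<-trans (s≤s (s≤s z≤n)) (ℕ.m≤n⇒m≤1+n 3≤n)) (sym (ℤ.+-injective (add-2 {+ suc n} eq)))
      big {n} 3≤n (inj₂ refl) (inj₂ refl) eq = ℕ.<⇒≢ (ℕ.m≤n⇒m≤1+n 3≤n) (sym (ℤ.+-injective (add-2 {+ suc n} eq)))

      apart : ∀ {x y} → x ≡ 0ℤ ⊎ x ≡ 1ℤ → y ≡ 0ℤ ⊎ y ≡ 1ℤ → x + + q - + 2 ≢ y + + p - + 2
      apart (inj₁ refl) (inj₁ refl) eq = p≢q (sym (ℤ.+-injective (add-2′ {+ q} {+ p} eq)))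
      apart (inj₁ refl) (inj₂ refl) eq = q≢1+p (ℤ.+-injective (add-2′ {+ q} {+ suc p} eq))
      apart (inj₂ refl) (inj₁ refl) eq = p≢1+q (sym (ℤ.+-injective (add-2′ {+ suc q} {+ p} eq)))
      apart (inj₂ refl) (inj₂ refl) eq = p≢q (ℕ.suc-injective (sym (ℤ.+-injective (add-2′ {+ suc q} {+ suc p} eq))))

  -- All that the combinatorics uses of primitivity.
  Spread : ∀ {r a b} → Colouring r a b → Fin r → Set
  Spread {r} {a} {b} C o = ∀ i → i ≢ o → ∀ l⋆ → ∃₂ λ l m → l ≢ l⋆ × Colouring.E C l m ≡ i

  module _ {r a b : ℕ} (C : Colouring r a b) where

    open Colouring C

    -- Distinct major colours d₀, d₁, d₂ would confine d₁ to the row l⋆ or d₂ to the column m⋆.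
    two-exceptions : ∀ {o l⋆ m⋆ d₀} → (∀ l → l ≢ l⋆ → dA l ≡ d₀) → (∀ m → m ≢ m⋆ → dB m ≡ d₀) →
                     dA l⋆ ≢ d₀ → dB m⋆ ≢ d₀ → dA l⋆ ≢ dB m⋆ → dA l⋆ ≢ o → dB m⋆ ≢ o →
                     Spread C o → Spread (transpose C) o → ⊥
    two-exceptions {o} {l⋆} {m⋆} {d₀} A-rest B-rest d₁≢d₀ d₂≢d₀ d₁≢d₂ d₁≢o d₂≢o spreadA spreadB
      with spreadA (dA l⋆) d₁≢o l⋆ | spreadB (dB m⋆) d₂≢o m⋆
    ... | l , m , l≢l⋆ , E≡d₁ | m′ , l′ , m′≢m⋆ , E≡d₂ = m′≢m⋆ (begin
      m′     ≡⟨ A-minor (λ eq → dA-cases l′ (trans (sym E≡d₂) eq)) ⟩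
      sA l′  ≡⟨ cong sA (trans (sym sB-m⋆≡l′) sB-m⋆≡l) ⟩
      sA l   ≡⟨ sA-l≡m ⟨
      m      ≡⟨ m≡m⋆ ⟩
      m⋆ ∎)
      where
      open ≡-Reasoning
      -- Write d₁, d₂ for the majors of `l⋆`, `m⋆`. No column has major d₁ and no row has major d₂,
      -- so an edge coloured d₁ is special for its column and one coloured d₂ for its row.
      dB-cases : ∀ k → dA l⋆ ≢ dB k
      dB-cases k eq with k ≟F m⋆
      ... | yes refl = d₁≢d₂ eq
      ... | no k≢    = d₁≢d₀ (trans eq (B-rest k k≢))
      dA-cases : ∀ k → dB m⋆ ≢ dA k
      dA-cases k eq with k ≟F l⋆
      ... | yes refl = d₁≢d₂ (sym eq)
      ... | no k≢    = d₂≢d₀ (trans eq (A-rest k k≢))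

      sA-l≡m : m ≡ sA l
      sA-l≡m = A-minor (λ eq → d₁≢d₀ (trans (sym E≡d₁) (trans eq (A-rest l l≢l⋆))))
      sB-m≡l : l ≡ sB m
      sB-m≡l = B-minor (λ eq → dB-cases m (trans (sym E≡d₁) eq))
      sA-l⋆≡m : m ≡ sA l⋆
      sA-l⋆≡m = A-minor (λ eq → dB-cases m (trans (sym eq) (B-major l⋆ m (λ l⋆≡ → l≢l⋆ (trans sB-m≡l (sym l⋆≡))))))

      -- Otherwise the edge (l⋆, m⋆) has colour d₁, so `l⋆` is the special row of `m⋆`. Then (l, m⋆)
      -- has colour d₂ and is a second special edge of row `l`, besides (l, m).
      m≡m⋆ : m ≡ m⋆
      m≡m⋆ = decidable-stable (m ≟F m⋆) (λ m≢m⋆ →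
        let sB-m⋆≡l⋆ : l⋆ ≡ sB m⋆
            sB-m⋆≡l⋆ = B-minor (λ eq → d₁≢d₂ (trans (sym (A-major l⋆ m⋆ (λ m⋆≡ → m≢m⋆ (trans sA-l⋆≡m (sym m⋆≡))))) eq))
            E-l-m⋆ : E l m⋆ ≡ dB m⋆
            E-l-m⋆ = B-major l m⋆ (λ l≡ → l≢l⋆ (trans l≡ (sym sB-m⋆≡l⋆)))
            m⋆≡sA-l : m⋆ ≡ sA l
            m⋆≡sA-l = A-minor (λ eq → d₂≢d₀ (trans (sym E-l-m⋆) (trans eq (A-rest l l≢l⋆))))
        in m≢m⋆ (trans sA-l≡m (sym m⋆≡sA-l)))

      sB-m⋆≡l : sB m⋆ ≡ l
      sB-m⋆≡l = sym (trans sB-m≡l (cong sB m≡m⋆))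
      -- Row `l′` has its special edge at `m′`, so at `m⋆` it shows its major, which is not d₂;
      -- hence `l′` is the special row of `m⋆`.
      sB-m⋆≡l′ : sB m⋆ ≡ l′
      sB-m⋆≡l′ = sym (B-minor (λ eq → dA-cases l′ (trans (sym eq)
        (A-major l′ m⋆ (λ m⋆≡ → m′≢m⋆ (trans (A-minor (λ eq′ → dA-cases l′ (trans (sym E≡d₂) eq′))) (sym m⋆≡)))))))

  module _ {r p q : ℕ} (C : Colouring r (suc p) (suc q)) (o : Fin r) where

    open Colouring C
    open Weights C

    -- Apart from `o`, the colour of the identity, only `major`, `dA l⋆` and `dB m⋆` can be
    -- excluded, so a fifth colour would do. Without one there are at most four colours: four fall
    -- to `two-exceptions`, three to the weights, and two contradict the rank.
    exists-minor-colour :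
      3 ℕ.≤ p → 3 ℕ.≤ q → p ≢ q → p ≢ suc q → q ≢ suc p → 3 ℕ.≤ r →
      (∀ l m → E l m ≢ o) → Spread C o → Spread (transpose C) o →
      (∀ X Y → X ≢ Y → X ≢ o → Y ≢ o → (∀ i → i ≡ o ⊎ i ≡ Y ⊎ i ≡ X) → TwoValued X) →
      ∃ λ f → f ≢ o × (∀ l → dA l ≢ f) × (∀ m → dB m ≢ f)
    exists-minor-colour 3≤p 3≤q p≢q p≢1+q q≢1+p 3≤r E≢o spreadA spreadB two =
      search (any? (λ f → ¬? (f ≟F o) ×-dec ¬? (f ≟F major) ×-dec ¬? (f ≟F dA l⋆) ×-dec ¬? (f ≟F dB m⋆)))
      where
      open Concentrated (concentrated (s≤s 3≤p) (s≤s 3≤q) (p≢q ∘ ℕ.suc-injective) C)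

      dA≢o : ∀ l → dA l ≢ o
      dA≢o l eq with avoid₃ (s≤s 3≤q) (sA l) (sA l) (sA l)
      ... | m , m≢ , _ = E≢o l m (trans (A-major l m m≢) eq)
      dB≢o : ∀ m → dB m ≢ o
      dB≢o m eq with avoid₃ (s≤s 3≤p) (sB m) (sB m) (sB m)
      ... | l , l≢ , _ = E≢o l m (trans (B-major l m l≢) eq)
      major≢o : major ≢ o
      major≢o eq with avoid₃ (s≤s 3≤p) l⋆ l⋆ l⋆
      ... | l , l≢ , _ = dA≢o l (trans (A-rest l l≢) eq)

      Minor : Fin r → Set
      Minor f = f ≢ o × f ≢ major × f ≢ dA l⋆ × f ≢ dB m⋆

      stuck : ¬ ∃ Minor → ⊥
      stuck none = cases (dA l⋆ ≟F major) (dB m⋆ ≟F major) (dA l⋆ ≟F dB m⋆)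
        where
        -- When both exceptional majors lie among `major` and one further `X`, the lack of a minor
        -- colour leaves three colours in all. This is the rank three situation covered by `two`.
        module _ {X} (X≢major : X ≢ major) (A-case : dA l⋆ ≡ major ⊎ dA l⋆ ≡ X) (B-case : dB m⋆ ≡ major ⊎ dB m⋆ ≡ X) where

          merge : ∀ {i d} → d ≡ major ⊎ d ≡ X → i ≢ major → i ≢ X → i ≢ d
          merge (inj₁ refl) i≢ _ = i≢
          merge (inj₂ refl) _ i≢ = i≢

          colours : ∀ i → i ≡ o ⊎ i ≡ major ⊎ i ≡ X
          colours i = decidable-stable ((i ≟F o) ⊎-dec (i ≟F major) ⊎-dec (i ≟F X)) (λ i∉ →
            none (i , i∉ ∘ inj₁ , i∉ ∘ inj₂ ∘ inj₁
                    , merge A-case (i∉ ∘ inj₂ ∘ inj₁) (i∉ ∘ inj₂ ∘ inj₂)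
                    , merge B-case (i∉ ∘ inj₂ ∘ inj₁) (i∉ ∘ inj₂ ∘ inj₂)))

          two-valued : X ≢ o → TwoValued X
          two-valued X≢o = two X major X≢major X≢o major≢o colours

        B-all : dB m⋆ ≡ major → ∀ m → dB m ≡ major
        B-all eq m with m ≟F m⋆
        ... | yes refl = eq
        ... | no m≢    = B-rest m m≢
        A-all : dA l⋆ ≡ major → ∀ l → dA l ≡ major
        A-all eq l with l ≟F l⋆
        ... | yes refl = eq
        ... | no l≢    = A-rest l l≢

        cases : Dec (dA l⋆ ≡ major) → Dec (dB m⋆ ≡ major) → Dec (dA l⋆ ≡ dB m⋆) → ⊥
        -- Here only the colours `o` and `major` remain, against 3 ≤ r.
        cases (yes eqA) (yes eqB) _ with pigeonhole 3≤r code
          where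
          code : Fin r → Fin 2
          code i with i ≟F o
          ... | yes _ = zero
          ... | no _  = suc zero
        ... | i , j , i<j , eq with i ≟F o | j ≟F o
        ...   | yes refl | yes refl = Fin.<-irrefl refl i<j
        ...   | no i≢o   | no j≢o   = Fin.<-irrefl (trans (only i i≢o) (sym (only j j≢o))) i<j
          where
          only : ∀ i → i ≢ o → i ≡ major
          only i i≢o = decidable-stable (i ≟F major) (λ i≢ → none (i , i≢o , i≢ ,
            (λ e → i≢ (trans e eqA)) , (λ e → i≢ (trans e eqB))))
        cases (no d₁≢) (yes eqB) _ with spreadA (dA l⋆) (dA≢o l⋆) l⋆
        ... | l , m , l≢ , E≡ = exceptional-row 3≤q C (d₁≢ ∘ sym) refl A-rest (B-all eqB)
                (two-valued d₁≢ (inj₂ refl) (inj₁ eqB) (dA≢o l⋆)) l≢ E≡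
        cases (yes eqA) (no d₂≢) _ with spreadB (dB m⋆) (dB≢o m⋆) m⋆
        ... | m , l , m≢ , E≡ = exceptional-row 3≤p (transpose C) (d₂≢ ∘ sym) refl B-rest (A-all eqA)
                (two-valued-transpose C (two-valued d₂≢ (inj₁ eqA) (inj₂ refl) (dB≢o m⋆))) m≢ E≡
        cases (no d₁≢) (no d₂≢) (yes d₁≡d₂) =
          exceptional-cross 3≤q C 3≤p p≢q p≢1+q q≢1+p (d₁≢ ∘ sym) refl A-rest (sym d₁≡d₂) B-rest
            (two-valued d₁≢ (inj₂ refl) (inj₂ (sym d₁≡d₂)) (dA≢o l⋆))
        cases (no d₁≢) (no d₂≢) (no d₁≢d₂) =
          two-exceptions C A-rest B-rest d₁≢ d₂≢ d₁≢d₂ (dA≢o l⋆) (dB≢o m⋆) spreadA spreadB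

      search : Dec (∃ Minor) → ∃ λ f → f ≢ o × (∀ l → dA l ≢ f) × (∀ m → dB m ≢ f)
      search (yes (f , f≢o , f≢d₀ , f≢d₁ , f≢d₂)) = f , f≢o , rows-avoid , columns-avoid
        where
        rows-avoid : ∀ l → dA l ≢ f
        rows-avoid l eq with l ≟F l⋆
        ... | yes refl = f≢d₁ (sym eq)
        ... | no l≢    = f≢d₀ (trans (sym eq) (A-rest l l≢))
        columns-avoid : ∀ m → dB m ≢ f
        columns-avoid m eq with m ≟F m⋆
        ... | yes refl = f≢d₂ (sym eq)
        ... | no m≢    = f≢d₀ (trans (sym eq) (B-rest m m≢))
      search (no none) = ⊥-elim (stuck none)

-- The affine relation between weights and eigenvalues.

module WeightSpectrum where

  open import Data.Integer using (_+_; _*_; _-_)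
  open import Algebra.Properties.AbelianGroup ℤ.+-0-abelianGroup using () renaming (∙-cancelˡ to +-cancelˡ; ∙-cancelʳ to +-cancelʳ)
  open FiniteSums
  open Colourings

  open ≡-Reasoning

  -- Subtracting the equations gives (x - y)(x + y - β) = 0. So a root determines the only other
  -- one, which leaves no room for a third.
  factor-sum : ∀ α β {x y} → x ≢ y → x * x ≡ α + β * x → y * y ≡ α + β * y → x + y ≡ β
  factor-sum α β {x} {y} x≢y eqx eqy = go (ℤ.i*j≡0⇒i≡0∨j≡0 (x - y)
      (trans (expand x y β) (trans (cong₂ (λ u v → u - v - β * (x - y)) eqx eqy) (vanish α β x y))))
    where
    expand : ∀ x y β → (x - y) * (x + y - β) ≡ x * x - y * y - β * (x - y)
    expand = solve-∀
    vanish : ∀ α β x y → α + β * x - (α + β * y) - β * (x - y) ≡ 0ℤ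
    vanish = solve-∀
    go : x - y ≡ 0ℤ ⊎ x + y - β ≡ 0ℤ → x + y ≡ β
    go (inj₁ x-y≡0)   = ⊥-elim (x≢y (ℤ.i-j≡0⇒i≡j x y x-y≡0))
    go (inj₂ x+y-β≡0) = ℤ.i-j≡0⇒i≡j (x + y) β x+y-β≡0

  no-three-roots : ∀ α β {x y z} → x * x ≡ α + β * x → y * y ≡ α + β * y → z * z ≡ α + β * z →
                   x ≢ y → y ≢ z → x ≢ z → ⊥
  no-three-roots α β {x} {y} {z} eqx eqy eqz x≢y y≢z x≢z =
    y≢z (+-cancelˡ x y z (trans (factor-sum α β x≢y eqx eqy) (sym (factor-sum α β x≢z eqx eqz))))

  module _ {r p q : ℕ} (C : Colouring r (suc p) (suc q)) (X : Fin r) where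

    open Colouring C
    open Weights C X

    degree : Fin (suc p) → ℤ
    degree l = ∑ columns (λ m → 𝟙 (E l m ≟F X))

    #vA #vB : ℤ
    #vA = ∑ rows (λ l → 𝟙 (vA l ≟F X))
    #vB = ∑ columns (λ m → 𝟙 (vB m ≟F X))

    degree-formula : ∀ l → degree l ≡ 𝟙 (vA l ≟F X) + + q * 𝟙 (dA l ≟F X)
    degree-formula l = begin
      degree l
        ≡⟨ ∑-cong columns pointwise ⟩
      ∑ columns (λ m → 𝟙 (m ≟F sA l) * (v - d) + d)
        ≡⟨ ∑-+ columns (λ m → 𝟙 (m ≟F sA l) * (v - d)) (λ _ → d) ⟩
      ∑ columns (λ m → 𝟙 (m ≟F sA l) * (v - d)) + ∑ columns (λ _ → d)
        ≡⟨ cong₂ _+_ (pick (enumerates-allFin (suc q)) (sA l) (λ _ → v - d)) (∑-const (suc q) d) ⟩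
      v - d + (1ℤ + + q) * d
        ≡⟨ ring v d (+ q) ⟩
      v + + q * d ∎
      where
      v = 𝟙 (vA l ≟F X)
      d = 𝟙 (dA l ≟F X)

      ring : ∀ v d q → v - d + (1ℤ + q) * d ≡ v + q * d
      ring = solve-∀
      special : ∀ v d → v ≡ 1ℤ * (v - d) + d
      special = solve-∀
      ordinary : ∀ v d → d ≡ 0ℤ * (v - d) + d
      ordinary = solve-∀

      pointwise : ∀ m → 𝟙 (E l m ≟F X) ≡ 𝟙 (m ≟F sA l) * (v - d) + d
      pointwise m with m ≟F sA l
      ... | yes refl = trans (cong (λ i → 𝟙 (i ≟F X)) (A-special l)) (special v d)
      ... | no m≢    = trans (cong (λ i → 𝟙 (i ≟F X)) (A-major l m m≢)) (ordinary v d)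

    ∑-degree : ∑ rows degree ≡ #vA + + q * #dA
    ∑-degree = trans (∑-cong rows degree-formula)
      (trans (∑-+ rows (λ l → 𝟙 (vA l ≟F X)) (λ l → + q * 𝟙 (dA l ≟F X)))
             (+ℤ-congˡ #vA (∑-*ˡ rows (+ q) (λ l → 𝟙 (dA l ≟F X)))))

  module _ {r p q : ℕ} (C : Colouring r (suc p) (suc q)) (X : Fin r) where

    open Colouring C
    open Weights C X

    -- Both sides count the edges of colour `X`, by rows and by columns. This ties the row
    -- statistics to those of the columns.
    edge-balance : #vA C X + + q * #dA ≡ #vB C X + + p * #dB
    edge-balance = trans (sym (∑-degree C X))
      (trans (∑-swap rows columns (λ l m → 𝟙 (E l m ≟F X))) (∑-degree (transpose C) X))

    -- `J l` is the number of elements of the basic set above a nonzero point of the line `l`: its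
    -- vertex, and q - 1 elements for each edge. Above 0 there are q - 1 for each column vertex, so
    -- the left side is the Fourier value of this count. After `edge-balance` only the weight
    -- depends on `l`.
    eigenvalue-weight : (J : Fin (suc p) → ℤ) → (∀ l → J l ≡ 𝟙 (vA l ≟F X) + (+ q - 1ℤ) * degree C X l) →
      ∀ l → (+ q - 1ℤ) * #vB C X + + p * J l - ∑ rows J ≡ + p * + q * weight (inj₁ l) + (+ p * #dB - #vA C X)
    eigenvalue-weight J J-formula l = begin
      (+ q - 1ℤ) * #vB C X + + p * J l - ∑ rows J
        ≡⟨ cong₂ (λ x y → (+ q - 1ℤ) * #vB C X + + p * x - y)
             (trans (J-formula l) (cong (λ x → v + (+ q - 1ℤ) * x) (degree-formula C X l))) ∑J ⟩
      (+ q - 1ℤ) * #vB C X + + p * (v + (+ q - 1ℤ) * (v + + q * d)) - (#vA C X + (+ q - 1ℤ) * (#vA C X + + q * #dA))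
        ≡⟨ ring₁ (+ p) (+ q) v d (#vA C X) #dA (#vB C X) #dB ⟩
      + p * + q * weight (inj₁ l) + (+ p * #dB - #vA C X) - (+ q - 1ℤ) * (#vA C X + + q * #dA - (#vB C X + + p * #dB))
        ≡⟨ cong (λ x → + p * + q * weight (inj₁ l) + (+ p * #dB - #vA C X) - (+ q - 1ℤ) * x)
             (ℤ.i≡j⇒i-j≡0 edge-balance) ⟩
      + p * + q * weight (inj₁ l) + (+ p * #dB - #vA C X) - (+ q - 1ℤ) * 0ℤ
        ≡⟨ ring₂ _ (+ q) ⟩
      + p * + q * weight (inj₁ l) + (+ p * #dB - #vA C X) ∎
      where
      v = 𝟙 (vA l ≟F X)
      d = 𝟙 (dA l ≟F X)

      ∑J : ∑ rows J ≡ #vA C X + (+ q - 1ℤ) * (#vA C X + + q * #dA)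
      ∑J = trans (∑-cong rows J-formula)
        (trans (∑-+ rows (λ l → 𝟙 (vA l ≟F X)) (λ l → (+ q - 1ℤ) * degree C X l))
          (+ℤ-congˡ (#vA C X) (trans (∑-*ˡ rows (+ q - 1ℤ) (degree C X)) (cong ((+ q - 1ℤ) *_) (∑-degree C X)))))

      ring₁ : ∀ p q v d nA dA nB dB →
        (q - 1ℤ) * nB + p * (v + (q - 1ℤ) * (v + q * d)) - (nA + (q - 1ℤ) * (nA + q * dA)) ≡
        p * q * (v + (q - 1ℤ) * d - dB) + (p * dB - nA) - (q - 1ℤ) * (nA + q * dA - (nB + p * dB))
      ring₁ = solve-∀
      ring₂ : ∀ x q → x - (q - 1ℤ) * 0ℤ ≡ x
      ring₂ = solve-∀

    -- With equal constants for rows and columns, a single affine map takes all weights to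
    -- eigenvalues, so that a row can be compared with a column.
    offset-symmetric : + q * #dA - #vB C X ≡ + p * #dB - #vA C X
    offset-symmetric = begin
      + q * #dA - #vB C X
        ≡⟨ ring₁ (#vA C X) (#vB C X) (+ q * #dA) ⟩
      #vA C X + + q * #dA - #vA C X - #vB C X
        ≡⟨ cong (λ x → x - #vA C X - #vB C X) edge-balance ⟩
      #vB C X + + p * #dB - #vA C X - #vB C X
        ≡⟨ ring₂ (#vA C X) (#vB C X) (+ p * #dB) ⟩
      + p * #dB - #vA C X ∎
      where
      ring₁ : ∀ a b x → x - b ≡ a + x - a - b
      ring₁ = solve-∀
      ring₂ : ∀ a b x → b + x - a - b ≡ x - a
      ring₂ = solve-∀

    quadratic⇒two-valued : ∀ α β κ (θ : Fin (suc p) ⊎ Fin (suc q) → ℤ) →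
      (∀ x → θ x ≡ + p * + q * weight x + κ) → (∀ x → θ x * θ x ≡ α + β * θ x) →
      .{{_ : ℕ.NonZero p}} .{{_ : ℕ.NonZero q}} → TwoValued
    quadratic⇒two-valued α β κ θ affine quadratic x y z x≢y y≢z x≢z =
      no-three-roots α β (quadratic x) (quadratic y) (quadratic z) (distinct x≢y) (distinct y≢z) (distinct x≢z)
      where
      distinct : ∀ {x y} → weight x ≢ weight y → θ x ≢ θ y
      distinct {x} {y} w≢ θ≡ = w≢ (ℤ.*-cancelˡ-≡ (+ q) _ _ (ℤ.*-cancelˡ-≡ (+ p) _ _ (begin
        + p * (+ q * weight x)   ≡⟨ ℤ.*-assoc (+ p) (+ q) _ ⟨
        + p * + q * weight x     ≡⟨ +-cancelʳ κ _ _ (trans (sym (affine x)) (trans θ≡ (affine y))) ⟩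
        + p * + q * weight y     ≡⟨ ℤ.*-assoc (+ p) (+ q) _ ⟩
        + p * (+ q * weight y) ∎)))

-- S-rings over G, and Schur's theorem on p-th powers.

module SRings where

  open import Algebra.Structures using (IsCommutativeMonoid)
  import Data.Bool.Properties as Bool
  open import Data.Fin.Properties using (all?; any?)
  open import Data.Integer using (_+_; _*_)
  open import Data.List using (map; filter)
  open import Function using (mk⇔)
  open import Relation.Nullary.Decidable using (_×-dec_; _→-dec_; map′; dec-true; dec-false; does-⇔)
  open FiniteSums
  open Frobenius
  open PrimePlane

  open ≡-Reasoning

  does-true : {A : Set} (a? : Dec A) → does a? ≡ true → A
  does-true (yes a) _ = a

  module GroupG (p q : ℕ) (pp : Prime p) (qq : Prime q) where

    open Over p q pp qq public
    module P = Plane p pp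
    module Q = Plane q qq

    infixr 5 _⋈_
    _⋈_ : P.V → Q.V → G
    (a , b) ⋈ (c , d) = a , b , c , d

    p-part : G → P.V
    p-part (a , b , c , d) = a , b
    q-part : G → Q.V
    q-part (a , b , c , d) = c , d

    ∑G : (G → ℤ) → ℤ
    ∑G = ∑ elems

    ∑G-⋈ : ∀ f → ∑G f ≡ P.∑V (λ u → Q.∑V (λ y → f (u ⋈ y)))
    ∑G-⋈ f = trans (∑-concatMap _ P.F f) (∑-cong P.F λ a → trans (∑-concatMap _ P.F f) (∑-cong P.F λ b →
      trans (∑-concatMap _ Q.F f) (∑-cong Q.F λ c → ∑-map _ Q.F f)))

    enumG : Enumerates _≟G_ elems
    enumG = enumerates λ { g@(a , b , c , d) f →
      let h = λ x → 𝟙 (x ≟G g) * f x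
          off : ∀ x → x ≢ g → h x ≡ 0ℤ
          off x x≢g = cong (_* f x) (𝟙-no (x ≟G g) x≢g)
      in begin
        ∑G h
          ≡⟨ ∑G-⋈ h ⟩
        P.∑V (λ u → Q.∑V (λ y → h (u ⋈ y)))
          ≡⟨ P.∑V-zero-except (a , b) _ (λ u u≢ → trans (Q.∑V-cong (λ y → off (u ⋈ y) (u≢ ∘ cong p-part))) Q.∑V-0) ⟩
        Q.∑V (λ y → h ((a , b) ⋈ y))
          ≡⟨ Q.∑V-zero-except (c , d) _ (λ y y≢ → off ((a , b) ⋈ y) (y≢ ∘ cong q-part)) ⟩
        h g
          ≡⟨ cong (_* f g) (𝟙-yes (g ≟G g) refl) ⟩
        1ℤ * f g
          ≡⟨ ℤ.*-identityˡ (f g) ⟩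
        f g ∎ }

    ·-assoc : ∀ x y z → (x · y) · z ≡ x · (y · z)
    ·-assoc (a , b , c , d) (a′ , b′ , c′ , d′) (a″ , b″ , c″ , d″) =
      cong₂ _,_ (P.⊕-assoc a a′ a″) (cong₂ _,_ (P.⊕-assoc b b′ b″) (cong₂ _,_ (Q.⊕-assoc c c′ c″) (Q.⊕-assoc d d′ d″)))

    ·-comm : ∀ x y → x · y ≡ y · x
    ·-comm (a , b , c , d) (a′ , b′ , c′ , d′) =
      cong₂ _,_ (P.⊕-comm a a′) (cong₂ _,_ (P.⊕-comm b b′) (cong₂ _,_ (Q.⊕-comm c c′) (Q.⊕-comm d d′)))

    ·-identityˡ : ∀ x → e · x ≡ x
    ·-identityˡ (a , b , c , d) =
      cong₂ _,_ (P.⊕-identityˡ a) (cong₂ _,_ (P.⊕-identityˡ b) (cong₂ _,_ (Q.⊕-identityˡ c) (Q.⊕-identityˡ d)))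

    ·-identityʳ : ∀ x → x · e ≡ x
    ·-identityʳ x = trans (·-comm x e) (·-identityˡ x)

    ·-inverseˡ : ∀ x → inv x · x ≡ e
    ·-inverseˡ (a , b , c , d) =
      cong₂ _,_ (P.⊕-inverseˡ a) (cong₂ _,_ (P.⊕-inverseˡ b) (cong₂ _,_ (Q.⊕-inverseˡ c) (Q.⊕-inverseˡ d)))

    inv-·-cancel : ∀ x y → inv x · (x · y) ≡ y
    inv-·-cancel x y = trans (sym (·-assoc (inv x) x y)) (trans (cong (_· y) (·-inverseˡ x)) (·-identityˡ y))

    ·-inv-cancel : ∀ x y → x · (inv x · y) ≡ y
    ·-inv-cancel x y = trans (sym (·-assoc x (inv x) y))
      (trans (cong (_· y) (trans (·-comm x (inv x)) (·-inverseˡ x))) (·-identityˡ y))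

    ·-isCommutativeMonoid : IsCommutativeMonoid _≡_ _·_ e
    ·-isCommutativeMonoid = record
      { isMonoid = record
        { isSemigroup = record { isMagma = record { isEquivalence = isEquivalence ; ∙-cong = cong₂ _·_ } ; assoc = ·-assoc }
        ; identity = ·-identityˡ , ·-identityʳ }
      ; comm = ·-comm }

    pow-suc : ∀ x k → pow x (suc k) ≡ x · pow x k
    pow-suc (a , b , c , d) k = cong₂ _,_ (step-p a) (cong₂ _,_ (step-p b) (cong₂ _,_ (step-q c) (step-q d)))
      where
      step-p : ∀ a → P.ι (suc k ℕ.* toℕ a) ≡ a P.⊕ P.ι (k ℕ.* toℕ a)
      step-p a = trans (P.ι-+ (toℕ a) (k ℕ.* toℕ a)) (cong (P._⊕ P.ι (k ℕ.* toℕ a)) (P.ι-toℕ a))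
      step-q : ∀ a → Q.ι (suc k ℕ.* toℕ a) ≡ a Q.⊕ Q.ι (k ℕ.* toℕ a)
      step-q a = trans (Q.ι-+ (toℕ a) (k ℕ.* toℕ a)) (cong (Q._⊕ Q.ι (k ℕ.* toℕ a)) (Q.ι-toℕ a))

    pow-⋈ : ∀ u y m → pow (u ⋈ y) m ≡ P.ι m P.∙ u ⋈ Q.ι m Q.∙ y
    pow-⋈ (a , b) (c , d) m =
      cong₂ _,_ (P.scale-⊗ m a) (cong₂ _,_ (P.scale-⊗ m b) (cong₂ _,_ (Q.scale-⊗ m c) (Q.scale-⊗ m d)))

    all-G? : {R : G → Set} → (∀ x → Dec (R x)) → Dec (∀ x → R x)
    all-G? R? = map′ (λ { h (a , b , c , d) → h a b c d }) (λ h a b c d → h (a , b , c , d))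
      (all? λ a → all? λ b → all? λ c → all? λ d → R? (a , b , c , d))

    any-G? : {R : G → Set} → (∀ x → Dec (R x)) → Dec (∃ R)
    any-G? R? = map′ (λ { (a , b , c , d , h) → (a , b , c , d) , h }) (λ { ((a , b , c , d) , h) → a , b , c , d , h })
      (any? λ a → any? λ b → any? λ c → any? λ d → R? (a , b , c , d))

    count-∑ : (R : G → Set) (R? : ∀ x → Dec (R x)) → + count R R? ≡ ∑G (𝟙 ∘ R?)
    count-∑ R R? = length-filter R? elems

    count-witness : (R : G → Set) (R? : ∀ x → Dec (R x)) → count R R? ≢ 0 → ∃ R
    count-witness R R? c≢0 = ∑𝟙-witness R? elems (λ s≡0 → c≢0 (ℤ.+-injective (trans (count-∑ R R?) s≡0)))

    count-≢0 : (R : G → Set) (R? : ∀ x → Dec (R x)) → ∃ R → count R R? ≢ 0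
    count-≢0 R R? (g , r) c≡0 = ℤ.<⇒≱ {0ℤ} {1ℤ} (ℤ.+<+ (ℕ.s≤s ℕ.z≤n))
      (subst (1ℤ ℤ.≤_) (trans (sym (count-∑ R R?)) (cong +_ c≡0)) (∑𝟙-positive enumG R? r))

    ∑G-translate : ∀ x (f : G → ℤ) → ∑G (λ y → f (x · y)) ≡ ∑G f
    ∑G-translate x = ∑-reindex enumG enumG (x ·_) (inv x ·_) (inv-·-cancel x) (·-inv-cancel x)

    module SRing {r : ℕ} (c : G → Fin r) (isSRing : IsSRing c) where

      open IsSRing isSRing

      structConst-∑ : ∀ i j z → + structConst c i j z ≡ ∑G (λ x → 𝟙 (c x ≟F i) * 𝟙 (c (inv x · z) ≟F j))
      structConst-∑ i j z = trans (count-∑ _ _) (∑-cong elems (λ x → 𝟙-× (c x ≟F i) (c (inv x · z) ≟F j)))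

      -- The structure constant for the basic sets of `x` and `y` is positive at `x · y`, hence also
      -- at `w`, and a positive count has a witness.
      factor : ∀ x y w → c w ≡ c (x · y) → ∃₂ λ x′ y′ → c x′ ≡ c x × c y′ ≡ c y × x′ · y′ ≡ w
      factor x y w w~xy with count-witness _ (λ z → (c z ≟F c x) ×-dec (c (inv z · w) ≟F c y))
        (λ eq → count-≢0 _ (λ z → (c z ≟F c x) ×-dec (c (inv z · (x · y)) ≟F c y))
          (x , refl , cong c (inv-·-cancel x y)) (trans (mult-closed (c x) (c y) (x · y) w (sym w~xy)) eq))
      ... | x′ , x′~x , y′~y = x′ , inv x′ · w , x′~x , y′~y , ·-inv-cancel x′ w

      -- The elements whose whole basic set lies in K form a subgroup which is a union of basic sets.
      class⊄subgroup : IsPrimitive c → (K : G → Bool) → IsSubgroup K → (∃ λ y → K y ≡ false) →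
                       ∀ x → x ≢ e → ¬ (∀ w → c w ≡ c x → K w ≡ true)
      class⊄subgroup primitive′ K K-subgroup (y , Ky≡false) x x≢e x⊂K =
        primitive′ H H-subgroup H-class ((x , H-intro x⊂K , x≢e) , (y , Hy≡false))
        where
        open IsSubgroup K-subgroup
        Inside : G → Set
        Inside x = ∀ w → c w ≡ c x → K w ≡ true
        inside? : ∀ x → Dec (Inside x)
        inside? x = all-G? (λ w → (c w ≟F c x) →-dec (K w Bool.≟ true))

        H : G → Bool
        H x = does (inside? x)
        H-intro : ∀ {x} → Inside x → H x ≡ true
        H-intro {x} = dec-true (inside? x)
        H-elim : ∀ {x} → H x ≡ true → Inside x
        H-elim {x} = does-true (inside? x)

        H-subgroup : IsSubgroup H
        H-subgroup = record
          { has-e   = H-intro (λ w w~e → subst (λ z → K z ≡ true) (sym (identity w w~e)) has-e)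
          ; has-mul = λ x y Hx Hy → H-intro (λ w w~xy → product x y Hx Hy w (factor x y w w~xy))
          ; has-inv = λ x Hx → H-intro (λ w w~x⁻¹ → subst (λ z → K z ≡ true) (inv-involutive w)
              (has-inv (inv w) (H-elim Hx (inv w) (trans (inverse w (inv x) w~x⁻¹) (cong c (inv-involutive x)))))) }
          where
          product : ∀ x y → H x ≡ true → H y ≡ true → ∀ w → (∃₂ λ x′ y′ → c x′ ≡ c x × c y′ ≡ c y × x′ · y′ ≡ w) → K w ≡ true
          product x y Hx Hy w (x′ , y′ , x′~x , y′~y , refl) = has-mul x′ y′ (H-elim Hx x′ x′~x) (H-elim Hy y′ y′~y)
          inv-involutive : ∀ x → inv (inv x) ≡ x
          inv-involutive x = begin
            inv (inv x)                  ≡⟨ ·-identityʳ _ ⟨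
            inv (inv x) · e              ≡⟨ cong (inv (inv x) ·_) (·-inverseˡ x) ⟨
            inv (inv x) · (inv x · x)    ≡⟨ inv-·-cancel (inv x) x ⟩
            x ∎

        H-class : InSRing c H
        H-class x y x~y = does-⇔ (mk⇔ (λ h w w~y → h w (trans w~y (sym x~y))) (λ h w w~x → h w (trans w~x x~y)))
                            (inside? x) (inside? y)

        Hy≡false : H y ≡ false
        Hy≡false = dec-false (inside? y) (λ h → Bool.not-¬ (h y refl) Ky≡false)

      module _ (n : ℕ) (pn : Prime n) (i : Fin r) where

        open Congruence n
        open MonoidSemiring ·-isCommutativeMonoid n hiding (module L)

        X : List G
        X = filter (λ x → c x ≟F i) elems

        δ : G → G → ℤ
        δ z x = 𝟙 (x ≟G z)

        coefficient : ℕ → G → ℤ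
        coefficient k z = ∑ (X ^ k) (δ z)

        coefficient-suc : ∀ k z → coefficient (suc k) z ≡ ∑G (λ x → 𝟙 (c x ≟F i) * coefficient k (inv x · z))
        coefficient-suc k z = begin
          ∑ (X ⊛ (X ^ k)) (δ z)
            ≡⟨ ∑-⊛ X (X ^ k) (δ z) ⟩
          ∑ X (λ x → ∑ (X ^ k) (λ t → δ z (x · t)))
            ≡⟨ ∑-filter (λ x → c x ≟F i) elems _ ⟩
          ∑G (λ x → 𝟙 (c x ≟F i) * ∑ (X ^ k) (λ t → δ z (x · t)))
            ≡⟨ ∑-cong elems (λ x → cong (𝟙 (c x ≟F i) *_) (∑-cong (X ^ k) (λ t →
                 𝟙-⇔ ((x · t) ≟G z) (t ≟G (inv x · z))
                   (λ { refl → sym (inv-·-cancel x t) }) (λ { refl → ·-inv-cancel x z })))) ⟩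
          ∑G (λ x → 𝟙 (c x ≟F i) * coefficient k (inv x · z)) ∎

        -- Powers of a basic set stay in the S-ring: once the coefficients of the k-th power depend
        -- on the class alone, grouping the sum by the class of `inv x · z` turns the next
        -- coefficient into a combination of structure constants.
        coefficient-class : ∀ k z w → c z ≡ c w → coefficient k z ≡ coefficient k w
        coefficient-class zero z w z~w = cong (_+ 0ℤ) (𝟙-⇔ (e ≟G z) (e ≟G w)
          (λ { refl → sym (identity w (sym z~w)) }) (λ { refl → sym (identity z z~w) }))
        coefficient-class (suc k) z w z~w = trans (expand z) (trans
          (∑-cong (allFin r) (λ j → cong (λ s → + s * γ j) (mult-closed i j z w z~w))) (sym (expand w)))
          where
          γ : Fin r → ℤ
          γ j = coefficient k (proj₁ (partition j))

          γ-label : ∀ z → coefficient k z ≡ γ (c z)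
          γ-label z = coefficient-class k z _ (sym (proj₂ (partition (c z))))

          expand : ∀ z → coefficient (suc k) z ≡ ∑ (allFin r) (λ j → + structConst c i j z * γ j)
          expand z = begin
            coefficient (suc k) z
              ≡⟨ coefficient-suc k z ⟩
            ∑G (λ x → 𝟙 (c x ≟F i) * coefficient k (inv x · z))
              ≡⟨ ∑-cong elems (λ x → cong (𝟙 (c x ≟F i) *_) (trans (γ-label (inv x · z))
                   (sym (pick (enumerates-allFin r) (c (inv x · z)) γ)))) ⟩
            ∑G (λ x → 𝟙 (c x ≟F i) * ∑ (allFin r) (λ j → 𝟙 (j ≟F c (inv x · z)) * γ j))
              ≡⟨ ∑-cong elems (λ x → trans (sym (∑-*ˡ (allFin r) (𝟙 (c x ≟F i)) _)) (∑-cong (allFin r) (λ j →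
                   trans (sym (ℤ.*-assoc (𝟙 (c x ≟F i)) _ (γ j))) (cong (λ d → 𝟙 (c x ≟F i) * d * γ j)
                     (𝟙-⇔ (j ≟F c (inv x · z)) (c (inv x · z) ≟F j) sym sym))))) ⟩
            ∑G (λ x → ∑ (allFin r) (λ j → 𝟙 (c x ≟F i) * 𝟙 (c (inv x · z) ≟F j) * γ j))
              ≡⟨ ∑-swap elems (allFin r) _ ⟩
            ∑ (allFin r) (λ j → ∑G (λ x → 𝟙 (c x ≟F i) * 𝟙 (c (inv x · z) ≟F j) * γ j))
              ≡⟨ ∑-cong (allFin r) (λ j → trans (∑-*ʳ elems (γ j) _) (cong (_* γ j) (sym (structConst-∑ i j z)))) ⟩
            ∑ (allFin r) (λ j → + structConst c i j z * γ j) ∎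

        roots : G → ℤ
        roots z = ∑G (λ x → 𝟙 (c x ≟F i) * 𝟙 (pow x n ≟G z))

        pow-mpow : ∀ x k → mpow x k ≡ pow x k
        pow-mpow x zero    = refl
        pow-mpow x (suc k) = trans (cong (x ·_) (pow-mpow x k)) (sym (pow-suc x k))

        -- Modulo the prime n the n-th power of the list `X` is the list of n-th powers, in which
        -- `z` occurs once for each of its roots.
        roots-coefficient : ∀ z → coefficient n z ≋ roots z
        roots-coefficient z = ≋-trans (at (frobenius pn X) (δ z)) (≋-reflexive (begin
          ∑ (map (λ x → mpow x n) X) (δ z)
            ≡⟨ ∑-map (λ x → mpow x n) X (δ z) ⟩
          ∑ X (λ x → δ z (mpow x n))
            ≡⟨ ∑-filter (λ x → c x ≟F i) elems _ ⟩
          ∑G (λ x → 𝟙 (c x ≟F i) * δ z (mpow x n))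
            ≡⟨ ∑-cong elems (λ x → cong (λ y → 𝟙 (c x ≟F i) * δ z y) (pow-mpow x n)) ⟩
          roots z ∎))

        roots-class : ∀ z w → c z ≡ c w → roots z ≋ roots w
        roots-class z w z~w = ≋-trans (≋-sym (roots-coefficient z))
          (≋-trans (≋-reflexive (coefficient-class n z w z~w)) (roots-coefficient w))

        roots-witness : ∀ z → roots z ≢ 0ℤ → ∃ λ x → pow x n ≡ z
        roots-witness z ≢0 with ∑𝟙-witness (λ x → (c x ≟F i) ×-dec (pow x n ≟G z)) elems
          (≢0 ∘ trans (∑-cong elems (λ x → sym (𝟙-× (c x ≟F i) (pow x n ≟G z)))))
        ... | x , _ , eq = x , eq

-- The quadratic equation for eigenvalues in rank three.

module RankThreeSRings where

  open import Data.Integer using (_+_; _*_; _-_)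
  open FiniteSums
  open PrimePlane
  open SRings

  open ≡-Reasoning

  module Eigenvalues (p q : ℕ) (pp : Prime p) (qq : Prime q) where

    open GroupG p q pp qq

    module _ {r : ℕ} (c : G → Fin r) (isSRing : IsSRing c) where

      open SRing c isSRing
      open IsSRing isSRing

      module RankThree (X Y : Fin r) (X≢Y : X ≢ Y) (X≢o : X ≢ c e) (Y≢o : Y ≢ c e)
                       (colours : ∀ i → i ≡ c e ⊎ i ≡ Y ⊎ i ≡ X) where

        χ : G → ℤ
        χ x = 𝟙 (c x ≟F X)

        xX xY : G
        xX = proj₁ (partition X)
        xY = proj₁ (partition Y)

        sc : G → ℤ
        sc z = + structConst c X X z

        -- Named as for a strongly regular graph: the coefficients of the square of the basic set
        -- `X` at e, on `X` and on `Y`.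
        k λ′ μ : ℤ
        k  = sc e
        λ′ = sc xX
        μ  = sc xY

        sc-formula : ∀ z → sc z ≡ μ + (λ′ - μ) * χ z + (k - μ) * 𝟙 (z ≟G e)
        sc-formula z with colours (c z)
        ... | inj₁ z~e = subst (λ z → sc z ≡ μ + (λ′ - μ) * χ z + (k - μ) * 𝟙 (z ≟G e)) (sym (identity z z~e))
          (trans (ring k λ′ μ) (cong₂ (λ a b → μ + (λ′ - μ) * a + (k - μ) * b)
            (sym (𝟙-no (c e ≟F X) (X≢o ∘ sym))) (sym (𝟙-yes (e ≟G e) refl))))
          where
          ring : ∀ k l m → k ≡ m + (l - m) * 0ℤ + (k - m) * 1ℤ
          ring = solve-∀
        ... | inj₂ (inj₁ z~Y) = trans (cong +_ (mult-closed X X z xY (trans z~Y (sym (proj₂ (partition Y))))))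
          (trans (ring k λ′ μ) (cong₂ (λ a b → μ + (λ′ - μ) * a + (k - μ) * b)
            (sym (𝟙-no (c z ≟F X) (λ z~X → X≢Y (trans (sym z~X) z~Y))))
            (sym (𝟙-no (z ≟G e) (λ z≡e → Y≢o (trans (sym z~Y) (cong c z≡e)))))))
          where
          ring : ∀ k l m → m ≡ m + (l - m) * 0ℤ + (k - m) * 0ℤ
          ring = solve-∀
        ... | inj₂ (inj₂ z~X) = trans (cong +_ (mult-closed X X z xX (trans z~X (sym (proj₂ (partition X))))))
          (trans (ring k λ′ μ) (cong₂ (λ a b → μ + (λ′ - μ) * a + (k - μ) * b)
            (sym (𝟙-yes (c z ≟F X) z~X))
            (sym (𝟙-no (z ≟G e) (λ z≡e → X≢o (trans (sym z~X) (cong c z≡e)))))))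
          where
          ring : ∀ k l m → l ≡ m + (l - m) * 1ℤ + (k - m) * 0ℤ
          ring = solve-∀

        module _ (n : ℕ) (pn : Prime n) where

          open PrimeField n pn

          module _ (ψ : G → Fin n) (ψ-· : ∀ x y → ψ (x · y) ≡ ψ x ⊕ ψ y) (ψ-e : ψ e ≡ 0#) where

            -- An integral stand-in for a nontrivial character of ℤ/n; what counts is that it has
            -- sum 0 and value 1 at 0.
            w : Fin n → ℤ
            w j = 𝟙 (j ≟F 0#) - 𝟙 (j ≟F 1#)

            w-0 : w 0# ≡ 1ℤ
            w-0 = cong₂ _-_ (𝟙-yes (0# ≟F 0#) refl) (𝟙-no (0# ≟F 1#) (1≢0 ∘ sym))

            ∑w : ∑ F w ≡ 0ℤ
            ∑w = begin
              ∑ F w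
                ≡⟨ ∑-cong F (λ j → ring (𝟙 (j ≟F 0#)) (𝟙 (j ≟F 1#))) ⟩
              ∑ F (λ j → 𝟙 (j ≟F 0#) * 1ℤ + 𝟙 (j ≟F 1#) * (0ℤ - 1ℤ))
                ≡⟨ ∑-+ F (λ j → 𝟙 (j ≟F 0#) * 1ℤ) (λ j → 𝟙 (j ≟F 1#) * (0ℤ - 1ℤ)) ⟩
              ∑ F (λ j → 𝟙 (j ≟F 0#) * 1ℤ) + ∑ F (λ j → 𝟙 (j ≟F 1#) * (0ℤ - 1ℤ))
                ≡⟨ cong₂ _+_ (pick enumF 0# (λ _ → 1ℤ)) (pick enumF 1# (λ _ → 0ℤ - 1ℤ)) ⟩
              0ℤ ∎
              where
              ring : ∀ a b → a - b ≡ a * 1ℤ + b * (0ℤ - 1ℤ)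
              ring = solve-∀

            level : (G → ℤ) → Fin n → ℤ
            level f j = ∑G (λ y → 𝟙 (ψ y ≟F j) * f y)

            -- Such level sums give every nontrivial character that factors through ψ the same value
            -- θ at f, since the constant part t cancels.
            record Flat (f : G → ℤ) (t θ : ℤ) : Set where
              constructor mkFlat
              field level-at : ∀ j → level f j ≡ t + θ * 𝟙 (j ≟F 0#)
            open Flat

            ∑G-by-levels : ∀ (g : Fin n → ℤ) f → ∑G (λ y → g (ψ y) * f y) ≡ ∑ F (λ j → g j * level f j)
            ∑G-by-levels g f = begin
              ∑G (λ y → g (ψ y) * f y)
                ≡⟨ ∑-cong elems (λ y → trans (cong (_* f y) (sym (pick enumF (ψ y) g))) (sym (∑-*ʳ F (f y) _))) ⟩
              ∑G (λ y → ∑ F (λ j → 𝟙 (j ≟F ψ y) * g j * f y))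
                ≡⟨ ∑-swap elems F _ ⟩
              ∑ F (λ j → ∑G (λ y → 𝟙 (j ≟F ψ y) * g j * f y))
                ≡⟨ ∑-cong F (λ j → trans (∑-cong elems (λ y → trans
                     (cong (λ d → d * g j * f y) (𝟙-⇔ (j ≟F ψ y) (ψ y ≟F j) sym sym))
                     (ring (𝟙 (ψ y ≟F j)) (g j) (f y)))) (∑-*ˡ elems (g j) _)) ⟩
              ∑ F (λ j → g j * level f j) ∎
              where
              ring : ∀ a b c → a * b * c ≡ b * (a * c)
              ring = solve-∀

            -- Convolution with a function f whose level sums take one value off ψ = 0 acts on w ∘ ψ
            -- as a scalar.
            ∑G-w : ∀ {f t θ} → Flat f t θ →
                   ∀ a → ∑G (λ y → w (a ⊕ ψ y) * f y) ≡ θ * w a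
            ∑G-w {f} {t} {θ} flat a = begin
              ∑G (λ y → w (a ⊕ ψ y) * f y)
                ≡⟨ ∑G-by-levels (λ j → w (a ⊕ j)) f ⟩
              ∑ F (λ j → w (a ⊕ j) * level f j)
                ≡⟨ ∑-cong F (λ j → trans (cong (w (a ⊕ j) *_) (level-at flat j)) (ring (w (a ⊕ j)) t θ (𝟙 (j ≟F 0#)))) ⟩
              ∑ F (λ j → t * w (a ⊕ j) + 𝟙 (j ≟F 0#) * (θ * w (a ⊕ j)))
                ≡⟨ ∑-+ F (λ j → t * w (a ⊕ j)) (λ j → 𝟙 (j ≟F 0#) * (θ * w (a ⊕ j))) ⟩
              ∑ F (λ j → t * w (a ⊕ j)) + ∑ F (λ j → 𝟙 (j ≟F 0#) * (θ * w (a ⊕ j)))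
                ≡⟨ cong₂ _+_ (trans (∑-*ˡ F t (λ j → w (a ⊕ j))) (cong (t *_) (trans (∑-translate a w) ∑w)))
                             (pick enumF 0# (λ j → θ * w (a ⊕ j))) ⟩
              t * 0ℤ + θ * w (a ⊕ 0#)
                ≡⟨ cong₂ (λ x b → x + θ * w b) (ℤ.*-zeroʳ t) (⊕-identityʳ a) ⟩
              0ℤ + θ * w a
                ≡⟨ ℤ.+-identityˡ _ ⟩
              θ * w a ∎
              where
              ring : ∀ w t θ d → w * (t + θ * d) ≡ t * w + d * (θ * w)
              ring = solve-∀

            W : (G → ℤ) → ℤ
            W f = ∑G (λ z → w (ψ z) * f z)

            W-level : ∀ {f t θ} → Flat f t θ → W f ≡ θ
            W-level {f} {t} {θ} flat = begin
              W f                              ≡⟨ ∑-cong elems (λ y → cong (λ j → w j * f y) (⊕-identityˡ (ψ y))) ⟨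
              ∑G (λ y → w (0# ⊕ ψ y) * f y)    ≡⟨ ∑G-w flat 0# ⟩
              θ * w 0#                         ≡⟨ cong (θ *_) w-0 ⟩
              θ * 1ℤ                           ≡⟨ ℤ.*-identityʳ θ ⟩
              θ ∎

            -- `sc` is the convolution of χ with itself. The substitution z = x y lets the inner sum
            -- see a translate of `w`, from which `∑G-w` extracts one factor θ; the outer sum yields
            -- the other.
            W-convolution : ∀ {t θ} → Flat χ t θ → W sc ≡ θ * θ
            W-convolution {t} {θ} flat = begin
              W sc
                ≡⟨ ∑-cong elems (λ z → trans (cong (w (ψ z) *_) (structConst-∑ X X z)) (sym (∑-*ˡ elems (w (ψ z)) _))) ⟩
              ∑G (λ z → ∑G (λ x → w (ψ z) * (χ x * χ (inv x · z))))
                ≡⟨ ∑-swap elems elems _ ⟩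
              ∑G (λ x → ∑G (λ z → w (ψ z) * (χ x * χ (inv x · z))))
                ≡⟨ ∑-cong elems (λ x → ∑G-translate x (λ z → w (ψ z) * (χ x * χ (inv x · z)))) ⟨
              ∑G (λ x → ∑G (λ y → w (ψ (x · y)) * (χ x * χ (inv x · (x · y)))))
                ≡⟨ ∑-cong elems (λ x → trans (∑-cong elems (λ y → trans
                     (cong₂ (λ j g → w j * (χ x * χ g)) (ψ-· x y) (inv-·-cancel x y))
                     (ring₁ (w (ψ x ⊕ ψ y)) (χ x) (χ y)))) (∑-*ˡ elems (χ x) _)) ⟩
              ∑G (λ x → χ x * ∑G (λ y → w (ψ x ⊕ ψ y) * χ y))
                ≡⟨ ∑-cong elems (λ x → trans (cong (χ x *_) (∑G-w flat (ψ x))) (ring₂ (χ x) θ (w (ψ x)))) ⟩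
              ∑G (λ x → θ * (w (ψ x) * χ x))
                ≡⟨ ∑-*ˡ elems θ (λ x → w (ψ x) * χ x) ⟩
              θ * W χ
                ≡⟨ cong (θ *_) (W-level flat) ⟩
              θ * θ ∎
              where
              ring₁ : ∀ w a b → w * (a * b) ≡ a * (w * b)
              ring₁ = solve-∀
              ring₂ : ∀ x θ w → x * (θ * w) ≡ θ * (w * x)
              ring₂ = solve-∀

            -- Apply `W` to both sides of `sc-formula`: the square of χ gives θ², the constant
            -- function gives 0 and the indicator of e gives 1.
            quadratic : ∀ {s t θ} → Flat (λ _ → 1ℤ) s 0ℤ →
                        Flat χ t θ →
                        θ * θ ≡ k - μ + (λ′ - μ) * θ
            quadratic {s} {t} {θ} flat₁ flat = begin
              θ * θ
                ≡⟨ W-convolution flat ⟨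
              W sc
                ≡⟨ ∑-cong elems (λ z → trans (cong (w (ψ z) *_) (sc-formula z))
                     (ring₁ (w (ψ z)) k λ′ μ (χ z) (𝟙 (z ≟G e)))) ⟩
              ∑G (λ z → μ * (w (ψ z) * 1ℤ) + (λ′ - μ) * (w (ψ z) * χ z) + 𝟙 (z ≟G e) * ((k - μ) * w (ψ z)))
                ≡⟨ ∑-+ elems (λ z → μ * (w (ψ z) * 1ℤ) + (λ′ - μ) * (w (ψ z) * χ z)) (λ z → 𝟙 (z ≟G e) * ((k - μ) * w (ψ z))) ⟩
              ∑G (λ z → μ * (w (ψ z) * 1ℤ) + (λ′ - μ) * (w (ψ z) * χ z)) + ∑G (λ z → 𝟙 (z ≟G e) * ((k - μ) * w (ψ z)))
                ≡⟨ cong₂ _+_ (∑-+ elems (λ z → μ * (w (ψ z) * 1ℤ)) (λ z → (λ′ - μ) * (w (ψ z) * χ z)))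
                             (pick enumG e (λ z → (k - μ) * w (ψ z))) ⟩
              ∑G (λ z → μ * (w (ψ z) * 1ℤ)) + ∑G (λ z → (λ′ - μ) * (w (ψ z) * χ z)) + (k - μ) * w (ψ e)
                ≡⟨ cong₂ _+_ (cong₂ _+_ (∑-*ˡ elems μ (λ z → w (ψ z) * 1ℤ)) (∑-*ˡ elems (λ′ - μ) (λ z → w (ψ z) * χ z)))
                             (cong ((k - μ) *_) (trans (cong w ψ-e) w-0)) ⟩
              μ * W (λ _ → 1ℤ) + (λ′ - μ) * W χ + (k - μ) * 1ℤ
                ≡⟨ cong₂ (λ a b → μ * a + (λ′ - μ) * b + (k - μ) * 1ℤ) (W-level flat₁) (W-level flat) ⟩
              μ * 0ℤ + (λ′ - μ) * θ + (k - μ) * 1ℤ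
                ≡⟨ ring₂ k λ′ μ θ ⟩
              k - μ + (λ′ - μ) * θ ∎
              where
              ring₁ : ∀ w k l m x d → w * (m + (l - m) * x + (k - m) * d) ≡ m * (w * 1ℤ) + (l - m) * (w * x) + d * ((k - m) * w)
              ring₁ = solve-∀
              ring₂ : ∀ k l m θ → m * 0ℤ + (l - m) * θ + (k - m) * 1ℤ ≡ k - m + (l - m) * θ
              ring₂ = solve-∀

-- The colouring attached to a primitive rational S-ring.

module BasicSetColouring where

  import Data.Bool.Properties as Bool
  open import Data.Integer using (_+_; _*_)
  open import Data.Nat.Coprimality using (Coprime; coprime-divisor)
  open import Data.Nat.Divisibility using (_∣_; divides; ∣-trans; n∣m⇒m%n≡0; m%n≡0⇒n∣m; ∣-refl)
  open import Data.Nat.Primality using (prime⇒irreducible; prime⇒nonTrivial; ¬prime[1]; prime[2])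
  open import Relation.Nullary.Decidable using (_×-dec_; decidable-stable; dec-true; dec-false)
  open FiniteSums
  open Frobenius
  open PrimePlane
  open Multiplicities
  open Colourings
  open SRings

  open ≡-Reasoning

  prime∣prime : ∀ {p q} → Prime p → Prime q → p ∣ q → p ≡ q
  prime∣prime pp qq p∣q with prime⇒irreducible qq p∣q
  ... | inj₁ refl = ⊥-elim (¬prime[1] pp)
  ... | inj₂ p≡q  = p≡q

  ∤⇒coprime : ∀ {p m} → Prime p → ¬ (p ∣ m) → Coprime m p
  ∤⇒coprime pp p∤m {d} (d∣m , d∣p) with prime⇒irreducible pp d∣p
  ... | inj₁ d≡1  = d≡1
  ... | inj₂ refl = ⊥-elim (p∤m d∣m)

  coprime-* : ∀ {m p q} → Coprime m p → Coprime m q → Coprime m (p ℕ.* q)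
  coprime-* m⊥p m⊥q {d} (d∣m , d∣pq) =
    m⊥q (d∣m , coprime-divisor (λ (k∣d , k∣p) → m⊥p (∣-trans k∣d d∣m , k∣p)) d∣pq)

  even-or-suc-even : ∀ n → 2 ∣ n ⊎ 2 ∣ suc n
  even-or-suc-even zero    = inj₁ (divides 0 refl)
  even-or-suc-even (suc n) with even-or-suc-even n
  ... | inj₁ (divides k refl) = inj₂ (divides (suc k) refl)
  ... | inj₂ 2∣1+n            = inj₁ 2∣1+n

  -- One of two consecutive numbers is even. This excludes |p - q| = 1, where an exceptional row and
  -- column could have equal weights.
  odd-primes-≢suc : ∀ {p q} → Prime p → Prime q → p ≢ 2 → q ≢ 2 → p ≢ suc q
  odd-primes-≢suc pp qq p≢2 q≢2 refl with even-or-suc-even _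
  ... | inj₁ 2∣q   = q≢2 (sym (prime∣prime prime[2] qq 2∣q))
  ... | inj₂ 2∣1+q = p≢2 (sym (prime∣prime prime[2] pp 2∣1+q))

  odd-prime-≥3 : ∀ {p} → Prime p → p ≢ 2 → 3 ℕ.≤ p
  odd-prime-≥3 {p} pp p≢2 = ℕ.≤∧≢⇒< (ℕ.nonTrivial⇒n>1 p {{prime⇒nonTrivial pp}}) (p≢2 ∘ sym)

  module Units (n : ℕ) (pn : Prime n) where

    open PrimeField n pn

    ∣⇒ι≡0 : ∀ {m} → n ∣ m → ι m ≡ 0#
    ∣⇒ι≡0 {m} n∣m = ι-cong (trans (n∣m⇒m%n≡0 m n n∣m) (sym (n∣m⇒m%n≡0 0 n (divides 0 refl))))

    ι≡0⇒∣ : ∀ {m} → ι m ≡ 0# → n ∣ m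
    ι≡0⇒∣ {m} eq = m%n≡0⇒n∣m m n
      (trans (ι-injective eq) (n∣m⇒m%n≡0 0 n (divides 0 refl)))

  module _ {p q : ℕ} (pp : Prime p) (qq : Prime q) (p≢q : p ≢ q) where

    private
      module P = PrimeField p pp
      module Q = PrimeField q qq

    ι-prime≢0 : P.ι q ≢ P.0#
    ι-prime≢0 eq = p≢q (prime∣prime pp qq (Units.ι≡0⇒∣ p pp eq))

    -- Chinese remainders with an explicit solution m = 1 + t q, where t is (s - 1)/q modulo p.
    -- Raising to the power m scales the p-part by s and fixes the q-part, so rationality allows the
    -- two parts to be scaled independently.
    unit-lift : ∀ s → s ≢ P.0# → ∃ λ m → P.ι m ≡ s × Q.ι m ≡ Q.1# × Coprime m (p ℕ.* q)
    unit-lift s s≢0 with P.inverse (P.ι q) ι-prime≢0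
    ... | u , qu≡1 = m , m≡s , m≡1 , coprime-*
            (∤⇒coprime pp (λ p∣m → s≢0 (trans (sym m≡s) (Units.∣⇒ι≡0 p pp p∣m))))
            (∤⇒coprime qq (λ q∣m → Q.1≢0 (trans (sym m≡1) (Units.∣⇒ι≡0 q qq q∣m))))
      where
      t = u P.⊗ (P.⊖ P.1# P.⊕ s)
      m = 1 ℕ.+ toℕ t ℕ.* q

      m≡1 : Q.ι m ≡ Q.1#
      m≡1 = Q.ι-+kn 1 (toℕ t)

      m≡s : P.ι m ≡ s
      m≡s = begin
        P.ι (1 ℕ.+ toℕ t ℕ.* q)                 ≡⟨ P.ι-+ 1 _ ⟩
        P.1# P.⊕ P.ι (toℕ t ℕ.* q)              ≡⟨ cong (λ x → P.1# P.⊕ P.ι x) (ℕ.*-comm (toℕ t) q) ⟩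
        P.1# P.⊕ P.ι (q ℕ.* toℕ t)              ≡⟨ cong (P.1# P.⊕_) (P.scale-⊗ q t) ⟩
        P.1# P.⊕ P.ι q P.⊗ t                    ≡⟨ cong (P.1# P.⊕_) (P.⊗-inverse-cancel u (P.ι q) (trans (P.⊗-comm u (P.ι q)) qu≡1) _) ⟩
        P.1# P.⊕ (P.⊖ P.1# P.⊕ s)               ≡⟨ P.⊕-⊖-cancel P.1# s ⟩
        s ∎


  module Assembly (p q : ℕ) (pp : Prime p) (qq : Prime q) (p≢q : p ≢ q) where

    open GroupG p q pp qq

    ψP : P.Direction → G → Fin p
    ψP l = P.ψ l ∘ p-part
    ψQ : Q.Direction → G → Fin q
    ψQ m = Q.ψ m ∘ q-part

    -- The target is part of the data, so that forms on the p-part and on the q-part can be paired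
    -- in `ker`.
    record Hom : Set where
      field
        {target} : ℕ
        isPrime  : Prime target
      open PrimeField target isPrime public
      field
        map      : G → Fin target
        map-·    : ∀ x y → map (x · y) ≡ map x ⊕ map y
        map-e    : map e ≡ 0#

      Kernel : G → Set
      Kernel x = map x ≡ 0#

      map-inv : ∀ x → map x ≡ 0# → map (inv x) ≡ 0#
      map-inv x x∈ker = begin
        map (inv x)             ≡⟨ ⊕-identityʳ _ ⟨
        map (inv x) ⊕ 0#        ≡⟨ cong (map (inv x) ⊕_) x∈ker ⟨
        map (inv x) ⊕ map x     ≡⟨ map-· (inv x) x ⟨
        map (inv x · x)         ≡⟨ cong map (·-inverseˡ x) ⟩
        map e                   ≡⟨ map-e ⟩
        0# ∎

    homP : P.Direction → Hom
    homP l = record { isPrime = pp ; map = ψP l ; map-· = λ x y → P.ψ-⊞ l (p-part x) (p-part y) ; map-e = P.ψ-𝟎 l }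
    homQ : Q.Direction → Hom
    homQ m = record { isPrime = qq ; map = ψQ m ; map-· = λ x y → Q.ψ-⊞ m (q-part x) (q-part y) ; map-e = Q.ψ-𝟎 m }

    module _ (h h′ : Hom) where

      private
        module h = Hom h
        module h′ = Hom h′

      ker? : ∀ x → Dec (h.map x ≡ h.0# × h′.map x ≡ h′.0#)
      ker? x = (h.map x ≟F h.0#) ×-dec (h′.map x ≟F h′.0#)

      -- Covers three kinds of subgroups: two independent forms on one part cut out the other part,
      -- a form paired with itself a subgroup of prime index, and one form on each part a product A
      -- × B of order pq.
      ker : G → Bool
      ker x = does (ker? x)

      ker-elim : ∀ x → ker x ≡ true → h.map x ≡ h.0# × h′.map x ≡ h′.0#
      ker-elim x = does-true (ker? x)

      ker-intro : ∀ x → h.map x ≡ h.0# → h′.map x ≡ h′.0# → ker x ≡ true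
      ker-intro x eq eq′ = dec-true (ker? x) (eq , eq′)

      ker-subgroup : IsSubgroup ker
      ker-subgroup = record
        { has-e   = ker-intro e h.map-e h′.map-e
        ; has-mul = λ x y kx ky → let (x₁ , x₂) = ker-elim x kx ; (y₁ , y₂) = ker-elim y ky in
            ker-intro (x · y) (trans (h.map-· x y) (trans (cong₂ h._⊕_ x₁ y₁) (h.⊕-identityˡ h.0#)))
                              (trans (h′.map-· x y) (trans (cong₂ h′._⊕_ x₂ y₂) (h′.⊕-identityˡ h′.0#)))
        ; has-inv = λ x kx → let (x₁ , x₂) = ker-elim x kx in ker-intro (inv x) (h.map-inv x x₁) (h′.map-inv x x₂) }

      ker-proper : ∀ x → h.map x ≢ h.0# → ker x ≡ false
      ker-proper x ≢0 = dec-false (ker? x) (≢0 ∘ proj₁)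

    lineSubgroup : P.Direction → Q.Direction → G → Bool
    lineSubgroup l m = ker (homP l) (homQ m)

    lineSubgroup-order : ∀ l m → order (lineSubgroup l m) ≡ p ℕ.* q
    lineSubgroup-order l m = ℤ.+-injective (begin
      + order (lineSubgroup l m)
        ≡⟨ count-∑ _ _ ⟩
      ∑G (λ x → 𝟙 (lineSubgroup l m x Bool.≟ true))
        ≡⟨ ∑-cong elems (λ x → trans
             (𝟙-⇔ (lineSubgroup l m x Bool.≟ true) (ker? (homP l) (homQ m) x)
               (ker-elim (homP l) (homQ m) x) (dec-true (ker? (homP l) (homQ m) x)))
             (𝟙-× (ψP l x ≟F P.0#) (ψQ m x ≟F Q.0#))) ⟩
      ∑G (λ x → 𝟙 (ψP l x ≟F P.0#) * 𝟙 (ψQ m x ≟F Q.0#))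
        ≡⟨ ∑G-⋈ _ ⟩
      P.∑V (λ u → Q.∑V (λ y → 𝟙 (P.ψ l u ≟F P.0#) * 𝟙 (Q.ψ m y ≟F Q.0#)))
        ≡⟨ P.∑V-cong (λ u → trans (Q.∑V-*ˡ (𝟙 (P.ψ l u ≟F P.0#)) _) (cong (𝟙 (P.ψ l u ≟F P.0#) *_) (trans
             (Q.∑V-cong (λ y → sym (ℤ.*-identityʳ (𝟙 (Q.ψ m y ≟F Q.0#))))) (Q.∑V-level-const m Q.0# 1ℤ)))) ⟩
      P.∑V (λ u → 𝟙 (P.ψ l u ≟F P.0#) * (+ q * 1ℤ + 0ℤ * 𝟙 (Q.0# ≟F Q.0#)))
        ≡⟨ P.∑V-level-const l P.0# _ ⟩
      + p * (+ q * 1ℤ + 0ℤ * 𝟙 (Q.0# ≟F Q.0#)) + 0ℤ * 𝟙 (P.0# ≟F P.0#)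
        ≡⟨ ring (+ p) (+ q) (𝟙 (Q.0# ≟F Q.0#)) (𝟙 (P.0# ≟F P.0#)) ⟩
      + p * + q
        ≡⟨ ℤ.pos-* p q ⟨
      + (p ℕ.* q) ∎)
      where
      ring : ∀ p q x y → p * (q * 1ℤ + 0ℤ * x) + 0ℤ * y ≡ p * q
      ring = solve-∀

    module FromSRing {r : ℕ} (c : G → Fin r) (isSRing : IsSRing c)
                     (isPrimitive : IsPrimitive c) (isRational : IsRational c) where

      open SRing c isSRing
      open IsSRing isSRing

      escape : (K : G → Bool) → IsSubgroup K → (∃ λ y → K y ≡ false) → ∀ x → x ≢ e → ∃ λ w → c w ≡ c x × K w ≡ false
      escape K K-subgroup proper x x≢e with any-G? (λ w → (c w ≟F c x) ×-dec (K w Bool.≟ false))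
      ... | yes found = found
      ... | no none   = ⊥-elim (class⊄subgroup isPrimitive K K-subgroup proper x x≢e
              (λ w w~x → Bool.¬-not (λ Kw≡false → none (w , w~x , Kw≡false))))

      scale-p : ∀ {s} → s ≢ P.0# → ∀ u y → c (s P.∙ u ⋈ y) ≡ c (u ⋈ y)
      scale-p {s} s≢0 u y = go (unit-lift pp qq p≢q s s≢0)
        where
        go : (∃ λ m → P.ι m ≡ s × Q.ι m ≡ Q.1# × Coprime m (p ℕ.* q)) → c (s P.∙ u ⋈ y) ≡ c (u ⋈ y)
        go (m , refl , m≡1 , m⊥pq) = begin
          c (P.ι m P.∙ u ⋈ y)              ≡⟨ cong (λ v → c (P.ι m P.∙ u ⋈ v)) (trans (cong (Q._∙ y) m≡1) (Q.1-∙ y)) ⟨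
          c (P.ι m P.∙ u ⋈ Q.ι m Q.∙ y)    ≡⟨ cong c (pow-⋈ u y m) ⟨
          c (pow (u ⋈ y) m)                ≡⟨ proj₁ (isRational m m⊥pq (c (u ⋈ y))) (u ⋈ y) refl ⟩
          c (u ⋈ y) ∎

      scale-q : ∀ {t} → t ≢ Q.0# → ∀ u y → c (u ⋈ t Q.∙ y) ≡ c (u ⋈ y)
      scale-q {t} t≢0 u y = go (unit-lift qq pp (p≢q ∘ sym) t t≢0)
        where
        go : (∃ λ m → Q.ι m ≡ t × P.ι m ≡ P.1# × Coprime m (q ℕ.* p)) → c (u ⋈ t Q.∙ y) ≡ c (u ⋈ y)
        go (m , refl , m≡1 , m⊥qp) = begin
          c (u ⋈ Q.ι m Q.∙ y)              ≡⟨ cong (λ v → c (v ⋈ Q.ι m Q.∙ y)) (trans (cong (P._∙ u) m≡1) (P.1-∙ u)) ⟨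
          c (P.ι m P.∙ u ⋈ Q.ι m Q.∙ y)    ≡⟨ cong c (pow-⋈ u y m) ⟨
          c (pow (u ⋈ y) m)                ≡⟨ proj₁ (isRational m (subst (Coprime m) (ℕ.*-comm q p) m⊥qp) (c (u ⋈ y))) (u ⋈ y) refl ⟩
          c (u ⋈ y) ∎

      E : P.Direction → Q.Direction → Fin r
      E l m = c (P.rep l ⋈ Q.rep m)
      vA : P.Direction → Fin r
      vA l = c (P.rep l ⋈ Q.𝟎)
      vB : Q.Direction → Fin r
      vB m = c (P.𝟎 ⋈ Q.rep m)

      ι-self-p : P.ι p ≡ P.0#
      ι-self-p = Units.∣⇒ι≡0 p pp ∣-refl
      ι-self-q : Q.ι q ≡ Q.0#
      ι-self-q = Units.∣⇒ι≡0 q qq ∣-refl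

      pow-p : ∀ u y → pow (u ⋈ y) p ≡ P.𝟎 ⋈ Q.ι p Q.∙ y
      pow-p u y = trans (pow-⋈ u y p) (cong (_⋈ Q.ι p Q.∙ y) (trans (cong (P._∙ u) ι-self-p) (P.0-∙ u)))
      pow-q : ∀ u y → pow (u ⋈ y) q ≡ P.ι q P.∙ u ⋈ Q.𝟎
      pow-q u y = trans (pow-⋈ u y q) (cong (P.ι q P.∙ u ⋈_) (trans (cong (Q._∙ y) ι-self-q) (Q.0-∙ y)))

      ι-p≢0 : Q.ι p ≢ Q.0#
      ι-p≢0 = ι-prime≢0 qq pp (p≢q ∘ sym)
      ι-q≢0 : P.ι q ≢ P.0#
      ι-q≢0 = ι-prime≢0 pp qq p≢q

      -- The p-th power map kills the p-part and is injective on the q-part, so the p-th roots of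
      -- the element in question are those with q-part `y`.
      roots-fibre-p : ∀ i y → roots p pp i (P.𝟎 ⋈ Q.ι p Q.∙ y) ≡ P.∑V (λ u → 𝟙 (c (u ⋈ y) ≟F i))
      roots-fibre-p i y = trans (∑G-⋈ _) (P.∑V-cong (λ u → trans
        (Q.∑V-zero-except y _ (λ y′ y′≢y → trans (cong (𝟙 (c (u ⋈ y′) ≟F i) *_) (𝟙-no (pow (u ⋈ y′) p ≟G z) (λ eq →
          y′≢y (Q.∙-injective ι-p≢0 (cong q-part (trans (sym (pow-p u y′)) eq)))))) (ℤ.*-zeroʳ (𝟙 (c (u ⋈ y′) ≟F i)))))
        (trans (cong (𝟙 (c (u ⋈ y) ≟F i) *_) (𝟙-yes (pow (u ⋈ y) p ≟G z) (pow-p u y))) (ℤ.*-identityʳ _))))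
        where z = P.𝟎 ⋈ Q.ι p Q.∙ y

      roots-fibre-q : ∀ i u → roots q qq i (P.ι q P.∙ u ⋈ Q.𝟎) ≡ Q.∑V (λ y → 𝟙 (c (u ⋈ y) ≟F i))
      roots-fibre-q i u = trans (∑G-⋈ _) (trans (∑V-swap pp qq _) (Q.∑V-cong (λ y → trans
        (P.∑V-zero-except u _ (λ u′ u′≢u → trans (cong (𝟙 (c (u′ ⋈ y) ≟F i) *_) (𝟙-no (pow (u′ ⋈ y) q ≟G z) (λ eq →
          u′≢u (P.∙-injective ι-q≢0 (cong p-part (trans (sym (pow-q u′ y)) eq)))))) (ℤ.*-zeroʳ (𝟙 (c (u′ ⋈ y) ≟F i)))))
        (trans (cong (𝟙 (c (u ⋈ y) ≟F i) *_) (𝟙-yes (pow (u ⋈ y) q ≟G z) (pow-q u y))) (ℤ.*-identityʳ _)))))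
        where z = P.ι q P.∙ u ⋈ Q.𝟎

      -- By primitivity the basic set of `z` contains some `w` outside the kernel. All n-th powers
      -- lie inside, so `w` has no roots, and modulo n the count at `z` is the same.
      roots-vanish : ∀ n (pn : Prime n) i (h h′ : Hom) → (∀ x → ker h h′ (pow x n) ≡ true) → (∃ λ y → ker h h′ y ≡ false) →
                     ∀ z → z ≢ e → Congruence._≋_ n (roots n pn i z) 0ℤ
      roots-vanish n pn i h h′ powers proper z z≢e with escape (ker h h′) (ker-subgroup h h′) proper z z≢e
      ... | w , w~z , Kw≡false = Congruence.≋-trans n (roots-class n pn i z w (sym w~z)) (Congruence.≋-reflexive n
              (decidable-stable (roots n pn i w ℤ.≟ 0ℤ) (λ ≢0 → outside (roots-witness n pn i w ≢0))))
        where
        outside : (∃ λ x → pow x n ≡ w) → ⊥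
        outside (x , refl) = Bool.not-¬ (powers x) Kw≡false

      column-congruence : ∀ m i → Congruence._≋_ p (P.∑V (λ u → 𝟙 (c (u ⋈ Q.rep m) ≟F i))) 0ℤ
      column-congruence m i = subst (λ x → Congruence._≋_ p x 0ℤ) (roots-fibre-p i (Q.rep m))
        -- The forms for `zero` and `suc P.0#` belong to distinct lines, so their common kernel is
        -- C_q², which contains all p-th powers.
        (roots-vanish p pp i (homP zero) (homP (suc P.0#))
          (λ x → let z≡𝟎 = cong p-part (pow-p (p-part x) (q-part x)) in
             ker-intro (homP zero) (homP (suc P.0#)) (pow x p)
               (trans (cong (P.ψ zero) z≡𝟎) (P.ψ-𝟎 zero)) (trans (cong (P.ψ (suc P.0#)) z≡𝟎) (P.ψ-𝟎 (suc P.0#))))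
          (P.rep (suc P.0#) ⋈ Q.𝟎 , ker-proper (homP zero) (homP (suc P.0#)) (P.rep (suc P.0#) ⋈ Q.𝟎) P.1≢0)
          _ (λ eq → Q.rep≢𝟎 m (Q.∙-injective ι-p≢0 (trans (cong q-part eq) (sym (Q.∙-𝟎 (Q.ι p)))))))

      row-congruence : ∀ l i → Congruence._≋_ q (Q.∑V (λ y → 𝟙 (c (P.rep l ⋈ y) ≟F i))) 0ℤ
      row-congruence l i = subst (λ x → Congruence._≋_ q x 0ℤ) (roots-fibre-q i (P.rep l))
        (roots-vanish q qq i (homQ zero) (homQ (suc Q.0#))
          (λ x → let z≡𝟎 = cong q-part (pow-q (p-part x) (q-part x)) in
             ker-intro (homQ zero) (homQ (suc Q.0#)) (pow x q)
               (trans (cong (Q.ψ zero) z≡𝟎) (Q.ψ-𝟎 zero)) (trans (cong (Q.ψ (suc Q.0#)) z≡𝟎) (Q.ψ-𝟎 (suc Q.0#))))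
          (P.𝟎 ⋈ Q.rep (suc Q.0#) , ker-proper (homQ zero) (homQ (suc Q.0#)) (P.𝟎 ⋈ Q.rep (suc Q.0#)) Q.1≢0)
          _ (λ eq → P.rep≢𝟎 l (P.∙-injective ι-q≢0 (trans (cong p-part eq) (sym (P.∙-𝟎 (P.ι q)))))))

      abstract
        -- Scaling the p-part preserves colours, so the fibre count above `Q.rep m` becomes the
        -- indicator of the vertex plus p - 1 times the number of edges of that colour: the
        -- expression that `all-but-one-equal` expects.
        column : ∀ m → ∃₂ λ l₀ d → E l₀ m ≡ vB m × (∀ l → l ≢ l₀ → E l m ≡ d)
        column m = all-but-one-equal P.1<n (λ l → E l m) (vB m) (λ i →
          subst (λ x → Congruence._≋_ p x 0ℤ)
            (P.∑V-homogeneous {λ u → 𝟙 (c (u ⋈ Q.rep m) ≟F i)} (λ s u s≢0 → cong (λ j → 𝟙 (j ≟F i)) (scale-p s≢0 u (Q.rep m))))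
            (column-congruence m i))

        row : ∀ l → ∃₂ λ m₀ d → E l m₀ ≡ vA l × (∀ m → m ≢ m₀ → E l m ≡ d)
        row l = all-but-one-equal Q.1<n (E l) (vA l) (λ i →
          subst (λ x → Congruence._≋_ q x 0ℤ)
            (Q.∑V-homogeneous {λ y → 𝟙 (c (P.rep l ⋈ y) ≟F i)} (λ t y t≢0 → cong (λ j → 𝟙 (j ≟F i)) (scale-q t≢0 (P.rep l) y)))
            (row-congruence l i))

      colouring : Colouring r (suc p) (suc q)
      colouring = record
        { E = E ; vA = vA ; vB = vB
        ; sA = λ l → proj₁ (row l) ; dA = λ l → proj₁ (proj₂ (row l))
        ; A-special = λ l → proj₁ (proj₂ (proj₂ (row l))) ; A-major = λ l → proj₂ (proj₂ (proj₂ (row l)))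
        ; sB = λ m → proj₁ (column m) ; dB = λ m → proj₁ (proj₂ (column m))
        ; B-special = λ m → proj₁ (proj₂ (proj₂ (column m))) ; B-major = λ l m → proj₂ (proj₂ (proj₂ (column m))) l }

      E≢o : ∀ l m → E l m ≢ c e
      E≢o l m eq = P.rep≢𝟎 l (cong p-part (identity _ eq))

-- The basic set of a minor colour as a union of subgroups.

module Conclusion where

  import Data.Bool.Properties as Bool
  open import Data.Integer using (_+_; _*_; _-_)
  open import Data.List using (filter; length; lookup)
  open import Data.List.Membership.Propositional using (_∈_)
  open import Data.List.Membership.Propositional.Properties using (∈-filter⁺; ∈-filter⁻; ∈-lookup; ∈-allFin)
  import Data.List.Relation.Unary.All as All
  open import Data.List.Relation.Unary.AllPairs using (_∷_)
  open import Data.List.Relation.Unary.Any using (index)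
  open import Data.List.Relation.Unary.Any.Properties using (lookup-index)
  open import Data.List.Relation.Unary.Unique.Propositional using (Unique)
  import Data.List.Relation.Unary.Unique.Propositional.Properties as Unique
  open import Function using (mk⇔)
  open FiniteSums
  open PrimePlane
  open Colourings
  open WeightSpectrum
  open SRings
  open RankThreeSRings
  open BasicSetColouring

  lookup-injective : ∀ {A : Set} {xs : List A} → Unique xs → ∀ i j → lookup xs i ≡ lookup xs j → i ≡ j
  lookup-injective (_   ∷ _) zero    zero    _  = refl
  lookup-injective (x∉  ∷ _) zero    (suc j) eq = ⊥-elim (All.lookup x∉ (∈-lookup j) eq)
  lookup-injective (x∉  ∷ _) (suc i) zero    eq = ⊥-elim (All.lookup x∉ (∈-lookup i) (sym eq))
  lookup-injective (_   ∷ u) (suc i) (suc j) eq = cong suc (lookup-injective u i j eq)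

  module Final (p q : ℕ) (pp : Prime p) (qq : Prime q) (p≢q : p ≢ q) where

    open GroupG p q pp qq
    open Eigenvalues p q pp qq
    open Assembly p q pp qq p≢q

    module MatchingSet {r : ℕ} (c : G → Fin r) (isSRing : IsSRing c)
                       (isPrimitive : IsPrimitive c) (isRational : IsRational c) where

      open SRing c isSRing
      open IsSRing isSRing
      open FromSRing c isSRing isPrimitive isRational renaming (colouring to C)
      open Colouring C hiding (E; vA; vB)
      open Weights C

      data Position : G → Set where
        origin : Position e
        onP    : ∀ s l → s ≢ P.0# → Position (s P.∙ P.rep l ⋈ Q.𝟎)
        onQ    : ∀ t m → t ≢ Q.0# → Position (P.𝟎 ⋈ t Q.∙ Q.rep m)
        mixed  : ∀ s l t m → s ≢ P.0# → t ≢ Q.0# → Position (s P.∙ P.rep l ⋈ t Q.∙ Q.rep m)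

      position : ∀ x → Position x
      position x = go (P.direction (p-part x)) (Q.direction (q-part x))
        where
        go : ∀ {u y} → u ≡ P.𝟎 ⊎ (∃₂ λ s l → s ≢ P.0# × u ≡ s P.∙ P.rep l) →
             y ≡ Q.𝟎 ⊎ (∃₂ λ t m → t ≢ Q.0# × y ≡ t Q.∙ Q.rep m) → Position (u ⋈ y)
        go (inj₁ refl)                   (inj₁ refl)                   = origin
        go (inj₂ (s , l , s≢0 , refl))   (inj₁ refl)                   = onP s l s≢0
        go (inj₁ refl)                   (inj₂ (t , m , t≢0 , refl))   = onQ t m t≢0
        go (inj₂ (s , l , s≢0 , refl))   (inj₂ (t , m , t≢0 , refl))   = mixed s l t m s≢0 t≢0

      c-mixed : ∀ s l t m → s ≢ P.0# → t ≢ Q.0# → c (s P.∙ P.rep l ⋈ t Q.∙ Q.rep m) ≡ E l m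
      c-mixed s l t m s≢0 t≢0 = trans (scale-p s≢0 (P.rep l) _) (scale-q t≢0 (P.rep l) (Q.rep m))

      outside-row : ∀ i → i ≢ c e → ∀ h → (∃ λ y → ker h h y ≡ false) →
                    ∃ λ w → c w ≡ i × ¬ Hom.Kernel h w
      outside-row i i≢o h proper with partition i
      ... | x , refl with escape (ker h h) (ker-subgroup h h) proper x (i≢o ∘ cong c)
      ... | w , w~x , Kw≡false = w , w~x , λ eq → Bool.not-¬ (ker-intro h h w eq eq) Kw≡false

      -- Primitivity provides an element of colour `i` outside A × C_q², where A is the line `l⋆`.
      -- If it lies on an edge, that edge serves; if it lies on a vertex of the p-side, the special
      -- edge of the vertex has the same colour.
      spreadA : Spread C (c e)
      spreadA i i≢o l⋆ with avoid l⋆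
        where
        avoid : ∀ l → ∃ λ l′ → l ≢ l′
        avoid zero    = suc P.0# , λ ()
        avoid (suc t) = zero , λ ()
      ... | l′ , l⋆≢l′ with outside-row i i≢o (homP l⋆)
                            (P.rep l′ ⋈ Q.𝟎 , ker-proper (homP l⋆) (homP l⋆) (P.rep l′ ⋈ Q.𝟎) (P.ψ-rep-other l⋆≢l′))
      ... | w , refl , w∉ with position w
      ... | origin              = ⊥-elim (w∉ (P.ψ-𝟎 l⋆))
      ... | onP s l s≢0         = l , sA l , (λ { refl → w∉ (P.ψ-line l s) })
                                , trans (A-special l) (sym (scale-p s≢0 (P.rep l) Q.𝟎))
      ... | onQ t m t≢0         = ⊥-elim (w∉ (P.ψ-𝟎 l⋆))
      ... | mixed s l t m s≢0 t≢0 = l , m , (λ { refl → w∉ (P.ψ-line l s) }) , sym (c-mixed s l t m s≢0 t≢0)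

      spreadB : Spread (transpose C) (c e)
      spreadB i i≢o m⋆ with avoid m⋆
        where
        avoid : ∀ m → ∃ λ m′ → m ≢ m′
        avoid zero    = suc Q.0# , λ ()
        avoid (suc t) = zero , λ ()
      ... | m′ , m⋆≢m′ with outside-row i i≢o (homQ m⋆)
                            (P.𝟎 ⋈ Q.rep m′ , ker-proper (homQ m⋆) (homQ m⋆) (P.𝟎 ⋈ Q.rep m′) (Q.ψ-rep-other m⋆≢m′))
      ... | w , refl , w∉ with position w
      ... | origin              = ⊥-elim (w∉ (Q.ψ-𝟎 m⋆))
      ... | onP s l s≢0         = ⊥-elim (w∉ (Q.ψ-𝟎 m⋆))
      ... | onQ t m t≢0         = m , sB m , (λ { refl → w∉ (Q.ψ-line m t) })
                                , trans (B-special m) (sym (scale-q t≢0 P.𝟎 (Q.rep m)))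
      ... | mixed s l t m s≢0 t≢0 = m , l , (λ { refl → w∉ (Q.ψ-line m t) }) , sym (c-mixed s l t m s≢0 t≢0)

      module _ (X Y : Fin r) (X≢Y : X ≢ Y) (X≢o : X ≢ c e) (Y≢o : Y ≢ c e)
               (colours : ∀ i → i ≡ c e ⊎ i ≡ Y ⊎ i ≡ X) where

        open RankThree c isSRing X Y X≢Y X≢o Y≢o colours

        -- The push-forward of χ to C_p². Its Fourier value at `l` is the value at the basic set `X`
        -- of a character trivial on C_q² and on the line `l`; rationality makes it an integer.
        JP : P.V → ℤ
        JP u = Q.∑V (λ y → χ (u ⋈ y))
        JQ : Q.V → ℤ
        JQ y = P.∑V (λ u → χ (u ⋈ y))

        JP-homogeneous : P.Homogeneous JP
        JP-homogeneous s u s≢0 = Q.∑V-cong (λ y → cong (λ i → 𝟙 (i ≟F X)) (scale-p s≢0 u y))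
        JQ-homogeneous : Q.Homogeneous JQ
        JQ-homogeneous t y t≢0 = P.∑V-cong (λ u → cong (λ i → 𝟙 (i ≟F X)) (scale-q t≢0 u y))

        JP-formula : ∀ u → JP u ≡ χ (u ⋈ Q.𝟎) + (+ q - 1ℤ) * ∑ Q.directions (λ m → χ (u ⋈ Q.rep m))
        JP-formula u = Q.∑V-homogeneous {λ y → χ (u ⋈ y)} (λ t y t≢0 → cong (λ i → 𝟙 (i ≟F X)) (scale-q t≢0 u y))
        JQ-formula : ∀ y → JQ y ≡ χ (P.𝟎 ⋈ y) + (+ p - 1ℤ) * ∑ P.directions (λ l → χ (P.rep l ⋈ y))
        JQ-formula y = P.∑V-homogeneous {λ u → χ (u ⋈ y)} (λ s u s≢0 → cong (λ i → 𝟙 (i ≟F X)) (scale-p s≢0 u y))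

        χ-e : χ e ≡ 0ℤ
        χ-e = 𝟙-no (c e ≟F X) (X≢o ∘ sym)

        JP-𝟎 : JP P.𝟎 ≡ (+ q - 1ℤ) * #vB C X
        JP-𝟎 = trans (JP-formula P.𝟎) (trans (cong (λ a → a + (+ q - 1ℤ) * #vB C X) χ-e) (ℤ.+-identityˡ _))
        JQ-𝟎 : JQ Q.𝟎 ≡ (+ p - 1ℤ) * #vA C X
        JQ-𝟎 = trans (JQ-formula Q.𝟎) (trans (cong (λ a → a + (+ p - 1ℤ) * #vA C X) χ-e) (ℤ.+-identityˡ _))

        levelP : ∀ (f : G → ℤ) l j → ∑G (λ x → 𝟙 (ψP l x ≟F j) * f x) ≡ P.∑V (λ u → 𝟙 (P.ψ l u ≟F j) * Q.∑V (λ y → f (u ⋈ y)))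
        levelP f l j = trans (∑G-⋈ _) (P.∑V-cong (λ u → Q.∑V-*ˡ (𝟙 (P.ψ l u ≟F j)) (λ y → f (u ⋈ y))))
        levelQ : ∀ (f : G → ℤ) m j → ∑G (λ x → 𝟙 (ψQ m x ≟F j) * f x) ≡ Q.∑V (λ y → 𝟙 (Q.ψ m y ≟F j) * P.∑V (λ u → f (u ⋈ y)))
        levelQ f m j = trans (∑G-⋈ _) (trans (∑V-swap pp qq _)
          (Q.∑V-cong (λ y → P.∑V-*ˡ (𝟙 (Q.ψ m y ≟F j)) (λ u → f (u ⋈ y)))))

        θ : Fin (suc p) ⊎ Fin (suc q) → ℤ
        θ (inj₁ l) = P.fourier JP-homogeneous l
        θ (inj₂ m) = Q.fourier JQ-homogeneous m

        θ-quadratic : ∀ x → θ x * θ x ≡ k - μ + (λ′ - μ) * θ x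
        θ-quadratic (inj₁ l) = quadratic p pp (ψP l) (Hom.map-· (homP l)) (Hom.map-e (homP l))
          {+ p * Q.∑V (λ _ → 1ℤ)} {P.background JP-homogeneous l} {P.fourier JP-homogeneous l}
          (mkFlat (λ j → trans (levelP (λ _ → 1ℤ) l j) (P.∑V-level-const l j (Q.∑V (λ _ → 1ℤ)))))
          (mkFlat (λ j → trans (levelP χ l j) (P.∑V-level JP-homogeneous l j)))
        θ-quadratic (inj₂ m) = quadratic q qq (ψQ m) (Hom.map-· (homQ m)) (Hom.map-e (homQ m))
          {+ q * P.∑V (λ _ → 1ℤ)} {Q.background JQ-homogeneous m} {Q.fourier JQ-homogeneous m}
          (mkFlat (λ j → trans (levelQ (λ _ → 1ℤ) m j) (Q.∑V-level-const m j (P.∑V (λ _ → 1ℤ)))))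
          (mkFlat (λ j → trans (levelQ χ m j) (Q.∑V-level JQ-homogeneous m j)))

        offset : ℤ
        offset = + p * #dB X - #vA C X

        θ-affine : ∀ x → θ x ≡ + p * + q * weight X x + offset
        θ-affine (inj₁ l) = trans
          (cong (λ a → a + + p * JP (P.rep l) - ∑ P.directions (JP ∘ P.rep)) JP-𝟎)
          (eigenvalue-weight C X (JP ∘ P.rep) (JP-formula ∘ P.rep) l)
        θ-affine (inj₂ m) = trans
          (cong (λ a → a + + q * JQ (Q.rep m) - ∑ Q.directions (JQ ∘ Q.rep)) JQ-𝟎)
          (trans (eigenvalue-weight (transpose C) X (JQ ∘ Q.rep) (JQ-formula ∘ Q.rep) m)
            (cong₂ _+_ (cong (_* weight X (inj₂ m)) (ℤ.*-comm (+ q) (+ p))) (offset-symmetric C X)))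

        two-valued : TwoValued X
        two-valued = quadratic⇒two-valued C X (k - μ) (λ′ - μ) offset θ θ-affine θ-quadratic {{P.nonZero}} {{Q.nonZero}}

      minor-colour : p ≢ 2 → q ≢ 2 → 3 ℕ.≤ r → ∃ λ f → f ≢ c e × (∀ l → dA l ≢ f) × (∀ m → dB m ≢ f)
      minor-colour p≢2 q≢2 3≤r = exists-minor-colour C (c e) (odd-prime-≥3 pp p≢2) (odd-prime-≥3 qq q≢2)
        p≢q (odd-primes-≢suc pp qq p≢2 q≢2) (odd-primes-≢suc qq pp q≢2 p≢2) 3≤r
        E≢o spreadA spreadB two-valued

      module _ (f : Fin r) (f≢o : f ≢ c e) (dA≢f : ∀ l → dA l ≢ f) (dB≢f : ∀ m → dB m ≢ f) where

        matched : List P.Direction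
        matched = filter (λ l → vA l ≟F f) (allFin (suc p))

        H : Fin (length matched) → G → Bool
        H k = lineSubgroup (lookup matched k) (sA (lookup matched k))

        vA-matched : ∀ k → vA (lookup matched k) ≡ f
        vA-matched k = proj₂ (∈-filter⁻ (λ l → vA l ≟F f) {xs = allFin (suc p)} (∈-lookup k))

        -- As `f` is nowhere major, an edge of this colour is special at both ends; each end thus
        -- has colour `f` and determines the other.
        edge-matched : ∀ l m → E l m ≡ f → vA l ≡ f × vB m ≡ f × m ≡ sA l × l ≡ sB m
        edge-matched l m E≡f =
          let E≢dA = λ eq → dA≢f l (trans (sym eq) E≡f)
              E≢dB = λ eq → dB≢f m (trans (sym eq) E≡f)
          in trans (sym (A-colour {l} {m} E≢dA)) E≡f , trans (sym (B-colour {l} {m} E≢dB)) E≡f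
             , A-minor {l} {m} E≢dA , B-minor {l} {m} E≢dB

        matching : ∀ {l} → vA l ≡ f → vB (sA l) ≡ f × l ≡ sB (sA l)
        matching {l} vA≡f with edge-matched l (sA l) (trans (A-special l) vA≡f)
        ... | _ , vB≡f , _ , l≡ = vB≡f , l≡

        H-disjoint : ∀ k k′ → k ≢ k′ → ∀ x → H k x ≡ true → H k′ x ≡ true → x ≡ e
        H-disjoint k k′ k≢k′ x Hx H′x =
          cong₂ _⋈_ (P.ψ-independent l l′ l≢l′ (p-part x) (proj₁ x∈) (proj₁ x∈′))
                    (Q.ψ-independent (sA l) (sA l′) m≢m′ (q-part x) (proj₂ x∈) (proj₂ x∈′))
          where
          l = lookup matched k
          l′ = lookup matched k′
          x∈ = ker-elim (homP l) (homQ (sA l)) x Hx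
          x∈′ = ker-elim (homP l′) (homQ (sA l′)) x H′x
          l≢l′ : l ≢ l′
          l≢l′ = k≢k′ ∘ lookup-injective (Unique.filter⁺ (λ l → vA l ≟F f) (Unique.allFin⁺ (suc p))) k k′
          -- `sB` recovers a matched row from its partner, so distinct rows have distinct partners.
          m≢m′ : sA l ≢ sA l′
          m≢m′ eq = l≢l′ (trans (proj₂ (matching (vA-matched k))) (trans (cong sB eq) (sym (proj₂ (matching (vA-matched k′))))))

        cover : ∀ {l} x → vA l ≡ f → ψP l x ≡ P.0# → ψQ (sA l) x ≡ Q.0# → ∃ λ k → H k x ≡ true
        cover {l} x vA≡f x∈ x∈′ = index l∈ , subst (λ l → lineSubgroup l (sA l) x ≡ true) (lookup-index l∈)
            (ker-intro (homP l) (homQ (sA l)) x x∈ x∈′)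
          where
          l∈ : l ∈ matched
          l∈ = ∈-filter⁺ (λ l → vA l ≟F f) (∈-allFin l) vA≡f

        covered : ∀ x → Position x → c x ≡ f → ∃ λ k → H k x ≡ true
        covered _ origin cx≡f = ⊥-elim (f≢o (sym cx≡f))
        covered _ (onP s l s≢0) cx≡f = cover {l} (s P.∙ P.rep l ⋈ Q.𝟎)
          (trans (sym (scale-p s≢0 (P.rep l) Q.𝟎)) cx≡f) (P.ψ-line l s) (Q.ψ-𝟎 (sA l))
        -- The subgroups are indexed by rows. A column of colour `f` is reached through its special
        -- edge, which also has colour `f` and leads to a matched row.
        covered _ (onQ t m t≢0) cx≡f = go (edge-matched (sB m) m
            (trans (B-special m) (trans (sym (scale-q t≢0 P.𝟎 (Q.rep m))) cx≡f)))
          where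
          go : vA (sB m) ≡ f × vB m ≡ f × m ≡ sA (sB m) × sB m ≡ sB m → _
          go (vA≡f , _ , m≡ , _) = cover {sB m} (P.𝟎 ⋈ t Q.∙ Q.rep m) vA≡f (P.ψ-𝟎 (sB m))
            (subst (λ m′ → Q.ψ m′ (t Q.∙ Q.rep m) ≡ Q.0#) m≡ (Q.ψ-line m t))
        covered _ (mixed s l t m s≢0 t≢0) cx≡f = go (edge-matched l m (trans (sym (c-mixed s l t m s≢0 t≢0)) cx≡f))
          where
          go : vA l ≡ f × vB m ≡ f × m ≡ sA l × l ≡ sB m → _
          go (vA≡f , _ , m≡ , _) = cover {l} (s P.∙ P.rep l ⋈ t Q.∙ Q.rep m) vA≡f (P.ψ-line l s)
            (subst (λ m′ → Q.ψ m′ (t Q.∙ Q.rep m) ≡ Q.0#) m≡ (Q.ψ-line m t))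

        to : ∀ x → c x ≡ f → x ≢ e × ∃ λ k → H k x ≡ true
        to x cx≡f = (λ { refl → f≢o (sym cx≡f) }) , covered x (position x) cx≡f

        -- A nontrivial element of A × B lies on A, on B or on the edge joining them, and the
        -- matching gives all three the colour `f`.
        from : ∀ x → x ≢ e → (∃ λ k → H k x ≡ true) → c x ≡ f
        from x x≢e (k , Hx) = go x (position x) x≢e (ker-elim (homP (lookup matched k)) (homQ (sA (lookup matched k))) x Hx)
          where
          l = lookup matched k
          go : ∀ x → Position x → x ≢ e → ψP l x ≡ P.0# × ψQ (sA l) x ≡ Q.0# → c x ≡ f
          go _ origin x≢e _ = ⊥-elim (x≢e refl)
          go _ (onP s l′ s≢0) _ (x∈ , _) = trans (scale-p s≢0 (P.rep l′) Q.𝟎)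
            (trans (cong vA (sym (P.ψ-kernel l l′ s≢0 x∈))) (vA-matched k))
          go _ (onQ t m′ t≢0) _ (_ , x∈) = trans (scale-q t≢0 P.𝟎 (Q.rep m′))
            (trans (cong vB (sym (Q.ψ-kernel (sA l) m′ t≢0 x∈))) (proj₁ (matching (vA-matched k))))
          go _ (mixed s l′ t m′ s≢0 t≢0) _ (x∈ , x∈′) = trans (c-mixed s l′ t m′ s≢0 t≢0)
            (trans (sym (cong₂ E (P.ψ-kernel l l′ s≢0 x∈) (Q.ψ-kernel (sA l) m′ t≢0 x∈′)))
              (trans (A-special l) (vA-matched k)))

      DisjointUnionOfSubgroups : Fin r → Set
      DisjointUnionOfSubgroups i = ∃ λ (m : ℕ) → ∃ λ (H : Fin m → G → Bool) →
        ((k : Fin m) → IsSubgroup (H k) × order (H k) ≡ p ℕ.* q) ×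
        ((k l : Fin m) → k ≢ l → (x : G) → H k x ≡ true → H l x ≡ true → x ≡ e) ×
        ((x : G) → (c x ≡ i) ⇔ (x ≢ e × ∃ λ k → H k x ≡ true))

      matching-class : (∃ λ f → f ≢ c e × (∀ l → dA l ≢ f) × (∀ m → dB m ≢ f)) → ∃ DisjointUnionOfSubgroups
      matching-class (f , f≢o , dA≢f , dB≢f) = f , length (matched f f≢o dA≢f dB≢f) , H f f≢o dA≢f dB≢f
        , (λ k → let l = lookup (matched f f≢o dA≢f dB≢f) k in
             ker-subgroup (homP l) (homQ (sA l)) , lineSubgroup-order l (sA l))
        , H-disjoint f f≢o dA≢f dB≢f
        , (λ x → mk⇔ (to f f≢o dA≢f dB≢f x) (λ (x≢e , x∈H) → from f f≢o dA≢f dB≢f x x≢e x∈H))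

open Conclusion
open import Data.Nat using (_*_; _≤_)

theorem6p4 : (p q : ℕ) (pp : Prime p) (qq : Prime q) → p ≢ q → p ≢ 2 → q ≢ 2 →
    let open Over p q pp qq in
    (r : ℕ) (c : G → Fin r) → IsSRing c → IsPrimitive c → IsRational c → 3 ≤ r →
    ∃ λ (i : Fin r) → ∃ λ (m : ℕ) → ∃ λ (H : Fin m → G → Bool) →
    ((k : Fin m) → IsSubgroup (H k) × order (H k) ≡ p * q) ×
    ((k l : Fin m) → k ≢ l → (x : G) → H k x ≡ true → H l x ≡ true → x ≡ e) ×
    ((x : G) → (c x ≡ i) ⇔ (x ≢ e × ∃ λ k → H k x ≡ true))
theorem6p4 p q pp qq p≢q p≢2 q≢2 r c isSRing isPrimitive isRational 3≤r =
  matching-class (minor-colour p≢2 q≢2 3≤r)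
  where open Final.MatchingSet p q pp qq p≢q c isSRing isPrimitive isRational
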